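{- Let $q$ be a prime power and let $k\ge 0$ be an integer. For each integer $n\ge 1$, let $\lambda_{q,n,k}$ be the number of elements $\alpha\in\mathbb{F}_{q^n}$ that are $k$-normal over $\mathbb{F}_q$, and set $\lambda_{q,k}(n)=\frac{\lambda_{q,n,k}}{q^n}$. Then there exists a real number $\overline{\lambda}_{q,k}\ge 0$ such that $$\overline{\lambda}_{q,k}=\lim_{t\to+\infty}\frac{1}{t}\sum_{1\le n\le t}\lambda_{q,k}(n).$$
   Context: $\mathbb{F}_{q^n}$ denotes the finite field with $q^n$ elements, viewed as an $\mathbb{F}_q$-vector space of dimension $n$. For an integer $0\le k\le n$, an element $\alpha\in\mathbb{F}_{q^n}$ is called $k$-normal over $\mathbb{F}_q$ if the $\mathbb{F}_q$-vector space generated by the set $\{\alpha,\alpha^q,\ldots,\alpha^{q^{n-1}}\}$ has dimension $n-k$. If $k>n$, no element of $\mathbb{F}_{q^n}$ is $k$-normal, so $\lambda_{q,n,k}=0$. The variable $t$ is a real number tending to infinity and $n$ ranges over positive integers. -}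

module Defs where

open import Algebra.Apartness.Bundles using (HeytingCommutativeRing; HeytingField)
open import Algebra.Bundles using (CommutativeRing; Ring)
open import Algebra.Module.Bundles using (LeftModule)
open import Algebra.Morphism.Structures using (module RingMorphisms)
import Algebra.Properties.Monoid.Sum as MonoidSum
import Algebra.Properties.Semiring.Exp as Exp
open import Data.Fin.Base using (Fin; toℕ; finToFun; funToFin)
import Data.Fin.Properties as Fin
open import Data.Integer.Base using (+_)
open import Data.Nat.Base as ℕ using (ℕ; zero; suc; _∸_; _^_)
open import Data.Nat.Primality using (Prime)
import Data.Nat.Properties as ℕ
open import Data.Product.Base using (∃; ∃₂; _×_; _,_; proj₁; proj₂)
open import Data.Sum.Base using (inj₁; inj₂)
open import Data.Rational.Base as ℚ using (ℚ; 0ℚ; 1ℚ; _/_)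
import Data.Rational.Properties as ℚ
open import Data.Rational.Solver using (module +-*-Solver)
open import Data.Vec.Base using (count; tabulate)
open import Data.Vec.Functional using (Vector)
import Data.Vec.Functional.Relation.Binary.Equality.Setoid as VecEquality
open import Function.Base using (_∘_)
open import Function.Bundles using (Inverse; Surjection)
open import Function.Properties.Inverse using (Inverse⇒Surjection)
open import Level using (Level; _⊔_) renaming (suc to lsuc)
open import Relation.Binary.Bundles using (Setoid)
open import Relation.Binary.Definitions using (_Respects_)
open import Relation.Binary.PropositionalEquality as ≡
  using (_≡_; _≢_; refl; cong; cong₂; subst)
open import Relation.Nullary.Decidable using (Dec; yes; no; map′; _×-dec_; _→-dec_)
open import Relation.Nullary.Negation using (contradiction)
open import Relation.Unary using (Pred; Decidable; _⊆_)

private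
  variable
    a c ℓ ℓ₁ ℓ₂ p r ℓr m ℓm : Level
    d n q : ℕ

-- A real number is given by any Cauchy sequence of rationals; the relations
-- _<ᴿ_ and _≤ᴿ_ do not distinguish sequences whose
-- difference tends to 0.
IsCauchy : (ℕ → ℚ) → Set
IsCauchy s =
  ∀ ε → 0ℚ ℚ.< ε → ∃ λ N → ∀ m n → N ℕ.≤ m → N ℕ.≤ n → ℚ.∣ s m ℚ.- s n ∣ ℚ.< ε

record ℝ : Set where
  constructor mkℝ
  field
    seq    : ℕ → ℚ
    cauchy : IsCauchy seq

open ℝ public

infix 4 _<ᴿ_ _≤ᴿ_

_<ᴿ_ : ℝ → ℝ → Set
x <ᴿ y =
  ∃ λ ε → 0ℚ ℚ.< ε × ∃ λ N → ∀ n → N ℕ.≤ n → seq x n ℚ.+ ε ℚ.≤ seq y n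

_≤ᴿ_ : ℝ → ℝ → Set
x ≤ᴿ y =
  ∀ ε → 0ℚ ℚ.< ε → ∃ λ N → ∀ n → N ℕ.≤ n → seq x n ℚ.≤ seq y n ℚ.+ ε

-- Total reciprocal, with value 0 at 0.
recip : ℚ → ℚ
recip x with x ℚ.≟ 0ℚ
... | yes _   = 0ℚ
... | no x≢0 = ℚ.1/_ x ⦃ ℚ.≢-nonZero x≢0 ⦄

recip-inverseˡ : ∀ x → x ≢ 0ℚ → recip x ℚ.* x ≡ 1ℚ
recip-inverseˡ x x≢0 with x ℚ.≟ 0ℚ
... | yes x≡0 = contradiction x≡0 x≢0
... | no x≢0′ = ℚ.*-inverseˡ x ⦃ ℚ.≢-nonZero x≢0′ ⦄

private
  open +-*-Solver using (solve; _:+_; _:-_; _:*_; :-_; _:=_)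

  >⇒≢0 : ∀ {x} → 0ℚ ℚ.< x → x ≢ 0ℚ
  >⇒≢0 0<x x≡0 = ℚ.<⇒≢ 0<x (≡.sym x≡0)

  recip-pos : ∀ {x} → 0ℚ ℚ.< x → 0ℚ ℚ.< recip x
  recip-pos {x} 0<x with x ℚ.≟ 0ℚ
  ... | yes x≡0 = contradiction x≡0 (>⇒≢0 0<x)
  ... | no x≢0 = ℚ.positive⁻¹ (ℚ.1/_ x ⦃ nz ⦄) ⦃ ℚ.1/pos⇒pos x ⦃ ℚ.positive 0<x ⦄ ⦄
    where nz = ℚ.≢-nonZero x≢0

  *-pos : ∀ {x y} → 0ℚ ℚ.< x → 0ℚ ℚ.< y → 0ℚ ℚ.< x ℚ.* y
  *-pos {x} {y} 0<x 0<y = ℚ.positive⁻¹ (x ℚ.* y) ⦃ ℚ.pos*pos⇒pos x ⦃ ℚ.positive 0<x ⦄ y ⦃ ℚ.positive 0<y ⦄ ⦄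

  *-mono-≤-nonNeg : ∀ {x y u v} → 0ℚ ℚ.≤ x → 0ℚ ℚ.≤ v → x ℚ.≤ y → u ℚ.≤ v → x ℚ.* u ℚ.≤ y ℚ.* v
  *-mono-≤-nonNeg {x} {y} {u} {v} 0≤x 0≤v x≤y u≤v = ℚ.≤-trans
    (ℚ.*-monoˡ-≤-nonNeg x ⦃ ℚ.nonNegative 0≤x ⦄ u≤v)
    (ℚ.*-monoʳ-≤-nonNeg v ⦃ ℚ.nonNegative 0≤v ⦄ x≤y)

  half : ∀ {ε} → 0ℚ ℚ.< ε → ∃ λ δ → 0ℚ ℚ.< δ × δ ℚ.+ δ ≡ ε
  half {ε} 0<ε = ℚ.½ ℚ.* ε , *-pos (ℚ.positive⁻¹ ℚ.½) 0<ε ,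
    ≡.trans (≡.sym (ℚ.*-distribʳ-+ ε ℚ.½ ℚ.½)) (ℚ.*-identityˡ ε)

  eventually-bounded : ∀ (x : ℝ) → ∃ λ B → 0ℚ ℚ.< B × ∃ λ N → ∀ n → N ℕ.≤ n → ℚ.∣ seq x n ∣ ℚ.≤ B
  eventually-bounded x with cauchy x 1ℚ (ℚ.positive⁻¹ 1ℚ)
  ... | N , near = 1ℚ ℚ.+ ℚ.∣ seq x N ∣
                 , ℚ.+-mono-<-≤ (ℚ.positive⁻¹ 1ℚ) (ℚ.0≤∣p∣ (seq x N))
                 , N , bound
    where
    bound : ∀ n → N ℕ.≤ n → ℚ.∣ seq x n ∣ ℚ.≤ 1ℚ ℚ.+ ℚ.∣ seq x N ∣
    bound n N≤n = begin
      ℚ.∣ seq x n ∣                                   ≡⟨ cong ℚ.∣_∣ (solve 2 (λ u v → u := (u :- v) :+ v) refl (seq x n) (seq x N)) ⟩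
      ℚ.∣ (seq x n ℚ.- seq x N) ℚ.+ seq x N ∣         ≤⟨ ℚ.∣p+q∣≤∣p∣+∣q∣ (seq x n ℚ.- seq x N) (seq x N) ⟩
      ℚ.∣ seq x n ℚ.- seq x N ∣ ℚ.+ ℚ.∣ seq x N ∣     ≤⟨ ℚ.+-monoˡ-≤ ℚ.∣ seq x N ∣ (ℚ.<⇒≤ (near n N N≤n ℕ.≤-refl)) ⟩
      1ℚ ℚ.+ ℚ.∣ seq x N ∣                            ∎
      where open ℚ.≤-Reasoning

  -ᴿ-cauchy : ∀ x y → IsCauchy (λ n → seq x n ℚ.- seq y n)
  -ᴿ-cauchy x y ε 0<ε with half 0<ε
  ... | δ , 0<δ , δ+δ≡ε with cauchy x δ 0<δ | cauchy y δ 0<δ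
  ... | M , near | N , near′ = M ℕ.⊔ N , λ m n ≤m ≤n → begin-strict
      ℚ.∣ (X m ℚ.- Y m) ℚ.- (X n ℚ.- Y n) ∣      ≡⟨ cong ℚ.∣_∣ (solve 4 (λ a b c d → (a :- b) :- (c :- d) := (a :- c) :- (b :- d)) refl (X m) (Y m) (X n) (Y n)) ⟩
      ℚ.∣ (X m ℚ.- X n) ℚ.- (Y m ℚ.- Y n) ∣      ≤⟨ ℚ.∣p-q∣≤∣p∣+∣q∣ (X m ℚ.- X n) (Y m ℚ.- Y n) ⟩
      ℚ.∣ X m ℚ.- X n ∣ ℚ.+ ℚ.∣ Y m ℚ.- Y n ∣    <⟨ ℚ.+-mono-< (near m n (ℕ.m⊔n≤o⇒m≤o M N ≤m) (ℕ.m⊔n≤o⇒m≤o M N ≤n))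
                                                               (near′ m n (ℕ.m⊔n≤o⇒n≤o M N ≤m) (ℕ.m⊔n≤o⇒n≤o M N ≤n)) ⟩
      δ ℚ.+ δ                                    ≡⟨ δ+δ≡ε ⟩
      ε                                          ∎
    where
    open ℚ.≤-Reasoning
    X = seq x
    Y = seq y

  p≤r+q⇒p-q≤r : ∀ {p q r} → p ℚ.≤ r ℚ.+ q → p ℚ.- q ℚ.≤ r
  p≤r+q⇒p-q≤r {p} {q} {r} p≤r+q = begin
    p ℚ.- q             ≤⟨ ℚ.+-monoˡ-≤ (ℚ.- q) p≤r+q ⟩
    (r ℚ.+ q) ℚ.- q     ≡⟨ solve 2 (λ r q → (r :+ q) :- q := r) refl r q ⟩
    r                   ∎
    where open ℚ.≤-Reasoning

  ∣p∣-∣q∣≤∣p-q∣ : ∀ p q → ℚ.∣ p ∣ ℚ.- ℚ.∣ q ∣ ℚ.≤ ℚ.∣ p ℚ.- q ∣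
  ∣p∣-∣q∣≤∣p-q∣ p q = p≤r+q⇒p-q≤r (begin
    ℚ.∣ p ∣                        ≡⟨ cong ℚ.∣_∣ (solve 2 (λ p q → p := (p :- q) :+ q) refl p q) ⟩
    ℚ.∣ (p ℚ.- q) ℚ.+ q ∣          ≤⟨ ℚ.∣p+q∣≤∣p∣+∣q∣ (p ℚ.- q) q ⟩
    ℚ.∣ p ℚ.- q ∣ ℚ.+ ℚ.∣ q ∣      ∎)
    where open ℚ.≤-Reasoning

  ∣p-q∣≡∣q-p∣ : ∀ p q → ℚ.∣ p ℚ.- q ∣ ≡ ℚ.∣ q ℚ.- p ∣
  ∣p-q∣≡∣q-p∣ p q = ≡.trans (≡.sym (ℚ.∣-p∣≡∣p∣ (p ℚ.- q)))
    (cong ℚ.∣_∣ (solve 2 (λ p q → :- (p :- q) := q :- p) refl p q))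

  ∣∣p∣-∣q∣∣≤∣p-q∣ : ∀ p q → ℚ.∣ ℚ.∣ p ∣ ℚ.- ℚ.∣ q ∣ ∣ ℚ.≤ ℚ.∣ p ℚ.- q ∣
  ∣∣p∣-∣q∣∣≤∣p-q∣ p q with ℚ.∣p∣≡p∨∣p∣≡-p (ℚ.∣ p ∣ ℚ.- ℚ.∣ q ∣)
  ... | inj₁ eq = subst (ℚ._≤ ℚ.∣ p ℚ.- q ∣) (≡.sym eq) (∣p∣-∣q∣≤∣p-q∣ p q)
  ... | inj₂ eq = begin
    ℚ.∣ ℚ.∣ p ∣ ℚ.- ℚ.∣ q ∣ ∣    ≡⟨ eq ⟩
    ℚ.- (ℚ.∣ p ∣ ℚ.- ℚ.∣ q ∣)    ≡⟨ solve 2 (λ p q → :- (p :- q) := q :- p) refl ℚ.∣ p ∣ ℚ.∣ q ∣ ⟩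
    ℚ.∣ q ∣ ℚ.- ℚ.∣ p ∣          ≤⟨ ∣p∣-∣q∣≤∣p-q∣ q p ⟩
    ℚ.∣ q ℚ.- p ∣                ≡⟨ ∣p-q∣≡∣q-p∣ q p ⟩
    ℚ.∣ p ℚ.- q ∣                ∎
    where open ℚ.≤-Reasoning

  *-difference : ∀ a b c d → a ℚ.* b ℚ.- c ℚ.* d ≡ a ℚ.* (b ℚ.- d) ℚ.+ (a ℚ.- c) ℚ.* d
  *-difference = solve 4 (λ a b c d → a :* b :- c :* d := a :* (b :- d) :+ (a :- c) :* d) refl

  split-ε : ∀ {A B} ε → 0ℚ ℚ.< A → 0ℚ ℚ.< B →
            let δ = ε ℚ.* recip (A ℚ.+ B) in A ℚ.* δ ℚ.+ δ ℚ.* B ≡ ε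
  split-ε {A} {B} ε 0<A 0<B = begin
    A ℚ.* (ε ℚ.* ρ) ℚ.+ (ε ℚ.* ρ) ℚ.* B    ≡⟨ cong (ℚ._+ (ε ℚ.* ρ) ℚ.* B) (ℚ.*-comm A (ε ℚ.* ρ)) ⟩
    (ε ℚ.* ρ) ℚ.* A ℚ.+ (ε ℚ.* ρ) ℚ.* B    ≡⟨ ℚ.*-distribˡ-+ (ε ℚ.* ρ) A B ⟨
    (ε ℚ.* ρ) ℚ.* (A ℚ.+ B)                ≡⟨ ℚ.*-assoc ε ρ (A ℚ.+ B) ⟩
    ε ℚ.* (ρ ℚ.* (A ℚ.+ B))                ≡⟨ cong (ε ℚ.*_) (recip-inverseˡ (A ℚ.+ B) (>⇒≢0 (ℚ.+-mono-< 0<A 0<B))) ⟩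
    ε ℚ.* 1ℚ                               ≡⟨ ℚ.*-identityʳ ε ⟩
    ε                                      ∎
    where
    open ≡.≡-Reasoning
    ρ = recip (A ℚ.+ B)

  *-estimate : ∀ {A B δ} a b c d → 0ℚ ℚ.< A → 0ℚ ℚ.< B →
               ℚ.∣ a ∣ ℚ.≤ A → ℚ.∣ d ∣ ℚ.≤ B →
               ℚ.∣ a ℚ.- c ∣ ℚ.< δ → ℚ.∣ b ℚ.- d ∣ ℚ.< δ →
               ℚ.∣ a ℚ.* b ℚ.- c ℚ.* d ∣ ℚ.< A ℚ.* δ ℚ.+ δ ℚ.* B
  *-estimate {A} {B} {δ} a b c d 0<A 0<B ∣a∣≤A ∣d∣≤B dx dy = begin-strict
    ℚ.∣ a ℚ.* b ℚ.- c ℚ.* d ∣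
      ≡⟨ cong ℚ.∣_∣ (*-difference a b c d) ⟩
    ℚ.∣ a ℚ.* (b ℚ.- d) ℚ.+ (a ℚ.- c) ℚ.* d ∣
      ≤⟨ ℚ.∣p+q∣≤∣p∣+∣q∣ (a ℚ.* (b ℚ.- d)) ((a ℚ.- c) ℚ.* d) ⟩
    ℚ.∣ a ℚ.* (b ℚ.- d) ∣ ℚ.+ ℚ.∣ (a ℚ.- c) ℚ.* d ∣
      ≡⟨ cong₂ ℚ._+_ (ℚ.∣p*q∣≡∣p∣*∣q∣ a (b ℚ.- d)) (ℚ.∣p*q∣≡∣p∣*∣q∣ (a ℚ.- c) d) ⟩
    ℚ.∣ a ∣ ℚ.* ℚ.∣ b ℚ.- d ∣ ℚ.+ ℚ.∣ a ℚ.- c ∣ ℚ.* ℚ.∣ d ∣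
      ≤⟨ ℚ.+-mono-≤
           (ℚ.*-monoʳ-≤-nonNeg ℚ.∣ b ℚ.- d ∣ ⦃ ℚ.∣-∣-nonNeg (b ℚ.- d) ⦄ ∣a∣≤A)
           (*-mono-≤-nonNeg (ℚ.0≤∣p∣ (a ℚ.- c)) (ℚ.<⇒≤ 0<B) (ℚ.<⇒≤ dx) ∣d∣≤B) ⟩
    A ℚ.* ℚ.∣ b ℚ.- d ∣ ℚ.+ δ ℚ.* B
      <⟨ ℚ.+-monoˡ-< (δ ℚ.* B) (ℚ.*-monoʳ-<-pos A ⦃ ℚ.positive 0<A ⦄ dy) ⟩
    A ℚ.* δ ℚ.+ δ ℚ.* B ∎
    where open ℚ.≤-Reasoning

  *ᴿ-cauchy : ∀ x y → IsCauchy (λ n → seq x n ℚ.* seq y n)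
  *ᴿ-cauchy x y ε 0<ε = (K ℕ.⊔ L) ℕ.⊔ (M ℕ.⊔ N) , λ m n ≤m ≤n →
    let ≤m₁ = ℕ.m⊔n≤o⇒m≤o (K ℕ.⊔ L) (M ℕ.⊔ N) ≤m
        ≤n₁ = ℕ.m⊔n≤o⇒m≤o (K ℕ.⊔ L) (M ℕ.⊔ N) ≤n
        ≤m₂ = ℕ.m⊔n≤o⇒n≤o (K ℕ.⊔ L) (M ℕ.⊔ N) ≤m
        ≤n₂ = ℕ.m⊔n≤o⇒n≤o (K ℕ.⊔ L) (M ℕ.⊔ N) ≤n
    in subst (ℚ.∣ seq x m ℚ.* seq y m ℚ.- seq x n ℚ.* seq y n ∣ ℚ.<_) (split-ε ε 0<A 0<B)
         (*-estimate (seq x m) (seq y m) (seq x n) (seq y n) 0<A 0<B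
           (∣x∣≤A m (ℕ.m⊔n≤o⇒m≤o K L ≤m₁))
           (∣y∣≤B n (ℕ.m⊔n≤o⇒n≤o K L ≤n₁))
           (x-near m n (ℕ.m⊔n≤o⇒m≤o M N ≤m₂) (ℕ.m⊔n≤o⇒m≤o M N ≤n₂))
           (y-near m n (ℕ.m⊔n≤o⇒n≤o M N ≤m₂) (ℕ.m⊔n≤o⇒n≤o M N ≤n₂)))
    where
    x-bound = eventually-bounded x
    y-bound = eventually-bounded y
    A = proj₁ x-bound
    B = proj₁ y-bound
    0<A = proj₁ (proj₂ x-bound)
    0<B = proj₁ (proj₂ y-bound)
    K = proj₁ (proj₂ (proj₂ x-bound))
    L = proj₁ (proj₂ (proj₂ y-bound))
    ∣x∣≤A = proj₂ (proj₂ (proj₂ x-bound))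
    ∣y∣≤B = proj₂ (proj₂ (proj₂ y-bound))
    0<δ = *-pos 0<ε (recip-pos (ℚ.+-mono-< 0<A 0<B))
    M = proj₁ (cauchy x _ 0<δ)
    N = proj₁ (cauchy y _ 0<δ)
    x-near = proj₂ (cauchy x _ 0<δ)
    y-near = proj₂ (cauchy y _ 0<δ)

  recip-difference : ∀ a b → a ≢ 0ℚ → b ≢ 0ℚ →
                     (recip a ℚ.- recip b) ℚ.* (a ℚ.* b) ≡ b ℚ.- a
  recip-difference a b a≢0 b≢0 = begin
    (recip a ℚ.- recip b) ℚ.* (a ℚ.* b)
      ≡⟨ solve 4 (λ a b r s → (r :- s) :* (a :* b) := (r :* a) :* b :- (s :* b) :* a) refl a b (recip a) (recip b) ⟩
    (recip a ℚ.* a) ℚ.* b ℚ.- (recip b ℚ.* b) ℚ.* a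
      ≡⟨ cong₂ (λ u v → u ℚ.* b ℚ.- v ℚ.* a) (recip-inverseˡ a a≢0) (recip-inverseˡ b b≢0) ⟩
    1ℚ ℚ.* b ℚ.- 1ℚ ℚ.* a
      ≡⟨ cong₂ ℚ._-_ (ℚ.*-identityˡ b) (ℚ.*-identityˡ a) ⟩
    b ℚ.- a ∎
    where open ≡.≡-Reasoning

  ⁻¹-cauchy : ∀ x y → (∀ n → seq y n ≡ 0ℚ) → y <ᴿ x → IsCauchy (recip ∘ seq x)
  ⁻¹-cauchy x y y≡0 (δ , 0<δ , K , y+δ≤x) ε 0<ε
    with cauchy x (ε ℚ.* (δ ℚ.* δ)) (*-pos 0<ε (*-pos 0<δ 0<δ))
  ... | N , near = K ℕ.⊔ N , bound
    where
    open ℚ.≤-Reasoning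
    X = seq x

    δ≤X : ∀ n → K ℕ.≤ n → δ ℚ.≤ X n
    δ≤X n K≤n = begin
      δ                   ≡⟨ ℚ.+-identityˡ δ ⟨
      0ℚ ℚ.+ δ            ≡⟨ cong (ℚ._+ δ) (y≡0 n) ⟨
      seq y n ℚ.+ δ       ≤⟨ y+δ≤x n K≤n ⟩
      X n                 ∎

    bound : ∀ m n → K ℕ.⊔ N ℕ.≤ m → K ℕ.⊔ N ℕ.≤ n → ℚ.∣ recip (X m) ℚ.- recip (X n) ∣ ℚ.< ε
    bound m n ≤m ≤n = ℚ.*-cancelʳ-<-nonNeg (X m ℚ.* X n) ⦃ ℚ.nonNegative 0≤XX ⦄ (begin-strict
      ℚ.∣ recip (X m) ℚ.- recip (X n) ∣ ℚ.* (X m ℚ.* X n)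
        ≡⟨ cong (ℚ.∣ recip (X m) ℚ.- recip (X n) ∣ ℚ.*_) (ℚ.0≤p⇒∣p∣≡p 0≤XX) ⟨
      ℚ.∣ recip (X m) ℚ.- recip (X n) ∣ ℚ.* ℚ.∣ X m ℚ.* X n ∣
        ≡⟨ ℚ.∣p*q∣≡∣p∣*∣q∣ (recip (X m) ℚ.- recip (X n)) (X m ℚ.* X n) ⟨
      ℚ.∣ (recip (X m) ℚ.- recip (X n)) ℚ.* (X m ℚ.* X n) ∣
        ≡⟨ cong ℚ.∣_∣ (recip-difference (X m) (X n) (>⇒≢0 0<Xm) (>⇒≢0 0<Xn)) ⟩
      ℚ.∣ X n ℚ.- X m ∣
        <⟨ near n m (ℕ.m⊔n≤o⇒n≤o K N ≤n) (ℕ.m⊔n≤o⇒n≤o K N ≤m) ⟩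
      ε ℚ.* (δ ℚ.* δ)
        ≤⟨ ℚ.*-monoˡ-≤-nonNeg ε ⦃ ℚ.nonNegative (ℚ.<⇒≤ 0<ε) ⦄
             (*-mono-≤-nonNeg (ℚ.<⇒≤ 0<δ) (ℚ.<⇒≤ 0<Xn) δ≤Xm δ≤Xn) ⟩
      ε ℚ.* (X m ℚ.* X n) ∎)
      where
      δ≤Xm = δ≤X m (ℕ.m⊔n≤o⇒m≤o K N ≤m)
      δ≤Xn = δ≤X n (ℕ.m⊔n≤o⇒m≤o K N ≤n)
      0<Xm = ℚ.<-≤-trans 0<δ δ≤Xm
      0<Xn = ℚ.<-≤-trans 0<δ δ≤Xn
      0≤XX = ℚ.<⇒≤ (*-pos 0<Xm 0<Xn)

infixl 7 _*ᴿ_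
infixl 6 _-ᴿ_

fromℚ : ℚ → ℝ
fromℚ x = mkℝ (λ _ → x) λ ε 0<ε → 0 , λ _ _ _ _ →
  subst (ℚ._< ε) (≡.sym (cong ℚ.∣_∣ (ℚ.+-inverseʳ x))) 0<ε

fromℕ : ℕ → ℝ
fromℕ n = fromℚ (+ n / 1)

0ᴿ : ℝ
0ᴿ = fromℚ 0ℚ

_-ᴿ_ : ℝ → ℝ → ℝ
x -ᴿ y = mkℝ (λ n → seq x n ℚ.- seq y n) (-ᴿ-cauchy x y)

_*ᴿ_ : ℝ → ℝ → ℝ
x *ᴿ y = mkℝ (λ n → seq x n ℚ.* seq y n) (*ᴿ-cauchy x y)

∣_∣ᴿ : ℝ → ℝ
∣ x ∣ᴿ = mkℝ (λ n → ℚ.∣ seq x n ∣) λ ε 0<ε →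
  let N , near = cauchy x ε 0<ε in
  N , λ m n N≤m N≤n →
    ℚ.≤-<-trans (∣∣p∣-∣q∣∣≤∣p-q∣ (seq x m) (seq x n)) (near m n N≤m N≤n)

inverse : (x : ℝ) → 0ᴿ <ᴿ x → ℝ
inverse x 0<x = mkℝ (recip ∘ seq x) (⁻¹-cauchy x 0ᴿ (λ _ → refl) 0<x)

-- N is the integer part of t, so that 1 ≤ n ≤ t if and only if 1 ≤ n ≤ N.
IsFloor : ℕ → ℝ → Set
IsFloor N t = fromℕ N ≤ᴿ t × t <ᴿ fromℕ (suc N)

partialSum : (∀ n → .⦃ ℕ.NonZero n ⦄ → ℚ) → ℕ → ℚ
partialSum f zero    = 0ℚ
partialSum f (suc N) = partialSum f N ℚ.+ f (suc N)

-- The limit, as the real number t tends to +∞, of 1/t times the sum of f n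
-- over 1 ≤ n ≤ t.  The integer part of t is given by a relation because it
-- is not a computable function of t.
HasMeanValue : (∀ n → .⦃ ℕ.NonZero n ⦄ → ℚ) → ℝ → Set
HasMeanValue f L =
  ∀ ε → 0ᴿ <ᴿ ε → ∃ λ T → ∀ t (0<t : 0ᴿ <ᴿ t) → T ≤ᴿ t → ∀ N → IsFloor N t →
  ∣ inverse t 0<t *ᴿ fromℚ (partialSum f N) -ᴿ L ∣ᴿ <ᴿ ε

module LinearAlgebra {R : Ring r ℓr} (M : LeftModule R m ℓm) where

  private
    module R = Ring R
  open LeftModule M
  open MonoidSum +ᴹ-monoid using (sum; sum-cong-≋)

  linearCombination : Vector R.Carrier d → Vector Carrierᴹ d → Carrierᴹ
  linearCombination a v = sum λ i → a i *ₗ v i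

  Span : Vector Carrierᴹ d → Pred Carrierᴹ (r ⊔ ℓm)
  Span v x = ∃ λ a → x ≈ᴹ linearCombination a v

  LinearlyIndependent : Vector Carrierᴹ d → Set (r ⊔ ℓr ⊔ ℓm)
  LinearlyIndependent v = ∀ a → linearCombination a v ≈ᴹ 0ᴹ → ∀ i → a i R.≈ R.0#

  IsBasis : Pred Carrierᴹ p → Vector Carrierᴹ d → Set (r ⊔ ℓr ⊔ m ⊔ ℓm ⊔ p)
  IsBasis U b = (∀ i → U (b i)) × LinearlyIndependent b × U ⊆ Span b

  HasDimension : Pred Carrierᴹ p → ℕ → Set (r ⊔ ℓr ⊔ m ⊔ ℓm ⊔ p)
  HasDimension U d = ∃ λ (b : Vector Carrierᴹ d) → IsBasis U b

  linearCombination-cong :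
    ∀ {a a′ : Vector R.Carrier d} {v v′ : Vector Carrierᴹ d} →
    (∀ i → a i R.≈ a′ i) → (∀ i → v i ≈ᴹ v′ i) →
    linearCombination a v ≈ᴹ linearCombination a′ v′
  linearCombination-cong a≈a′ v≈v′ = sum-cong-≋ λ i → *ₗ-cong (a≈a′ i) (v≈v′ i)

module _ {S : Setoid a ℓ} (enum : Surjection (≡.setoid (Fin n)) S) where
  open Setoid S
  open Surjection enum using (to; strictlySurjective)

  ∃-dec : {P : Pred Carrier p} → P Respects _≈_ → Decidable P → Dec (∃ P)
  ∃-dec {P = P} resp P? = map′
    (λ (i , Pi) → to i , Pi)
    (λ (x , Px) → let i , toi≈x = strictlySurjective x in i , resp (sym toi≈x) Px)
    (Fin.any? (P? ∘ to))

  ∀-dec : {P : Pred Carrier p} → P Respects _≈_ → Decidable P → Dec (∀ x → P x)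
  ∀-dec {P = P} resp P? = map′
    (λ all x → let i , toi≈x = strictlySurjective x in resp toi≈x (all i))
    (λ all i → all (to i))
    (Fin.all? (P? ∘ to))

  vectorEnum : ∀ d → Surjection (≡.setoid (Fin (n ^ d))) (VecEquality.≋-setoid S d)
  vectorEnum d = record
    { to         = λ i → to ∘ finToFun i
    ; cong       = λ { refl _ → refl′ }
    ; surjective = λ v → let w = λ j → strictlySurjective (v j) in
        funToFin (proj₁ ∘ w) ,
        λ { refl j → trans (reflexive (cong to (Fin.finToFun-funToFin (proj₁ ∘ w) j))) (proj₂ (w j)) }
    }
    where refl′ = λ {x} → Setoid.refl S {x}

module _ {R : Ring r ℓr} (M : LeftModule R m ℓm) {r# m# : ℕ}
         (enumR : Surjection (≡.setoid (Fin r#)) (Ring.setoid R))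
         (enumM : Surjection (≡.setoid (Fin m#)) (LeftModule.≈ᴹ-setoid M))
         (_≟R_ : ∀ x y → Dec (Ring._≈_ R x y))
         (_≟M_ : ∀ x y → Dec (LeftModule._≈ᴹ_ M x y))
         where
  private
    module R = Ring R
  open LeftModule M
  open LinearAlgebra M

  Span-resp : ∀ {v v′ : Vector Carrierᴹ d} → (∀ i → v i ≈ᴹ v′ i) →
              ∀ {x x′} → x ≈ᴹ x′ → Span v x → Span v′ x′
  Span-resp v≈v′ x≈x′ (a , x≈av) =
    a , ≈ᴹ-trans (≈ᴹ-sym x≈x′) (≈ᴹ-trans x≈av (linearCombination-cong (λ _ → R.refl) v≈v′))

  Span? : (v : Vector Carrierᴹ d) → Decidable (Span v)
  Span? {d} v x = ∃-dec (vectorEnum enumR d)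
    (λ a≈a′ x≈av → ≈ᴹ-trans x≈av (linearCombination-cong a≈a′ (λ _ → ≈ᴹ-refl)))
    (λ a → x ≟M linearCombination a v)

  LinearlyIndependent? : Decidable (LinearlyIndependent {d})
  LinearlyIndependent? {d} v = ∀-dec (vectorEnum enumR d)
    (λ a≈a′ indep a′v≈0 i → R.trans (R.sym (a≈a′ i))
      (indep (≈ᴹ-trans (linearCombination-cong a≈a′ (λ _ → ≈ᴹ-refl)) a′v≈0) i))
    (λ a → (linearCombination a v ≟M 0ᴹ) →-dec Fin.all? (λ i → a i ≟R R.0#))

  HasDimension? : {U : Pred Carrierᴹ p} → U Respects _≈ᴹ_ → Decidable U →
                  Decidable (HasDimension U)
  HasDimension? {U = U} U-resp U? d = ∃-dec (vectorEnum enumM d)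
    (λ b≈b′ (b∈U , indep , U⊆b) →
      (λ i → U-resp (b≈b′ i) (b∈U i)) ,
      (λ a ab′≈0 → indep a
        (≈ᴹ-trans (linearCombination-cong (λ _ → R.refl) b≈b′) ab′≈0)) ,
      (λ x∈U → Span-resp b≈b′ ≈ᴹ-refl (U⊆b x∈U)))
    (λ b → Fin.all? (U? ∘ b) ×-dec LinearlyIndependent? b ×-dec
      map′ (λ U⊆b {x} → U⊆b x) (λ U⊆b x → U⊆b {x})
        (∀-dec enumM
          (λ x≈x′ ⊆b x′∈U →
            Span-resp (λ _ → ≈ᴹ-refl) x≈x′ (⊆b (U-resp (≈ᴹ-sym x≈x′) x′∈U)))
          (λ x → U? x →-dec Span? b x)))

IsPrimePower : ℕ → Set
IsPrimePower q = ∃₂ λ p e → Prime p × 1 ℕ.≤ e × q ≡ p ^ e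

-- In a Heyting field x # y holds exactly when x - y is invertible, and
-- tightness says that ¬ (x # y) implies x ≈ y.  Equality is decidable on a
-- finite carrier, so this is a field in the usual sense: x ≉ 0# implies that
-- x is invertible.
record FiniteField (q : ℕ) (c ℓ₁ ℓ₂ : Level) : Set (lsuc (c ⊔ ℓ₁ ⊔ ℓ₂)) where
  field
    heytingField : HeytingField c ℓ₁ ℓ₂

  open HeytingField heytingField public

  commutativeRing : CommutativeRing c ℓ₁
  commutativeRing = HeytingCommutativeRing.commutativeRing heytingCommutativeRing

  open CommutativeRing commutativeRing public using (ring; rawRing; semiring)

  field
    enumeration : Inverse (≡.setoid (Fin q)) setoid

  open Inverse enumeration public using () renaming (to to element; from to index)

  surjection : Surjection (≡.setoid (Fin q)) setoid
  surjection = Inverse⇒Surjection enumeration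

  _≟_ : ∀ x y → Dec (x ≈ y)
  x ≟ y = map′
    (λ ix≡iy → trans (sym (element-index x)) (trans (reflexive (cong element ix≡iy)) (element-index y)))
    (Inverse.from-cong enumeration)
    (index x Fin.≟ index y)
    where
    element-index : ∀ z → element (index z) ≈ z
    element-index = Inverse.strictlyInverseˡ enumeration

  order-nonZero : ℕ.NonZero q
  order-nonZero = Fin.nonZeroIndex (index 0#)

-- An extension of degree n of F, presented as a field with q ^ n elements
-- together with an embedding of F.
record Extension (F : FiniteField q c ℓ₁ ℓ₂) (n : ℕ) : Set (lsuc (c ⊔ ℓ₁ ⊔ ℓ₂)) where
  private
    module F = FiniteField F

  field
    field′ : FiniteField (q ^ n) c ℓ₁ ℓ₂

  open FiniteField field′ public

  open RingMorphisms F.rawRing rawRing using (IsRingHomomorphism)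

  field
    embed                : F.Carrier → Carrier
    embed-isHomomorphism : IsRingHomomorphism embed

  private
    module embed = IsRingHomomorphism embed-isHomomorphism

  vectorSpace : LeftModule F.ring c ℓ₁
  vectorSpace = record
    { Carrierᴹ = Carrier
    ; _≈ᴹ_ = _≈_
    ; _+ᴹ_ = _+_
    ; _*ₗ_ = λ a x → embed a * x
    ; 0ᴹ = 0#
    ; -ᴹ_ = -_
    ; isLeftModule = record
      { isLeftSemimodule = record
        { +ᴹ-isCommutativeMonoid = +-isCommutativeMonoid
        ; isPreleftSemimodule = record
          { *ₗ-cong = λ a≈b x≈y → *-cong (embed.⟦⟧-cong a≈b) x≈y
          ; *ₗ-zeroˡ = λ x → trans (*-congʳ embed.0#-homo) (zeroˡ x)
          ; *ₗ-distribʳ = λ x a b → trans (*-congʳ (embed.+-homo a b)) (distribʳ x (embed a) (embed b))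
          ; *ₗ-identityˡ = λ x → trans (*-congʳ embed.1#-homo) (*-identityˡ x)
          ; *ₗ-assoc = λ a b x → trans (*-congʳ (embed.*-homo a b)) (*-assoc (embed a) (embed b) x)
          ; *ₗ-zeroʳ = λ a → zeroʳ (embed a)
          ; *ₗ-distribˡ = λ a x y → distribˡ (embed a) x y
          }
        }
      ; -ᴹ‿cong = -‿cong
      ; -ᴹ‿inverse = -‿inverse
      }
    }

module _ {F : FiniteField q c ℓ₁ ℓ₂} (K : Extension F n) where
  private
    module F = FiniteField F
  open Extension K
  open Exp semiring renaming (_^_ to _^ᴷ_)
  open LinearAlgebra vectorSpace

  conjugates : Carrier → Vector Carrier n
  conjugates α i = α ^ᴷ (q ^ toℕ i)

  -- The condition k ≤ n excludes k > n, where n ∸ k would be 0.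
  IsNormal : ℕ → Pred Carrier (c ⊔ ℓ₁)
  IsNormal k α = k ℕ.≤ n × HasDimension (Span (conjugates α)) (n ∸ k)

  IsNormal? : ∀ k → Decidable (IsNormal k)
  IsNormal? k α = k ℕ.≤? n ×-dec
    HasDimension? vectorSpace F.surjection surjection F._≟_ _≟_
      (Span-resp vectorSpace F.surjection surjection F._≟_ _≟_ (λ _ → refl′))
      (Span? vectorSpace F.surjection surjection F._≟_ _≟_ (conjugates α))
      (n ∸ k)
    where refl′ = λ {x} → Setoid.refl setoid {x}

  normalCount : ℕ → ℕ
  normalCount k = count (IsNormal? k) (tabulate element)

  normalDensity : ℕ → ℚ
  normalDensity k = (+ normalCount k / (q ^ n)) ⦃ order-nonZero ⦄

{-# OPTIONS --safe #-}

-- By the normal basis theorem, F_{q^n} with the Frobenius T is isomorphic to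
-- A_n = F_q[x]/(xⁿ - 1), and an element is k-normal iff its annihilator in A_n
-- has dimension k.  Let d divide n with n/d prime to p.  The dimension of the
-- annihilator of c ∈ A_n equals that of its image in A_d unless c is killed
-- by a simple submodule N of A_n on which T^d is not the identity.  If N has
-- q^m elements, then T^g is the identity on N for g = gcd(n, q^m - 1), there are
-- at most q g such N, and each kills a fraction q^-m of A_n.
--
-- For d = gcd(n, M) with M = p^J (q^{2J})! only m ≥ 2J occurs, and n/d is prime
-- to p unless p^J divides n.  On average over n, g is O(q^{m/2}), so the density
-- of k-normal elements is approximated in mean by the periodic functions
-- n ↦ λ(gcd(n, M)), and hence has a mean value.

module Submission where

open import Algebra.Bundles using (CommutativeRing; CommutativeSemigroup; RawRing)
import Algebra.Morphism.RingMonomorphism as RingMonomorphism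
open import Algebra.Morphism.Structures using (IsRingHomomorphism; IsRingMonomorphism)
import Algebra.Properties.CommutativeMonoid.Sum as CommutativeMonoidSum
import Algebra.Properties.CommutativeSemigroup as CommutativeSemigroupProperties
import Algebra.Properties.CommutativeSemiring.Binomial as Binomial
import Algebra.Properties.CommutativeSemiring.Exp as Exp
import Algebra.Properties.Group as GroupProperties
import Algebra.Properties.Ring as RingProperties
import Algebra.Properties.Semiring.Exp as SemiringExp
import Algebra.Properties.Semiring.Mult as Mult
import Algebra.Properties.Semiring.Sum as Sum
import Algebra.Solver.Ring.NaturalCoefficients.Default as Solver
open import Algebra.Structures using (IsCommutativeMonoid; IsCommutativeRing)
open import Data.Bool.Base using (if_then_else_)
open import Data.Empty using (⊥)
open import Data.Fin.Base as Fin using (Fin; zero; suc; toℕ)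
import Data.Fin.Properties as Fin
import Data.Integer.Base as ℤ
import Data.Integer.Properties as ℤ
open import Data.List.Base as List using (List; []; _∷_; length)
open import Data.List.Membership.Propositional using (_∈_)
open import Data.List.Membership.Propositional.Properties using (∈-tabulate⁺)
open import Data.List.Relation.Unary.All as All using (All; []; _∷_)
import Data.List.Relation.Unary.All.Properties as All
open import Data.List.Relation.Unary.AllPairs using (AllPairs; []; _∷_)
open import Data.List.Relation.Unary.Any as Any using (Any; here; there)
open import Data.Nat.Base
open import Data.Nat.Combinatorics using (_C_; nCn≡1; nCk≡n!/k![n-k]!; k![n∸k]!∣n!)
open import Data.Nat.Coprimality using (Coprime; coprime⇒gcd≡1; coprime-divisor)
open import Data.Nat.DivMod using (_/_; _%_; m/n*n≡m; m*n/n≡m; m≡m%n+[m/n]*n; m%n<n)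
open import Data.Nat.Divisibility
open import Data.Nat.GCD using (gcd; gcd-GCD; gcd[m,n]∣m; gcd[m,n]∣n; gcd-greatest; module Bézout)
open import Data.Nat.GeneralisedArithmetic using (fold; fold-+)
open import Data.Nat.Primality using (Prime; euclidsLemma; prime⇒irreducible; prime⇒nonZero; prime⇒nonTrivial)
import Data.Nat.Properties as ℕ using (_≟_)
open import Data.Nat.Properties hiding (_≟_)
import Data.Nat.Solver as ℕSolver
open import Data.Product.Base using (∃; ∃₂; Σ; _×_; _,_; proj₁; proj₂)
open import Data.Product.Function.NonDependent.Propositional using (_×-↔_)
open import Data.Rational.Base as ℚ using (ℚ; 0ℚ; 1ℚ)
  renaming (_+_ to _+ℚ_; _*_ to _*ℚ_; _-_ to _-ℚ_; -_ to -ℚ_; _≤_ to _≤ℚ_; _<_ to _<ℚ_)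
import Data.Rational.Properties as ℚ
open import Data.Rational.Solver using (module +-*-Solver)
import Data.Rational.Unnormalised.Base as ℚᵘ
import Data.Rational.Unnormalised.Properties as ℚᵘ
open import Data.Sum.Base using (_⊎_; inj₁; inj₂)
open import Data.Unit.Base using (⊤; tt)
open import Data.Vec.Base as Vec using (Vec; []; _∷_; _∷ʳ_; _++_; count; tabulate; replicate; zipWith; map; lookup)
import Data.Vec.Properties as Vec
open import Function.Base using (_∘_; id)
open import Function.Bundles using (Inverse; _↔_; mk↔ₛ′)
open import Function.Construct.Composition using (_↔-∘_)
open import Function.Construct.Identity using (↔-id)
open import Function.Properties.Inverse using (Inverse⇒Injection; ↔-sym)
open import Level using (Level; 0ℓ)
open import Relation.Binary.Definitions using (DecidableEquality)
open import Relation.Binary.PropositionalEquality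
import Relation.Binary.Reasoning.Setoid as SetoidReasoning
open import Relation.Nullary.Decidable using (Dec; does; yes; no; map′; _×-dec_; _⊎-dec_; ¬?; via-injection; decidable-stable)
open import Relation.Nullary.Negation using (¬_; contradiction)
open import Relation.Unary using (Pred; Decidable; _∩_; ∁)
open import Relation.Unary.Properties using (_∩?_; _∪?_; ∁?; U?)
open import Defs

-- Degrees n and d are compared exactly on every c whose annihilator consists of fixed points of
-- T^d, because these fixed points form a copy of A_d. If x annihilates c and is moved by T^d, then
-- (T^d - 1)x is nonzero and c kills a simple submodule inside the image of T^d - 1. That n/d is
-- prime to p enters here: the kernel and the image of T^d - 1 then meet only in 0, so T^d is not
-- the identity on this submodule.
--
-- The obstacle is that gcd(n, q^m - 1) is as large as q^m - 1 for particular n, so the bound on the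
-- exceptional fraction is small only on average over n. This makes approximation in mean the
-- working notion, and the limit a Cauchy sequence of averages rather than a formula.
--
-- Simple submodules are represented by generators and dimensions are compared through the
-- cardinalities q^dim, in place of a factorisation of xⁿ - 1 and a general dimension theory. The
-- elements that separate one simple submodule from the others serve twice, for bounding the number
-- of simple submodules and for constructing a normal basis.

private
  variable
    a ℓ ℓ′ : Level
    X Y : Set a
    M N : ℕ

-- Iterates of a map.

iter : (X → X) → ℕ → X → X
iter f i x = fold x f i

iter-+ : (f : X → X) (i j : ℕ) (x : X) → iter f (i + j) x ≡ iter f i (iter f j x)
iter-+ f i j x = fold-+ x f i

iter-suc : (f : X → X) (i : ℕ) (x : X) → iter f i (f x) ≡ f (iter f i x)
iter-suc f i x = trans (sym (iter-+ f i 1 x)) (cong (λ k → iter f k x) (+-comm i 1))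

iter-fixed-* : (f : X → X) {o : ℕ} {x : X} → iter f o x ≡ x → ∀ k → iter f (k * o) x ≡ x
iter-fixed-* f         eq zero    = refl
iter-fixed-* f {o} {x} eq (suc k) =
  trans (iter-+ f o (k * o) x) (trans (cong (iter f o) (iter-fixed-* f eq k)) eq)

iter-injective : {f : X → X} → (∀ {x y} → f x ≡ f y → x ≡ y) →
                 ∀ i {x y} → iter f i x ≡ iter f i y → x ≡ y
iter-injective inj zero    eq = eq
iter-injective inj (suc i) eq = iter-injective inj i (inj eq)

sumTo : (ℕ → ℕ) → ℕ → ℕ
sumTo f zero    = 0
sumTo f (suc j) = sumTo f j + f j

-- Counting

card : {P : Pred (Fin N) ℓ} → Decidable P → ℕ
card P? = count P? (tabulate id)

count-tabulate : {P : Pred X ℓ} (P? : Decidable P) (f : Fin N → X) →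
                 count P? (tabulate f) ≡ card (P? ∘ f)
count-tabulate {N = zero}  P? f = refl
count-tabulate {N = suc N} P? f = cong (if does (P? (f zero)) then suc else id)
  (trans (count-tabulate P? (f ∘ suc)) (sym (count-tabulate (P? ∘ f) suc)))

card-suc : {P : Pred (Fin (suc N)) ℓ} (P? : Decidable P) →
           card P? ≡ (if does (P? zero) then suc else id) (card (P? ∘ suc))
card-suc P? = cong (if does (P? zero) then suc else id) (count-tabulate P? suc)

card-⊤ : {P : Pred (Fin N) ℓ} (P? : Decidable P) → (∀ i → P i) → card P? ≡ N
card-⊤ {N = zero}  P? all = refl
card-⊤ {N = suc N} P? all rewrite card-suc P? with P? zero
... | yes _ = cong suc (card-⊤ (P? ∘ suc) (all ∘ suc))
... | no ¬p = contradiction (all zero) ¬p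

card-split : {P : Pred (Fin N) ℓ} {Q : Pred (Fin N) ℓ′} (P? : Decidable P) (Q? : Decidable Q) →
             card P? ≡ card (P? ∩? Q?) + card (P? ∩? ∁? Q?)
card-split {N = zero}  P? Q? = refl
card-split {N = suc N} P? Q?
  rewrite card-suc P? | card-suc (P? ∩? Q?) | card-suc (P? ∩? ∁? Q?)
  with card-split (P? ∘ suc) (Q? ∘ suc) | P? zero | Q? zero
... | eq | yes _ | yes _ = cong suc eq
... | eq | yes _ | no _  = trans (cong suc eq) (sym (+-suc _ _))
... | eq | no _  | yes _ = eq
... | eq | no _  | no _  = eq

-- Lists the subset bijectively, so that counts are compared by `Fin.injective⇒≤` instead of by
-- induction.
enumerate : {P : Pred (Fin N) ℓ} (P? : Decidable P) → Σ (Fin (card P?) → Fin N) λ e →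
            (∀ i → P (e i)) × (∀ {i j} → e i ≡ e j → i ≡ j) × (∀ {x} → P x → ∃ λ i → e i ≡ x)
enumerate {N = zero} P? = (λ ()) , (λ ()) , (λ { {()} }) , λ { {()} }
enumerate {N = suc N} P? rewrite card-suc P? with P? zero | enumerate (P? ∘ suc)
... | no ¬p | e , e-P , e-inj , e-onto =
  suc ∘ e , e-P , e-inj ∘ Fin.suc-injective ,
  λ { {zero} p → contradiction p ¬p ; {suc x} p → let i , eq = e-onto p in i , cong suc eq }
... | yes p | e , e-P , e-inj , e-onto =
  (λ { zero → zero ; (suc i) → suc (e i) }) ,
  (λ { zero → p ; (suc i) → e-P i }) ,
  (λ { {zero} {zero} _ → refl ; {suc i} {suc j} eq → cong suc (e-inj (Fin.suc-injective eq)) }) ,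
  λ { {zero} _ → zero , refl ; {suc x} px → let i , eq = e-onto px in suc i , cong suc eq }

card-≤ : {P : Pred (Fin M) ℓ} {Q : Pred (Fin N) ℓ′} (P? : Decidable P) (Q? : Decidable Q) →
         (f : ∀ i → P i → ∃ Q) →
         (∀ {i j} p p′ → proj₁ (f i p) ≡ proj₁ (f j p′) → i ≡ j) → card P? ≤ card Q?
card-≤ P? Q? f f-inj with enumerate P? | enumerate Q?
... | e , e-P , e-inj , _ | e′ , _ , _ , e′-onto = Fin.injective⇒≤ {f = λ i → proj₁ (g i)} λ {i} {j} eq →
  e-inj (f-inj _ _ (trans (sym (proj₂ (g i))) (trans (cong e′ eq) (proj₂ (g j)))))
  where g = λ i → let j , q = f (e i) (e-P i) in e′-onto q

module Counting (fin : Fin N ↔ X) where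

  open Inverse fin using (to; from; strictlyInverseˡ; strictlyInverseʳ)

  # : {P : Pred X ℓ} → Decidable P → ℕ
  # P? = card (P? ∘ to)

  infix 4 _≡?_
  _≡?_ : DecidableEquality X
  _≡?_ = via-injection (Inverse⇒Injection (↔-sym fin)) Fin._≟_

  ∃? : {P : Pred X ℓ} → Decidable P → Dec (∃ P)
  ∃? {P = P} P? = map′ (λ (i , p) → to i , p) (λ (x , p) → from x , subst P (sym (strictlyInverseˡ x)) p)
    (Fin.any? (P? ∘ to))

  ∀? : {P : Pred X ℓ} → Decidable P → Dec (∀ x → P x)
  ∀? {P = P} P? = map′ (λ all x → subst P (strictlyInverseˡ x) (all (from x))) (λ all i → all (to i))
    (Fin.all? (P? ∘ to))

  #-⊤ : {P : Pred X ℓ} (P? : Decidable P) → (∀ x → P x) → # P? ≡ N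
  #-⊤ P? all = card-⊤ (P? ∘ to) (all ∘ to)

  #-split : {P : Pred X ℓ} {Q : Pred X ℓ′} (P? : Decidable P) (Q? : Decidable Q) →
            # P? ≡ # (P? ∩? Q?) + # (P? ∩? ∁? Q?)
  #-split P? Q? = card-split (P? ∘ to) (Q? ∘ to)

  -- Pigeonhole: prepending a missed value `y` to the images of `f` would inject `Fin (suc N)` into
  -- `Fin N`.
  injective⇒surjective : (f : X → X) → (∀ {x y} → f x ≡ f y → x ≡ y) → ∀ y → ∃ λ x → f x ≡ y
  injective⇒surjective f f-inj y = decidable-stable (∃? λ x → f x ≡? y) λ ¬∃ →
    let g : Fin (suc N) → Fin N
        g = λ { zero → from y ; (suc i) → from (f (to i)) }
        from-inj : ∀ {u v} → from u ≡ from v → u ≡ v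
        from-inj {u} {v} eq = trans (sym (strictlyInverseˡ u)) (trans (cong to eq) (strictlyInverseˡ v))
        to-inj : ∀ {i j} → to i ≡ to j → i ≡ j
        to-inj {i} {j} eq = trans (sym (strictlyInverseʳ i)) (trans (cong from eq) (strictlyInverseʳ j))
        g-inj : ∀ {i j} → g i ≡ g j → i ≡ j
        g-inj = λ { {zero} {zero} _ → refl
                  ; {zero} {suc j} eq → contradiction (to j , sym (from-inj eq)) ¬∃
                  ; {suc i} {zero} eq → contradiction (to i , from-inj eq) ¬∃
                  ; {suc i} {suc j} eq → cong suc (to-inj (f-inj (from-inj eq))) }
    in 1+n≰n (Fin.injective⇒≤ {f = g} g-inj)

module _ {a b} {X : Set a} {Y : Set b} {finX : Fin M ↔ X} {finY : Fin N ↔ Y} where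
  private
    module X = Counting finX
    module Y = Counting finY
    module fX = Inverse finX
    module fY = Inverse finY

  #-≤ : {P : Pred X ℓ} {Q : Pred Y ℓ′} (P? : Decidable P) (Q? : Decidable Q) (f : ∀ x → P x → ∃ Q) →
        (∀ {x x′} p p′ → proj₁ (f x p) ≡ proj₁ (f x′ p′) → x ≡ x′) → X.# P? ≤ Y.# Q?
  #-≤ {Q = Q} P? Q? f f-inj = card-≤ (P? ∘ fX.to) (Q? ∘ fY.to)
    (λ i p → let y , qy = f (fX.to i) p in fY.from y , subst Q (sym (fY.strictlyInverseˡ y)) qy)
    λ {i} {j} p p′ eq → trans (sym (fX.strictlyInverseʳ i)) (trans (cong fX.from (f-inj p p′
      (trans (sym (fY.strictlyInverseˡ _)) (trans (cong fY.to eq) (fY.strictlyInverseˡ _)))))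
      (fX.strictlyInverseʳ j))

  #≤size : {P : Pred X ℓ} (P? : Decidable P) (f : ∀ x → P x → Y) →
           (∀ {x x′} p p′ → f x p ≡ f x′ p′ → x ≡ x′) → X.# P? ≤ N
  #≤size P? f f-inj = ≤-trans (#-≤ P? (λ _ → U? tt) (λ x p → f x p , tt) f-inj)
    (≤-reflexive (Y.#-⊤ _ (λ _ → tt)))

  size≤# : {Q : Pred Y ℓ′} (Q? : Decidable Q) (f : X → Y) → (∀ x → Q (f x)) →
           (∀ {x x′} → f x ≡ f x′ → x ≡ x′) → M ≤ Y.# Q?
  size≤# Q? f q f-inj = ≤-trans (≤-reflexive (sym (X.#-⊤ (λ _ → U? tt) (λ _ → tt))))
    (#-≤ (λ _ → U? tt) Q? (λ x _ → f x , q x) (λ _ _ → f-inj))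

module _ {a} {X : Set a} {fin : Fin N ↔ X} where
  open Counting fin

  #-mono : {P : Pred X ℓ} {Q : Pred X ℓ′} (P? : Decidable P) (Q? : Decidable Q) →
           (∀ x → P x → Q x) → # P? ≤ # Q?
  #-mono P? Q? P⊆Q = #-≤ {finX = fin} {finY = fin} P? Q? (λ x p → x , P⊆Q x p) (λ _ _ → id)

  #-∅ : {P : Pred X ℓ} (P? : Decidable P) → (∀ x → ¬ P x) → # P? ≡ 0
  #-∅ P? none = n≤0⇒n≡0 (#≤size {finX = fin} {finY = ↔-id (Fin 0)} P?
    (λ x p → contradiction p (none x)) (λ p → contradiction p (none _)))

  #-singleton : {P : Pred X ℓ} (P? : Decidable P) {x : X} → P x → (∀ {y} → P y → y ≡ x) → # P? ≡ 1
  #-singleton P? {x} px unique = ≤-antisym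
    (#≤size {finX = fin} {finY = ↔-id (Fin 1)} P? (λ _ _ → zero) (λ p p′ _ → trans (unique p) (sym (unique p′))))
    (size≤# {finX = ↔-id (Fin 1)} {finY = fin} P? (λ _ → x) (λ _ → px) λ { {zero} {zero} _ → refl })

  #-∪ : {P : Pred X ℓ} {Q : Pred X ℓ′} (P? : Decidable P) (Q? : Decidable Q) →
        # (P? ∪? Q?) ≤ # P? + # Q?
  #-∪ P? Q? = ≤-trans (≤-reflexive (#-split (P? ∪? Q?) P?)) (+-mono-≤
    (#-mono ((P? ∪? Q?) ∩? P?) P? (λ _ → proj₂))
    (#-mono ((P? ∪? Q?) ∩? ∁? P?) Q? λ { _ (inj₁ p , ¬p) → contradiction p ¬p ; _ (inj₂ q , _) → q }))

least : {P : Pred ℕ ℓ} → Decidable P → ∀ {n} → P n → ∃ λ m → P m × ∀ {i} → i < m → ¬ P i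
least {P = P} P? {n} pn with search (suc n)
  where
  search : ∀ k → (∀ {i} → i < k → ¬ P i) ⊎ ∃ λ m → P m × ∀ {i} → i < m → ¬ P i
  search zero = inj₁ λ ()
  search (suc k) with search k
  ... | inj₂ found = inj₂ found
  ... | inj₁ none with P? k
  ...   | yes pk = inj₂ (k , pk , none)
  ...   | no ¬pk = inj₁ λ {i} i<1+k → case-≤ (≤-pred i<1+k)
    where
    case-≤ : ∀ {i} → i ≤ k → ¬ P i
    case-≤ i≤k with m≤n⇒m<n∨m≡n i≤k
    ... | inj₁ i<k  = none i<k
    ... | inj₂ refl = ¬pk
... | inj₁ none = contradiction pn (none ≤-refl)
... | inj₂ found = found

-- When all points of a stable set have the same stabiliser, every orbit in
-- it has the same length, which therefore divides its cardinality.
module _ {X : Set} (fin : Fin N ↔ X) (f : X → X) (f-inj : ∀ {x y} → f x ≡ f y → x ≡ y)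
         {P : Pred X 0ℓ} (P? : Decidable P) (P-stable : ∀ {x} → P x → P (f x))
         (x₀ : X) (same⇒ : ∀ {x} i → P x → iter f i x ≡ x → iter f i x₀ ≡ x₀)
         (same⇐ : ∀ {x} i → P x → iter f i x₀ ≡ x₀ → iter f i x ≡ x) where
  private
    open Counting fin

    suc-∸ : ∀ {i j} → i < j → j ∸ i ≡ suc (j ∸ suc i)
    suc-∸ i<j = +-∸-assoc 1 i<j

    abstract
     return : ∀ {i j x} → i ≤ j → iter f i x ≡ iter f j x → iter f (j ∸ i) x ≡ x
     return {i} {j} {x} i≤j eq = sym (iter-injective f-inj i (trans eq
      (trans (cong (λ k → iter f k x) (sym (m+[n∸m]≡n i≤j))) (iter-+ f i (j ∸ i) x))))

    abstract
     period : ∃ λ o → iter f (suc o) x₀ ≡ x₀ × ∀ {i} → i < o → iter f (suc i) x₀ ≢ x₀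
     period with Fin.pigeonhole (n<1+n N) (λ i → Inverse.from fin (iter f (toℕ i) x₀))
     ... | i , j , i<j , eq = least (λ i → iter f (suc i) x₀ ≡? x₀) {toℕ j ∸ suc (toℕ i)} (subst (λ k → iter f k x₀ ≡ x₀) (suc-∸ i<j)
       (return (<⇒≤ i<j) (trans (sym (Inverse.strictlyInverseˡ fin _)) (trans (cong (Inverse.to fin) eq)
         (Inverse.strictlyInverseˡ fin _)))))

    o : ℕ
    o = suc (proj₁ period)

    distinct : ∀ {x} → P x → (i j : Fin o) → iter f (toℕ i) x ≡ iter f (toℕ j) x → ¬ (toℕ i < toℕ j)
    distinct {x} px i j eq i<j = proj₂ (proj₂ period) {toℕ j ∸ suc (toℕ i)}
      (<-≤-trans (≤-reflexive (sym (suc-∸ i<j)))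
        (≤-trans (m∸n≤m (toℕ j) (toℕ i)) (≤-pred (Fin.toℕ<n j))))
      (same⇒ (suc (toℕ j ∸ suc (toℕ i))) px (subst (λ k → iter f k x ≡ x) (suc-∸ i<j) (return (<⇒≤ i<j) eq)))

    distinct≡ : ∀ {x} → P x → {i j : Fin o} → iter f (toℕ i) x ≡ iter f (toℕ j) x → i ≡ j
    distinct≡ px {i} {j} eq = Fin.toℕ-injective
      (≤-antisym (≮⇒≥ (distinct px j i (sym eq))) (≮⇒≥ (distinct px i j eq)))

    -- Orbits are removed one at a time, with `fuel` bounding what is left. Every orbit has exactly
    -- `o` points because its points share the stabiliser of `x₀`, and the complement of an orbit is
    -- stable because a predecessor of an orbit point lies in the orbit.
    divides-stable : ∀ fuel {Q : Pred X 0ℓ} (Q? : Decidable Q) → (∀ {x} → Q x → P x) →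
                     (∀ {x} → Q x → Q (f x)) → # Q? ≤ fuel → o ∣ # Q?
    divides-stable fuel {Q} Q? Q⊆P Q-stable ≤fuel with ∃? Q?
    divides-stable fuel {Q} Q? Q⊆P Q-stable ≤fuel | no ¬∃ =
      subst (o ∣_) (sym (#-∅ {fin = fin} Q? (λ x qx → ¬∃ (x , qx)))) (o ∣0)
    divides-stable fuel {Q} Q? Q⊆P Q-stable ≤fuel | yes (x , qx) =
      subst (o ∣_) (sym split) (∣m∣n⇒∣m+n ∣-refl (rest fuel ≤fuel))
      where
      Orbit : Pred X _
      Orbit y = ∃ λ (i : Fin o) → iter f (toℕ i) x ≡ y
      Orbit? : Decidable Orbit
      Orbit? y = Fin.any? (λ i → iter f (toℕ i) x ≡? y)
      Q-iter : ∀ i → Q (iter f i x)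
      Q-iter zero = qx
      Q-iter (suc i) = Q-stable (Q-iter i)
      #orbit : # (Q? ∩? Orbit?) ≡ o
      #orbit = ≤-antisym
        (#≤size {finX = fin} {finY = ↔-id (Fin o)} (Q? ∩? Orbit?) (λ _ (_ , i , _) → i)
          λ { (_ , _ , eq) (_ , _ , eq′) refl → trans (sym eq) eq′ })
        (size≤# {finX = ↔-id (Fin o)} {finY = fin} (Q? ∩? Orbit?) (λ i → iter f (toℕ i) x)
          (λ i → Q-iter (toℕ i) , i , refl) (distinct≡ (Q⊆P qx)))
      split : # Q? ≡ o + # (Q? ∩? ∁? Orbit?)
      split = trans (#-split Q? Orbit?) (cong (_+ # (Q? ∩? ∁? Orbit?)) #orbit)
      back : ∀ {y} → Orbit (f y) → Orbit y
      -- Here `f y` is the starting point `x` itself, so `y` is the last point of the cycle, reached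
      -- from `x` after `o - 1` steps.
      back {y} (zero , eq) = Fin.fromℕ (proj₁ period) , f-inj (trans
        (cong (λ k → f (iter f k x)) (Fin.toℕ-fromℕ (proj₁ period)))
        (trans (same⇐ o (Q⊆P qx) (proj₁ (proj₂ period))) eq))
      back (suc i , eq) = Fin.inject₁ i , f-inj (trans (cong (λ k → f (iter f k x)) (Fin.toℕ-inject₁ i)) eq)
      rest : ∀ fuel → # Q? ≤ fuel → o ∣ # (Q? ∩? ∁? Orbit?)
      rest zero ≤fuel = contradiction (subst (_≤ 0) split ≤fuel) λ ()
      rest (suc fuel) ≤fuel = divides-stable fuel (Q? ∩? ∁? Orbit?) (Q⊆P ∘ proj₁)
        (λ (q , ¬orb) → Q-stable q , ¬orb ∘ back)
        (≤-trans (m≤n+m _ (proj₁ period)) (≤-pred (subst (_≤ suc fuel) split ≤fuel)))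

  -- A form of Lagrange's theorem. It serves three times: for adding 1 in a field, for multiplying
  -- by a nonzero element, and for `T` on a simple submodule.
  iter-# : iter f (# P?) x₀ ≡ x₀
  iter-# with divides-stable (# P?) P? id P-stable ≤-refl
  ... | divides k eq = trans (cong (λ i → iter f i x₀) eq) (iter-fixed-* f (proj₁ (proj₂ period)) k)

-- Fields on `Fin N` and modules over a polynomial ring.

distinct⇒1< : ∀ {n} {x y : Fin n} → x ≢ y → 1 < n
distinct⇒1< {1}           {zero} {zero} x≢y = contradiction refl x≢y
distinct⇒1< {suc (suc _)}               x≢y = s≤s (s≤s z≤n)

-- On `Fin N` equality is propositional and decidable, so counting needs no setoids;
-- `Strictification` brings the fields of the theorem into this form.
record FieldOn (N : ℕ) : Set where
  infix  8 ⊟_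
  infixl 7 _⊠_
  infixl 6 _⊞_
  field
    _⊞_ _⊠_           : Fin N → Fin N → Fin N
    ⊟_                : Fin N → Fin N
    𝟘 𝟙               : Fin N
    isCommutativeRing : IsCommutativeRing _≡_ _⊞_ _⊠_ ⊟_ 𝟘 𝟙
    invertible        : ∀ {x} → x ≢ 𝟘 → ∃ λ y → y ⊠ x ≡ 𝟙
    𝟙≢𝟘               : 𝟙 ≢ 𝟘

  commutativeRing : CommutativeRing 0ℓ 0ℓ
  commutativeRing = record { isCommutativeRing = isCommutativeRing }

  module R = CommutativeRing commutativeRing
  module RP = RingProperties R.ring

  1<N : 1 < N
  1<N = distinct⇒1< 𝟙≢𝟘

finVec : ∀ {q} m → Fin (q ^ m) ↔ Vec (Fin q) m
finVec zero = mk↔ₛ′ (λ _ → []) (λ _ → zero) (λ { [] → refl }) (λ { zero → refl })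
finVec {q} (suc m) = mk↔ₛ′
  (λ i → let a , j = to Fin.*↔× i in a ∷ to (finVec m) j)
  (λ { (a ∷ v) → from (Fin.*↔× {q} {q ^ m}) (a , from (finVec m) v) })
  (λ { (a ∷ v) → trans
    (cong (λ (b , j) → b ∷ to (finVec m) j) (strictlyInverseˡ (Fin.*↔× {q} {q ^ m}) (a , from (finVec m) v)))
    (cong (a ∷_) (strictlyInverseˡ (finVec m) v)) })
  λ i → trans
    (cong (λ j → from (Fin.*↔× {q} {q ^ m}) (proj₁ (to (Fin.*↔× {q} {q ^ m}) i) , j))
      (strictlyInverseʳ (finVec m) _))
    (strictlyInverseʳ (Fin.*↔× {q} {q ^ m}) i)
  where open Inverse

module OverField {q : ℕ} (F : FieldOn q) where
  open FieldOn F

  Coeffs : ℕ → Set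
  Coeffs = Vec (Fin q)

  0v : ∀ {m} → Coeffs m
  0v {m} = replicate m 𝟘

  δ : ∀ {m} → Coeffs (suc m)
  δ = 𝟙 ∷ 0v

  infixl 6 _+v_
  infixl 7 _*v_

  _+v_ : ∀ {m} → Coeffs m → Coeffs m → Coeffs m
  _+v_ = zipWith _⊞_

  _*v_ : ∀ {m} → Fin q → Coeffs m → Coeffs m
  a *v v = map (a ⊠_) v

  0v-∷ʳ : ∀ {m} → 0v {m} ∷ʳ 𝟘 ≡ 0v
  0v-∷ʳ {zero}  = refl
  0v-∷ʳ {suc m} = cong (𝟘 ∷_) 0v-∷ʳ

  open module CountCoeffs {m} = Counting (finVec {q} m) public
    using (injective⇒surjective) renaming (_≡?_ to _≡v?_; # to #v; #-split to #v-split; ∃? to ∃v?; ∀? to ∀v?)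

  -- A module over F[x] in which x acts as `T`. Subtraction is derived, as multiplication by `⊟ 𝟙`.
  record ShiftModule : Set₁ where
    infixl 6 _⊕_
    infixr 7 _•_
    field
      Carrier : Set
      _⊕_     : Carrier → Carrier → Carrier
      𝟎       : Carrier
      _•_     : Fin q → Carrier → Carrier
      T       : Carrier → Carrier
      isCommutativeMonoid : IsCommutativeMonoid _≡_ _⊕_ 𝟎
      •-distribˡ : ∀ a x y → a • (x ⊕ y) ≡ a • x ⊕ a • y
      •-distribʳ : ∀ a b x → (a ⊞ b) • x ≡ a • x ⊕ b • x
      •-assoc    : ∀ a b x → (a ⊠ b) • x ≡ a • b • x
      •-identity : ∀ x → 𝟙 • x ≡ x
      •-zero     : ∀ x → 𝟘 • x ≡ 𝟎
      T-⊕        : ∀ x y → T (x ⊕ y) ≡ T x ⊕ T y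
      T-•        : ∀ a x → T (a • x) ≡ a • T x

    open IsCommutativeMonoid isCommutativeMonoid public
      using (identityˡ; identityʳ; assoc; comm)

    ⊕-commutativeSemigroup : CommutativeSemigroup 0ℓ 0ℓ
    ⊕-commutativeSemigroup = record
      { isCommutativeSemigroup = IsCommutativeMonoid.isCommutativeSemigroup isCommutativeMonoid }

    open CommutativeSemigroupProperties ⊕-commutativeSemigroup public using (interchange)

    neg : Carrier → Carrier
    neg x = (⊟ 𝟙) • x

    •-𝟎 : ∀ a → a • 𝟎 ≡ 𝟎
    •-𝟎 a = begin
      a • 𝟎         ≡⟨ cong (a •_) (•-zero 𝟎) ⟨
      a • 𝟘 • 𝟎     ≡⟨ •-assoc a 𝟘 𝟎 ⟨
      (a ⊠ 𝟘) • 𝟎   ≡⟨ cong (_• 𝟎) (R.zeroʳ a) ⟩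
      𝟘 • 𝟎         ≡⟨ •-zero 𝟎 ⟩
      𝟎             ∎
      where open ≡-Reasoning

    neg-inverseˡ : ∀ x → neg x ⊕ x ≡ 𝟎
    neg-inverseˡ x = begin
      (⊟ 𝟙) • x ⊕ x       ≡⟨ cong (neg x ⊕_) (•-identity x) ⟨
      (⊟ 𝟙) • x ⊕ 𝟙 • x   ≡⟨ •-distribʳ (⊟ 𝟙) 𝟙 x ⟨
      (⊟ 𝟙 ⊞ 𝟙) • x       ≡⟨ cong (_• x) (R.-‿inverseˡ 𝟙) ⟩
      𝟘 • x               ≡⟨ •-zero x ⟩
      𝟎                   ∎
      where open ≡-Reasoning

    cancelˡ : ∀ x {y z} → x ⊕ y ≡ x ⊕ z → y ≡ z
    cancelˡ x {y} {z} eq = begin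
      y                ≡⟨ lemma y ⟨
      neg x ⊕ (x ⊕ y)  ≡⟨ cong (neg x ⊕_) eq ⟩
      neg x ⊕ (x ⊕ z)  ≡⟨ lemma z ⟩
      z                ∎
      where
      open ≡-Reasoning
      lemma : ∀ w → neg x ⊕ (x ⊕ w) ≡ w
      lemma w = trans (sym (assoc _ _ _)) (trans (cong (_⊕ w) (neg-inverseˡ x)) (identityˡ w))

    x⊕neg-y≡𝟎⇒x≡y : ∀ {x y} → x ⊕ neg y ≡ 𝟎 → x ≡ y
    x⊕neg-y≡𝟎⇒x≡y {x} {y} eq = cancelˡ (neg y) (trans (comm _ _) (trans eq (sym (neg-inverseˡ y))))

    T-𝟎 : T 𝟎 ≡ 𝟎
    T-𝟎 = trans (cong T (sym (•-zero 𝟎))) (trans (T-• 𝟘 𝟎) (•-zero _))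

    -- The polynomial in `T` with coefficients `c`, constant term first, applied to `x`.
    act : ∀ {m} → Coeffs m → Carrier → Carrier
    act []      x = 𝟎
    act (a ∷ c) x = a • x ⊕ act c (T x)

    act-⊕ʳ : ∀ {m} (c : Coeffs m) x y → act c (x ⊕ y) ≡ act c x ⊕ act c y
    act-⊕ʳ []      x y = sym (identityˡ 𝟎)
    act-⊕ʳ (a ∷ c) x y = begin
      a • (x ⊕ y) ⊕ act c (T (x ⊕ y))                  ≡⟨ cong₂ _⊕_ (•-distribˡ a x y) (cong (act c) (T-⊕ x y)) ⟩
      a • x ⊕ a • y ⊕ act c (T x ⊕ T y)                ≡⟨ cong (a • x ⊕ a • y ⊕_) (act-⊕ʳ c (T x) (T y)) ⟩
      a • x ⊕ a • y ⊕ (act c (T x) ⊕ act c (T y))      ≡⟨ interchange _ _ _ _ ⟩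
      a • x ⊕ act c (T x) ⊕ (a • y ⊕ act c (T y))      ∎
      where open ≡-Reasoning

    act-𝟎 : ∀ {m} (c : Coeffs m) → act c 𝟎 ≡ 𝟎
    act-𝟎 []      = refl
    act-𝟎 (a ∷ c) = trans (cong₂ _⊕_ (•-𝟎 a) (trans (cong (act c) T-𝟎) (act-𝟎 c))) (identityˡ 𝟎)

    •-comm : ∀ a b x → a • b • x ≡ b • a • x
    •-comm a b x = trans (sym (•-assoc a b x)) (trans (cong (_• x) (R.*-comm a b)) (•-assoc b a x))

    act-•ʳ : ∀ {m} (c : Coeffs m) a x → act c (a • x) ≡ a • act c x
    act-•ʳ []      a x = sym (•-𝟎 a)
    act-•ʳ (b ∷ c) a x = begin
      b • a • x ⊕ act c (T (a • x))   ≡⟨ cong₂ _⊕_ (•-comm b a x) (cong (act c) (T-• a x)) ⟩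
      a • b • x ⊕ act c (a • T x)     ≡⟨ cong (a • b • x ⊕_) (act-•ʳ c a (T x)) ⟩
      a • b • x ⊕ a • act c (T x)     ≡⟨ •-distribˡ a _ _ ⟨
      a • (b • x ⊕ act c (T x))       ∎
      where open ≡-Reasoning

    act-T : ∀ {m} (c : Coeffs m) x → act c (T x) ≡ T (act c x)
    act-T []      x = sym T-𝟎
    act-T (a ∷ c) x = sym (trans (T-⊕ _ _) (cong₂ _⊕_ (T-• a x) (sym (act-T c (T x)))))

    act-iter : ∀ {m} (c : Coeffs m) i x → act c (iter T i x) ≡ iter T i (act c x)
    act-iter c zero    x = refl
    act-iter c (suc i) x = trans (act-T c _) (cong T (act-iter c i x))

    iter-⊕ : ∀ i x y → iter T i (x ⊕ y) ≡ iter T i x ⊕ iter T i y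
    iter-⊕ zero    x y = refl
    iter-⊕ (suc i) x y = trans (cong T (iter-⊕ i x y)) (T-⊕ _ _)

    iter-• : ∀ i a x → iter T i (a • x) ≡ a • iter T i x
    iter-• zero    a x = refl
    iter-• (suc i) a x = trans (cong T (iter-• i a x)) (T-• a _)

    act-+ˡ : ∀ {m} (c d : Coeffs m) x → act (c +v d) x ≡ act c x ⊕ act d x
    act-+ˡ []      []      x = sym (identityˡ 𝟎)
    act-+ˡ (a ∷ c) (b ∷ d) x =
      trans (cong₂ _⊕_ (•-distribʳ a b x) (act-+ˡ c d (T x))) (interchange _ _ _ _)

    act-*ˡ : ∀ {m} a (c : Coeffs m) x → act (a *v c) x ≡ a • act c x
    act-*ˡ a []      x = sym (•-𝟎 a)
    act-*ˡ a (b ∷ c) x =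
      trans (cong₂ _⊕_ (•-assoc a b x) (act-*ˡ a c (T x))) (sym (•-distribˡ a _ _))

    act-0v : ∀ {m} x → act (0v {m}) x ≡ 𝟎
    act-0v {zero}  x = refl
    act-0v {suc m} x = trans (cong₂ _⊕_ (•-zero x) (act-0v {m} (T x))) (identityˡ 𝟎)

    act-δ : ∀ {m} x → act (δ {m}) x ≡ x
    act-δ {m} x = trans (cong₂ _⊕_ (•-identity x) (act-0v {m} (T x))) (identityʳ x)

    act-0∷ : ∀ {m} (c : Coeffs m) x → act (𝟘 ∷ c) x ≡ T (act c x)
    act-0∷ c x = trans (cong₂ _⊕_ (•-zero x) (act-T c x)) (identityˡ _)

    act-++ : ∀ {m l} (c : Coeffs m) (d : Coeffs l) x → act (c ++ d) x ≡ act c x ⊕ act d (iter T m x)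
    act-++ []              d x = sym (identityˡ _)
    act-++ {suc m} (a ∷ c) d x = begin
      a • x ⊕ act (c ++ d) (T x)                       ≡⟨ cong (a • x ⊕_) (act-++ c d (T x)) ⟩
      a • x ⊕ (act c (T x) ⊕ act d (iter T m (T x)))   ≡⟨ assoc _ _ _ ⟨
      act (a ∷ c) x ⊕ act d (iter T m (T x))           ≡⟨ cong (λ y → act (a ∷ c) x ⊕ act d y) (iter-suc T m x) ⟩
      act (a ∷ c) x ⊕ act d (iter T (suc m) x)         ∎
      where open ≡-Reasoning

    act-∷ʳ : ∀ {m} (c : Coeffs m) a x → act (c ∷ʳ a) x ≡ act c x ⊕ a • iter T m x
    act-∷ʳ []              a x = trans (identityʳ _) (sym (identityˡ _))
    act-∷ʳ {suc m} (b ∷ c) a x = begin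
      b • x ⊕ act (c ∷ʳ a) (T x)                   ≡⟨ cong (b • x ⊕_) (act-∷ʳ c a (T x)) ⟩
      b • x ⊕ (act c (T x) ⊕ a • iter T m (T x))   ≡⟨ assoc _ _ _ ⟨
      act (b ∷ c) x ⊕ a • iter T m (T x)           ≡⟨ cong (λ y → act (b ∷ c) x ⊕ a • y) (iter-suc T m x) ⟩
      act (b ∷ c) x ⊕ a • iter T (suc m) x         ∎
      where open ≡-Reasoning

    act-comm : ∀ {m l} (c : Coeffs m) (d : Coeffs l) x → act c (act d x) ≡ act d (act c x)
    act-comm c []      x = act-𝟎 c
    act-comm c (a ∷ d) x = begin
      act c (a • x ⊕ act d (T x))            ≡⟨ act-⊕ʳ c _ _ ⟩
      act c (a • x) ⊕ act c (act d (T x))    ≡⟨ cong₂ _⊕_ (act-•ʳ c a x) (act-comm c d (T x)) ⟩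
      a • act c x ⊕ act d (act c (T x))      ≡⟨ cong (λ y → a • act c x ⊕ act d y) (act-T c x) ⟩
      a • act c x ⊕ act d (T (act c x))      ∎
      where open ≡-Reasoning

    -- The order of u is the dimension of the cyclic submodule generated by u.
    record Order (u : Carrier) : Set where
      field
        order       : ℕ
        relation    : Coeffs order
        relates     : act relation u ≡ iter T order u
        independent : (c : Coeffs order) → act c u ≡ 𝟎 → c ≡ 0v

      injective : {c d : Coeffs order} → act c u ≡ act d u → c ≡ d
      injective {c} {d} eq = differ c d (independent (c +v (⊟ 𝟙) *v d) (begin
        act (c +v (⊟ 𝟙) *v d) u       ≡⟨ act-+ˡ c _ u ⟩
        act c u ⊕ act ((⊟ 𝟙) *v d) u  ≡⟨ cong₂ _⊕_ eq (act-*ˡ (⊟ 𝟙) d u) ⟩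
        act d u ⊕ neg (act d u)       ≡⟨ comm _ _ ⟩
        neg (act d u) ⊕ act d u       ≡⟨ neg-inverseˡ _ ⟩
        𝟎                             ∎))
        where
        open ≡-Reasoning
        head-eq : ∀ a b → a ⊞ (⊟ 𝟙) ⊠ b ≡ 𝟘 → a ≡ b
        head-eq a b eq = RP.x∙y⁻¹≈ε⇒x≈y _ _ (trans (cong (a ⊞_) (sym (RP.-1*x≈-x b))) eq)
        differ : ∀ {m} (c d : Coeffs m) → c +v (⊟ 𝟙) *v d ≡ 0v → c ≡ d
        differ []      []      _  = refl
        differ (a ∷ c) (b ∷ d) eq = cong₂ _∷_
          (head-eq a b (Vec.∷-injectiveˡ eq)) (differ c d (Vec.∷-injectiveʳ eq))

      span-self : ∃ λ (c : Coeffs order) → act c u ≡ u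
      span-self = go order relation relates
        where
        go : ∀ m (c : Coeffs m) → act c u ≡ iter T m u → ∃ λ (c : Coeffs m) → act c u ≡ u
        -- In order 0 there is no `δ`, but `relates` then already says that the empty combination is
        -- `u`.
        go zero    c eq = c , eq
        go (suc m) c eq = δ , act-δ {m} u

      -- Multiplication by x pushes one coefficient past the top; `relation` rewrites
      -- `iter T order u` and brings it back.
      span-T : (c : Coeffs order) → ∃ λ (d : Coeffs order) → act d u ≡ T (act c u)
      span-T c with Vec.initLast (𝟘 ∷ c)
      ... | e , a , eq = e +v a *v relation , (begin
        act (e +v a *v relation) u             ≡⟨ act-+ˡ e _ u ⟩
        act e u ⊕ act (a *v relation) u        ≡⟨ cong (act e u ⊕_) (act-*ˡ a relation u) ⟩
        act e u ⊕ a • act relation u           ≡⟨ cong (λ y → act e u ⊕ a • y) relates ⟩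
        act e u ⊕ a • iter T order u           ≡⟨ act-∷ʳ e a u ⟨
        act (e ∷ʳ a) u                         ≡⟨ cong (λ c → act c u) eq ⟨
        act (𝟘 ∷ c) u                          ≡⟨ act-0∷ c u ⟩
        T (act c u)                            ∎)
        where open ≡-Reasoning

      span : ∀ {l} (c : Coeffs l) → ∃ λ (d : Coeffs order) → act d u ≡ act c u
      span []      = 0v , act-0v {order} u
      span (a ∷ c) with span c | span-self
      ... | d , eq | s , eqₛ with span-T d
      ...   | e , eqₑ = a *v s +v e , (begin
        act (a *v s +v e) u      ≡⟨ act-+ˡ (a *v s) e u ⟩
        act (a *v s) u ⊕ act e u ≡⟨ cong₂ _⊕_ (trans (act-*ˡ a s u) (cong (a •_) eqₛ)) (trans eqₑ (cong T eq)) ⟩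
        a • u ⊕ T (act c u)      ≡⟨ cong (a • u ⊕_) (act-T c u) ⟨
        a • u ⊕ act c (T u)      ∎)
        where open ≡-Reasoning

    open Order public using (order)

    module _ (_≟_ : DecidableEquality Carrier) {n} (u : Carrier) (periodic : iter T (suc n) u ≡ u) where

      private
        Independent : ℕ → Set
        Independent m = (c : Coeffs m) → act c u ≡ 𝟎 → c ≡ 0v

        -- A relation with nonzero top coefficient could be solved for `iter T m u`. So the top
        -- coefficient vanishes, and independence of the lower powers applies.
        extend : ∀ {m} → Independent m → ¬ (∃ λ (c : Coeffs m) → act c u ≡ iter T m u) → Independent (suc m)
        extend {m} ind none c eq with Vec.initLast c
        ... | e , a , refl with a Fin.≟ 𝟘
        ...   | yes refl = trans (cong (_∷ʳ 𝟘) (ind e (trans (sym (trans (act-∷ʳ e 𝟘 u)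
                  (trans (cong (act e u ⊕_) (•-zero _)) (identityʳ _)))) eq))) 0v-∷ʳ
        ...   | no a≢0 with invertible a≢0
        ...     | b , ba≡1 = contradiction ((b ⊠ ⊟ 𝟙) *v e , (begin
          act ((b ⊠ ⊟ 𝟙) *v e) u          ≡⟨ act-*ˡ (b ⊠ ⊟ 𝟙) e u ⟩
          (b ⊠ ⊟ 𝟙) • act e u             ≡⟨ •-assoc b (⊟ 𝟙) _ ⟩
          b • neg (act e u)               ≡⟨ cong (b •_) (cancelˡ (act e u) (trans (comm _ _)
                                               (trans (neg-inverseˡ _) (trans (sym eq) (act-∷ʳ e a u))))) ⟩
          b • a • iter T m u              ≡⟨ •-assoc b a _ ⟨
          (b ⊠ a) • iter T m u            ≡⟨ cong (_• iter T m u) ba≡1 ⟩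
          𝟙 • iter T m u                  ≡⟨ •-identity _ ⟩
          iter T m u                      ∎)) none
          where open ≡-Reasoning

        -- The order is the first `m` for which `iter T m u` lies in the span of its predecessors.
        -- Periodicity stops the search at `suc n` at the latest, where the relation is the constant
        -- polynomial 1.
        search : ∀ m k → m + k ≡ suc n → Independent m → Σ (Order u) λ o → order o ≤ suc n
        search m zero    eq ind with trans (sym (+-identityʳ m)) eq
        ... | refl = record { order = m ; relation = δ ; relates = trans (act-δ {n} u) (sym periodic)
                            ; independent = ind } , ≤-refl
        search m (suc k) eq ind with ∃v? (λ (c : Coeffs m) → act c u ≟ iter T m u)
        ... | yes (c , rel) = record { order = m ; relation = c ; relates = rel ; independent = ind } ,
                              ≤-trans (m≤m+n m (suc k)) (≤-reflexive eq)
        ... | no none = search (suc m) k (trans (sym (+-suc m k)) eq) (extend ind none)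

      order-of : Σ (Order u) λ o → order o ≤ suc n
      order-of = search 0 (suc n) refl λ { [] _ → refl }

  record Hom (V W : ShiftModule) : Set where
    private
      module V = ShiftModule V
      module W = ShiftModule W
    field
      ⟦_⟧    : V.Carrier → W.Carrier
      ⊕-homo : ∀ x y → ⟦ x V.⊕ y ⟧ ≡ ⟦ x ⟧ W.⊕ ⟦ y ⟧
      •-homo : ∀ a x → ⟦ a V.• x ⟧ ≡ a W.• ⟦ x ⟧
      T-homo : ∀ x → ⟦ V.T x ⟧ ≡ W.T ⟦ x ⟧

    𝟎-homo : ⟦ V.𝟎 ⟧ ≡ W.𝟎
    𝟎-homo = trans (cong ⟦_⟧ (sym (V.•-zero V.𝟎))) (trans (•-homo 𝟘 V.𝟎) (W.•-zero _))

    act-homo : ∀ {m} (c : Coeffs m) x → ⟦ V.act c x ⟧ ≡ W.act c ⟦ x ⟧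
    act-homo []      x = 𝟎-homo
    act-homo (a ∷ c) x = trans (⊕-homo _ _)
      (cong₂ W._⊕_ (•-homo a x) (trans (act-homo c (V.T x)) (cong (W.act c) (T-homo x))))

    iter-homo : ∀ i x → ⟦ iter V.T i x ⟧ ≡ iter W.T i ⟦ x ⟧
    iter-homo zero    x = refl
    iter-homo (suc i) x = trans (T-homo _) (cong W.T (iter-homo i x))

-- The algebra F[x]/(xⁿ - 1) as coefficient vectors under a cyclic shift.

module CyclicShift {q : ℕ} (F : FieldOn q) where
  open FieldOn F
  open OverField F

  -- `push a v` lets `a` enter in front and drops the final entry; `lastOr a v` is the entry
  -- dropped, or `a` when `v` is empty. With the incoming entry as an argument both are plain
  -- recursions, visibly linear, and `rotate` inherits this.
  push : ∀ {n} → Fin q → Coeffs n → Coeffs n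
  push a []      = []
  push a (x ∷ v) = a ∷ push x v

  lastOr : ∀ {n} → Fin q → Coeffs n → Fin q
  lastOr a []      = a
  lastOr a (x ∷ v) = lastOr x v

  rotate : ∀ {n} → Coeffs n → Coeffs n
  rotate v = push (lastOr 𝟘 v) v

  push-+ : ∀ {n} a b (v w : Coeffs n) → push (a ⊞ b) (v +v w) ≡ push a v +v push b w
  push-+ a b []      []      = refl
  push-+ a b (x ∷ v) (y ∷ w) = cong (_ ∷_) (push-+ x y v w)

  lastOr-+ : ∀ {n} a b (v w : Coeffs n) → lastOr (a ⊞ b) (v +v w) ≡ lastOr a v ⊞ lastOr b w
  lastOr-+ a b []      []      = refl
  lastOr-+ a b (x ∷ v) (y ∷ w) = lastOr-+ x y v w

  push-* : ∀ {n} a b (v : Coeffs n) → push (a ⊠ b) (a *v v) ≡ a *v push b v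
  push-* a b []      = refl
  push-* a b (x ∷ v) = cong (_ ∷_) (push-* a x v)

  lastOr-* : ∀ {n} a b (v : Coeffs n) → lastOr (a ⊠ b) (a *v v) ≡ a ⊠ lastOr b v
  lastOr-* a b []      = refl
  lastOr-* a b (x ∷ v) = lastOr-* a x v

  last : ∀ {n} → Coeffs n → Fin q
  last = lastOr 𝟘

  last-+ : ∀ {n} (v w : Coeffs n) → last (v +v w) ≡ last v ⊞ last w
  last-+ v w = trans (cong (λ z → lastOr z (v +v w)) (sym (R.+-identityˡ 𝟘))) (lastOr-+ 𝟘 𝟘 v w)

  last-* : ∀ {n} a (v : Coeffs n) → last (a *v v) ≡ a ⊠ last v
  last-* a v = trans (cong (λ z → lastOr z (a *v v)) (sym (R.zeroʳ a))) (lastOr-* a 𝟘 v)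

  -- F[x]/(xⁿ - 1), with coefficient vectors as elements and multiplication
  -- by x as the shift.
  A : ℕ → ShiftModule
  A n = record
    { Carrier = Coeffs n
    ; _⊕_ = _+v_
    ; 𝟎 = 0v
    ; _•_ = _*v_
    ; T = rotate
    ; isCommutativeMonoid = record
      { isMonoid = record
        { isSemigroup = record
          { isMagma = record { isEquivalence = isEquivalence ; ∙-cong = cong₂ _+v_ }
          ; assoc = Vec.zipWith-assoc R.+-assoc
          }
        ; identity = Vec.zipWith-identityˡ R.+-identityˡ , Vec.zipWith-identityʳ R.+-identityʳ
        }
      ; comm = Vec.zipWith-comm R.+-comm
      }
    ; •-distribˡ = *v-distribˡ
    ; •-distribʳ = *v-distribʳ
    ; •-assoc = *v-assoc
    ; •-identity = λ v → trans (Vec.map-cong R.*-identityˡ v) (Vec.map-id v)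
    ; •-zero = *v-zero
    ; T-⊕ = λ v w → trans (cong (λ z → push z (v +v w)) (last-+ v w)) (push-+ (last v) (last w) v w)
    ; T-• = λ a v → trans (cong (λ z → push z (a *v v)) (last-* a v)) (push-* a (last v) v)
    }
    where
    *v-distribˡ : ∀ {n} a (v w : Coeffs n) → a *v (v +v w) ≡ a *v v +v a *v w
    *v-distribˡ a []      []      = refl
    *v-distribˡ a (x ∷ v) (y ∷ w) = cong₂ _∷_ (R.distribˡ a x y) (*v-distribˡ a v w)
    *v-distribʳ : ∀ {n} a b (v : Coeffs n) → (a ⊞ b) *v v ≡ a *v v +v b *v v
    *v-distribʳ a b []      = refl
    *v-distribʳ a b (x ∷ v) = cong₂ _∷_ (R.distribʳ x a b) (*v-distribʳ a b v)
    *v-assoc : ∀ {n} a b (v : Coeffs n) → (a ⊠ b) *v v ≡ a *v (b *v v)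
    *v-assoc a b []      = refl
    *v-assoc a b (x ∷ v) = cong₂ _∷_ (R.*-assoc a b x) (*v-assoc a b v)
    *v-zero : ∀ {n} (v : Coeffs n) → 𝟘 *v v ≡ 0v
    *v-zero []      = refl
    *v-zero (x ∷ v) = cong₂ _∷_ (R.zeroˡ x) (*v-zero v)

  pad : ∀ {m} → Coeffs m → ∀ n → Coeffs n
  pad []      n       = 0v
  pad (a ∷ c) zero    = []
  pad (a ∷ c) (suc n) = a ∷ pad c n

  pad-id : ∀ {n} (c : Coeffs n) → pad c n ≡ c
  pad-id []      = refl
  pad-id (a ∷ c) = cong (a ∷_) (pad-id c)

  push-0v : ∀ {n} → push 𝟘 (0v {n}) ≡ 0v
  push-0v {zero}  = refl
  push-0v {suc n} = cong (𝟘 ∷_) push-0v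

  last-0v : ∀ {n} → last (0v {n}) ≡ 𝟘
  last-0v {zero}  = refl
  last-0v {suc n} = last-0v {n}

  lastOr-nonempty : ∀ {n} a b (v : Coeffs (suc n)) → lastOr a v ≡ lastOr b v
  lastOr-nonempty a b (x ∷ v) = refl

  last-pad : ∀ {m n} (c : Coeffs m) → m ≤ n → last (pad c (suc n)) ≡ 𝟘
  last-pad {n = n}     []      _         = last-0v {suc n}
  last-pad {n = suc n} (a ∷ c) (s≤s m≤n) =
    trans (lastOr-nonempty a 𝟘 (pad c (suc n))) (last-pad c m≤n)

  push-pad : ∀ {m n} b (c : Coeffs m) → m ≤ n → push b (pad c (suc n)) ≡ b ∷ pad c n
  push-pad             b []      _         = cong (b ∷_) push-0v
  push-pad {n = suc n} b (a ∷ c) (s≤s m≤n) = cong (b ∷_) (push-pad a c m≤n)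

  lastOr-∷ʳ : ∀ {n} a (v : Coeffs n) x → lastOr a (v ∷ʳ x) ≡ x
  lastOr-∷ʳ a []      x = refl
  lastOr-∷ʳ a (y ∷ v) x = lastOr-∷ʳ y v x

  push-∷ʳ : ∀ {n} a (v : Coeffs n) x → push a (v ∷ʳ x) ≡ a ∷ v
  push-∷ʳ a []      x = refl
  push-∷ʳ a (y ∷ v) x = cong (a ∷_) (push-∷ʳ y v x)

  rotate-∷ʳ : ∀ {n} (v : Coeffs n) x → rotate (v ∷ʳ x) ≡ x ∷ v
  rotate-∷ʳ v x = trans (cong (λ z → push z (v ∷ʳ x)) (lastOr-∷ʳ 𝟘 v x)) (push-∷ʳ x v x)

  module _ {n : ℕ} where
    open ShiftModule (A (suc n))

    -- `δ` is the element 1. As long as the degree stays below `suc n` nothing wraps around: each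
    -- shift meets a vector whose last entry is still 0.
    act-pad : ∀ {m} (c : Coeffs m) → m ≤ suc n → act c δ ≡ pad c (suc n)
    act-pad []      _         = refl
    act-pad (a ∷ c) (s≤s m≤n) = begin
      a *v δ +v act c (rotate δ)              ≡⟨ cong (a *v δ +v_) (act-T c δ) ⟩
      a *v δ +v rotate (act c δ)              ≡⟨ cong (λ v → a *v δ +v rotate v) (act-pad c (m≤n⇒m≤1+n m≤n)) ⟩
      a *v δ +v rotate (pad c (suc n))        ≡⟨ cong (λ z → a *v δ +v push z (pad c (suc n))) (last-pad c m≤n) ⟩
      a *v δ +v push 𝟘 (pad c (suc n))        ≡⟨ cong (a *v δ +v_) (push-pad 𝟘 c m≤n) ⟩
      a *v δ +v (𝟘 ∷ pad c n)                 ≡⟨ cong₂ _∷_ (trans (R.+-identityʳ _) (R.*-identityʳ a))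
                                                   (trans (cong (_+v pad c n) (ShiftModule.•-𝟎 (A n) a))
                                                          (ShiftModule.identityˡ (A n) _)) ⟩
      a ∷ pad c n                             ∎
      where open ≡-Reasoning

    act-generator : (c : Coeffs (suc n)) → act c δ ≡ c
    act-generator c = trans (act-pad c ≤-refl) (pad-id c)

    generator-periodic : iter rotate (suc n) δ ≡ δ
    generator-periodic = begin
      rotate (iter rotate n δ)                       ≡⟨ cong rotate (begin
        iter rotate n δ                                ≡⟨ •-identity _ ⟨
        𝟙 *v iter rotate n δ                           ≡⟨ identityˡ _ ⟨
        0v +v 𝟙 *v iter rotate n δ                     ≡⟨ cong (_+v 𝟙 *v iter rotate n δ) (act-0v {n} δ) ⟨
        act (0v {n}) δ +v 𝟙 *v iter rotate n δ         ≡⟨ act-∷ʳ (0v {n}) 𝟙 δ ⟨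
        act (0v {n} ∷ʳ 𝟙) δ                            ≡⟨ act-generator (0v {n} ∷ʳ 𝟙) ⟩
        0v {n} ∷ʳ 𝟙                                    ∎) ⟩
      rotate (0v {n} ∷ʳ 𝟙)                           ≡⟨ rotate-∷ʳ 0v 𝟙 ⟩
      δ                                              ∎
      where open ≡-Reasoning

    periodic : ∀ x → iter rotate (suc n) x ≡ x
    periodic x = begin
      iter rotate (suc n) x             ≡⟨ cong (iter rotate (suc n)) (act-generator x) ⟨
      iter rotate (suc n) (act x δ)     ≡⟨ act-iter x (suc n) δ ⟨
      act x (iter rotate (suc n) δ)     ≡⟨ cong (act x) generator-periodic ⟩
      act x δ                           ≡⟨ act-generator x ⟩
      x                                 ∎
      where open ≡-Reasoning

  -- The universal property of the cyclic algebra: 1 may be sent to any `u` with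
  -- `iter T (suc n) u ≡ u`. Compatibility with the shift is where this is used, for the coefficient
  -- that wraps around.
  orbit-map : (V : ShiftModule) → let open ShiftModule V in ∀ {n} u → iter T (suc n) u ≡ u → Hom (A (suc n)) V
  orbit-map V {n} u fixed = record
    { ⟦_⟧ = λ c → act c u
    ; ⊕-homo = λ c d → act-+ˡ c d u
    ; •-homo = λ a c → act-*ˡ a c u
    ; T-homo = λ c → T-homo c (Vec.initLast c)
    }
    where
    open ShiftModule V
    open ≡-Reasoning
    T-homo : ∀ c → (∃₂ λ e a → c ≡ e ∷ʳ a) → act (rotate c) u ≡ T (act c u)
    T-homo _ (e , a , refl) = begin
      act (rotate (e ∷ʳ a)) u              ≡⟨ cong (λ c → act c u) (rotate-∷ʳ e a) ⟩
      a • u ⊕ act e (T u)                  ≡⟨ comm _ _ ⟩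
      act e (T u) ⊕ a • u                  ≡⟨ cong (λ y → act e (T u) ⊕ a • y) (trans (iter-suc T n u) fixed) ⟨
      act e (T u) ⊕ a • iter T n (T u)     ≡⟨ act-∷ʳ e a (T u) ⟨
      act (e ∷ʳ a) (T u)                   ≡⟨ act-T (e ∷ʳ a) u ⟩
      T (act (e ∷ʳ a) u)                   ∎

  rotate-injective : ∀ {n} {x y : Coeffs n} → rotate x ≡ rotate y → x ≡ y
  rotate-injective {zero}  {[]} {[]} _  = refl
  rotate-injective {suc n} {x}  {y}  eq = begin
    x                           ≡⟨ periodic x ⟨
    iter rotate (suc n) x       ≡⟨ iter-suc rotate n x ⟨
    iter rotate n (rotate x)    ≡⟨ cong (iter rotate n) eq ⟩
    iter rotate n (rotate y)    ≡⟨ iter-suc rotate n y ⟩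
    iter rotate (suc n) y       ≡⟨ periodic y ⟩
    y                           ∎
    where open ≡-Reasoning

  -- The linear form `last` along the orbit of `x`: the initial values of a linear recurrence.
  coords : ∀ {n} m → Coeffs n → Coeffs m
  coords zero    x = []
  coords (suc m) x = last x ∷ coords m (rotate x)

  module _ {n : ℕ} where
    open ShiftModule (A n)

    coords-+ : ∀ m x y → coords m (x +v y) ≡ coords m x +v coords m y
    coords-+ zero    x y = refl
    coords-+ (suc m) x y = cong₂ _∷_ (last-+ x y) (trans (cong (coords m) (T-⊕ x y)) (coords-+ m (rotate x) (rotate y)))

    coords-* : ∀ m a x → coords m (a *v x) ≡ a *v coords m x
    coords-* zero    a x = refl
    coords-* (suc m) a x = cong₂ _∷_ (last-* a x) (trans (cong (coords m) (T-• a x)) (coords-* m a (rotate x)))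

    coords-∷ʳ : ∀ m (x : Coeffs n) → coords (suc m) x ≡ coords m x ∷ʳ last (iter rotate m x)
    coords-∷ʳ zero    x = refl
    coords-∷ʳ (suc m) x = cong (last x ∷_) (trans (coords-∷ʳ m (rotate x))
      (cong (λ y → coords m (rotate x) ∷ʳ last y) (iter-suc rotate m x)))

    last-act : ∀ {m} (c : Coeffs m) x → coords m x ≡ 0v → last (act c x) ≡ 𝟘
    last-act []      x _  = last-0v {n}
    last-act (a ∷ c) x eq = begin
      last (a *v x +v act c (rotate x))         ≡⟨ last-+ (a *v x) (act c (rotate x)) ⟩
      last (a *v x) ⊞ last (act c (rotate x))   ≡⟨ cong₂ _⊞_ (last-* a x) (last-act c (rotate x) (Vec.∷-injectiveʳ eq)) ⟩
      a ⊠ last x ⊞ 𝟘                            ≡⟨ R.+-identityʳ _ ⟩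
      a ⊠ last x                                ≡⟨ cong (a ⊠_) (Vec.∷-injectiveˡ eq) ⟩
      a ⊠ 𝟘                                     ≡⟨ R.zeroʳ a ⟩
      𝟘                                         ∎
      where open ≡-Reasoning

  ZeroPrefix : ∀ {n} → ℕ → Coeffs n → Set
  ZeroPrefix zero    v       = ⊤
  ZeroPrefix (suc j) []      = ⊤
  ZeroPrefix (suc j) (x ∷ v) = x ≡ 𝟘 × ZeroPrefix j v

  push-ZeroPrefix : ∀ {n} j {a} (v : Coeffs n) → a ≡ 𝟘 → ZeroPrefix j v → ZeroPrefix (suc j) (push a v)
  push-ZeroPrefix j       []      a≡0 z         = tt
  push-ZeroPrefix zero    (x ∷ v) a≡0 z         = a≡0 , tt
  push-ZeroPrefix (suc j) (x ∷ v) a≡0 (x≡0 , z) = a≡0 , push-ZeroPrefix j v x≡0 z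

  ZeroPrefix⇒0v : ∀ {n} (v : Coeffs n) → ZeroPrefix n v → v ≡ 0v
  ZeroPrefix⇒0v []      _         = refl
  ZeroPrefix⇒0v (x ∷ v) (x≡0 , z) = cong₂ _∷_ x≡0 (ZeroPrefix⇒0v v z)

  module _ {n : ℕ} where
    open ShiftModule (A (suc n))

    Recurrent : ∀ {m} → Coeffs m → Coeffs (suc n) → Set
    Recurrent {m} c x = iter rotate m x ≡ act c x

    -- With zero initial values the recurrence keeps `last` zero along the whole orbit. Each
    -- rotation moves such a zero to the front, so after `suc n` rotations, which together are the
    -- identity, the vector is zero.
    recurrent-zero : ∀ {m} (c : Coeffs m) x → Recurrent c x → coords m x ≡ 0v → x ≡ 0v
    recurrent-zero {m} c x rec eq₀ = begin
      x                        ≡⟨ periodic x ⟨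
      iter rotate (suc n) x    ≡⟨ ZeroPrefix⇒0v _ (prefix (suc n)) ⟩
      0v                       ∎
      where
      open ≡-Reasoning
      extended : ∀ y → Recurrent c y → coords m y ≡ 0v → coords (suc m) y ≡ 0v
      extended y rec eq₀ = trans (coords-∷ʳ m y)
        (trans (cong₂ _∷ʳ_ eq₀ (trans (cong last rec) (last-act c y eq₀))) 0v-∷ʳ)
      vanish : ∀ j → Recurrent c (iter rotate j x) × coords m (iter rotate j x) ≡ 0v
      vanish zero = rec , eq₀
      vanish (suc j) with vanish j
      ... | rec′ , eq₀′ = trans (iter-suc rotate m _) (trans (cong rotate rec′) (sym (act-T c _)))
                         , Vec.∷-injectiveʳ (extended _ rec′ eq₀′)
      prefix : ∀ j → ZeroPrefix j (iter rotate j x)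
      prefix zero    = tt
      prefix (suc j) = let rec′ , eq₀′ = vanish j in
        push-ZeroPrefix j _ (Vec.∷-injectiveˡ (extended _ rec′ eq₀′)) (prefix j)

    coords-injective : ∀ {m} (c : Coeffs m) {x y} → Recurrent c x → Recurrent c y →
                       coords m x ≡ coords m y → x ≡ y
    coords-injective {m} c {x} {y} recˣ recʸ eq = x⊕neg-y≡𝟎⇒x≡y (recurrent-zero c (x +v neg y)
      (begin
        iter rotate m (x +v neg y)                ≡⟨ iter-⊕ m x (neg y) ⟩
        iter rotate m x +v iter rotate m (neg y)  ≡⟨ cong₂ _+v_ recˣ (trans (iter-• m (⊟ 𝟙) y) (cong neg recʸ)) ⟩
        act c x +v neg (act c y)                  ≡⟨ cong (act c x +v_) (act-•ʳ c (⊟ 𝟙) y) ⟨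
        act c x +v act c (neg y)                  ≡⟨ act-⊕ʳ c x (neg y) ⟨
        act c (x +v neg y)                        ∎)
      (begin
        coords m (x +v neg y)                     ≡⟨ coords-+ m x (neg y) ⟩
        coords m x +v coords m (neg y)            ≡⟨ cong₂ _+v_ eq (coords-* m (⊟ 𝟙) y) ⟩
        coords m y +v (⊟ 𝟙) *v coords m y         ≡⟨ trans (ShiftModule.comm (A m) _ _) (ShiftModule.neg-inverseˡ (A m) _) ⟩
        0v                                        ∎))
      where
      open ≡-Reasoning

    -- The solutions of a recurrence of length m form a space of dimension at
    -- most m, so any injective family of q^m solutions is exhaustive.
    recurrent-onto : ∀ {m} (c : Coeffs m) (h : Coeffs m → Coeffs (suc n)) → (∀ s → Recurrent c (h s)) →
                     (∀ {s t} → h s ≡ h t → s ≡ t) → ∀ {x} → Recurrent c x → ∃ λ s → h s ≡ x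
    recurrent-onto {m} c h rec h-inj {x} recˣ =
      let s , eq = injective⇒surjective (coords m ∘ h)
                     (λ eq → h-inj (coords-injective c (rec _) (rec _) eq)) (coords m x)
      in s , coords-injective c (rec s) recˣ eq

    -- Being fixed by `g` rotations is the recurrence of length `g` given by the constant polynomial
    -- 1, so `g` initial values determine a fixed point.
    fixed-injective : ∀ {g} → 1 ≤ g → ∀ {x y : Coeffs (suc n)} → iter rotate g x ≡ x → iter rotate g y ≡ y →
                      coords g x ≡ coords g y → x ≡ y
    fixed-injective {suc g} _ {x} {y} fixˣ fixʸ =
      coords-injective δ (trans fixˣ (sym (act-δ {g} x))) (trans fixʸ (sym (act-δ {g} y)))

n<2^n : ∀ n → n < 2 ^ n
n<2^n zero    = s≤s z≤n
n<2^n (suc n) = begin-strict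
  suc n            <⟨ s≤s (n<2^n n) ⟩
  suc (2 ^ n)      ≤⟨ +-monoˡ-≤ (2 ^ n) (m^n>0 2 n) ⟩
  2 ^ n + 2 ^ n    ≡⟨ cong (2 ^ n +_) (+-identityʳ (2 ^ n)) ⟨
  2 ^ suc n        ∎
  where open ≤-Reasoning

injection⇒^≤^ : ∀ {a b m k} (f : Vec (Fin a) m → Vec (Fin b) k) →
                (∀ {u v} → f u ≡ f v → u ≡ v) → a ^ m ≤ b ^ k
injection⇒^≤^ {a} {b} {m} {k} f f-inj = ≤-trans
  (≤-reflexive (sym (Counting.#-⊤ (finVec m) (λ _ → yes tt) _)))
  (#≤size {finX = finVec m} {finY = finVec k} (λ _ → yes tt) (λ u _ → f u) (λ _ _ → f-inj))

^-cancelʳ-≤ : ∀ {a} m k → 1 < a → a ^ m ≤ a ^ k → m ≤ k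
^-cancelʳ-≤ {a} m k 1<a le = ≮⇒≥ λ k<m → <⇒≱ (^-monoʳ-< a 1<a k<m) le

injection-onto : ∀ {a m k} → 1 < a → k ≤ m → (f : Vec (Fin a) m → Vec (Fin a) k) →
                 (∀ {u v} → f u ≡ f v → u ≡ v) → ∀ v → ∃ λ u → f u ≡ v
injection-onto {m = m} {k} 1<a k≤m f f-inj with ≤-antisym k≤m (^-cancelʳ-≤ m k 1<a (injection⇒^≤^ f f-inj))
... | refl = Counting.injective⇒surjective (finVec k) f f-inj

module _ {q : ℕ} {F : FieldOn q} where
  open FieldOn F
  open OverField F

  module _ (V : ShiftModule) (_≟_ : DecidableEquality (ShiftModule.Carrier V)) where
    open ShiftModule V

    -- Rank and nullity by counting: the upper `l` coefficients are free, and the lower ones are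
    -- then forced, since they must express a given element of the cyclic submodule of `u` in its
    -- basis.
    annihilator-size : ∀ {u} (o : Order u) {N l} → N ≡ order o + l →
                       #v (λ (c : Coeffs N) → act c u ≟ 𝟎) ≡ q ^ l
    annihilator-size {u} o {l = l} refl = ≤-antisym
      (#≤size {finX = finVec (m + l)} {finY = finVec l} (λ c → act c u ≟ 𝟎) (λ c _ → Vec.drop m c)
        λ {c} {d} pc pd eq → begin
          c                              ≡⟨ Vec.take++drop≡id m c ⟨
          Vec.take m c ++ Vec.drop m c   ≡⟨ cong₂ _++_ (Order.injective o (cancelˡ _ (begin
            act (Vec.drop m c) (iter T m u) ⊕ act (Vec.take m c) u ≡⟨ split c ⟩
            act c u                                                ≡⟨ trans pc (sym pd) ⟩
            act d u                                                ≡⟨ split d ⟨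
            act (Vec.drop m d) (iter T m u) ⊕ act (Vec.take m d) u ≡⟨ cong (λ e → act e (iter T m u) ⊕ act (Vec.take m d) u) eq ⟨
            act (Vec.drop m c) (iter T m u) ⊕ act (Vec.take m d) u ∎))) eq ⟩
          Vec.take m d ++ Vec.drop m d   ≡⟨ Vec.take++drop≡id m d ⟩
          d                              ∎)
      (size≤# {finX = finVec l} {finY = finVec (m + l)} (λ c → act c u ≟ 𝟎) complete
        complete-annihilates (λ eq → Vec.++-injectiveʳ _ _ eq))
      where
      open ≡-Reasoning
      m = order o
      split : (c : Coeffs (m + l)) → act (Vec.drop m c) (iter T m u) ⊕ act (Vec.take m c) u ≡ act c u
      split c = trans (comm _ _) (trans (sym (act-++ (Vec.take m c) (Vec.drop m c) u))
        (cong (λ c → act c u) (Vec.take++drop≡id m c)))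
      tail : (c : Coeffs l) → ∃ λ (d : Coeffs m) → act d u ≡ neg (act c (iter T m u))
      tail c with Order.span o ((⊟ 𝟙) *v (0v {m} ++ c))
      ... | d , eq = d , (begin
        act d u                                        ≡⟨ eq ⟩
        act ((⊟ 𝟙) *v (0v {m} ++ c)) u                 ≡⟨ act-*ˡ (⊟ 𝟙) (0v {m} ++ c) u ⟩
        neg (act (0v {m} ++ c) u)                      ≡⟨ cong neg (act-++ (0v {m}) c u) ⟩
        neg (act (0v {m}) u ⊕ act c (iter T m u))      ≡⟨ cong (λ x → neg (x ⊕ act c (iter T m u))) (act-0v {m} u) ⟩
        neg (𝟎 ⊕ act c (iter T m u))                   ≡⟨ cong neg (identityˡ _) ⟩
        neg (act c (iter T m u))                       ∎)
      complete : Coeffs l → Coeffs (m + l)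
      complete c = proj₁ (tail c) ++ c
      complete-annihilates : ∀ c → act (complete c) u ≡ 𝟎
      complete-annihilates c = begin
        act (complete c) u                                   ≡⟨ act-++ (proj₁ (tail c)) c u ⟩
        act (proj₁ (tail c)) u ⊕ act c (iter T m u)          ≡⟨ cong (_⊕ act c (iter T m u)) (proj₂ (tail c)) ⟩
        neg (act c (iter T m u)) ⊕ act c (iter T m u)        ≡⟨ neg-inverseˡ _ ⟩
        𝟎                                                    ∎

-- Multiplication in the cyclic algebra and its simple submodules.

module CyclicAlgebra {q : ℕ} (F : FieldOn q) (n : ℕ) where
  open FieldOn F
  open OverField F
  open CyclicShift F
  open ShiftModule (A (suc n))

  Elem : Set
  Elem = Coeffs (suc n)

  infixr 7 _⋆_
  -- Elements are coefficient vectors, so the action of polynomials on `A (suc n)` is at the same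
  -- time the multiplication of the algebra, with unit `δ`.
  _⋆_ : Elem → Elem → Elem
  c ⋆ x = act c x

  act-⋆ : (V : ShiftModule) → let module V = ShiftModule V in
          ∀ {u} → iter V.T (suc n) u ≡ u → ∀ c x → V.act (c ⋆ x) u ≡ V.act c (V.act x u)
  act-⋆ V fixed c x = Hom.act-homo (orbit-map V _ fixed) c x

  ⋆-assoc : ∀ c d x → (c ⋆ d) ⋆ x ≡ c ⋆ d ⋆ x
  ⋆-assoc c d x = act-⋆ (A (suc n)) (periodic x) c d

  ⋆-comm : ∀ c d → c ⋆ d ≡ d ⋆ c
  ⋆-comm c d = begin
    c ⋆ d        ≡⟨ cong (c ⋆_) (act-generator d) ⟨
    c ⋆ d ⋆ δ    ≡⟨ act-comm c d δ ⟩
    d ⋆ c ⋆ δ    ≡⟨ cong (d ⋆_) (act-generator c) ⟩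
    d ⋆ c        ∎
    where open ≡-Reasoning

  act-as-⋆ : ∀ {m} (c : Coeffs m) x → act c x ≡ act c δ ⋆ x
  act-as-⋆ c x = begin
    act c x              ≡⟨ cong (act c) (act-generator x) ⟨
    act c (x ⋆ δ)        ≡⟨ act-comm c x δ ⟩
    x ⋆ act c δ          ≡⟨ ⋆-comm x (act c δ) ⟩
    act c δ ⋆ x          ∎
    where open ≡-Reasoning

  abstract
    ord-≤ : ∀ u → Σ (Order u) λ o → order o ≤ suc n
    ord-≤ u = order-of _≡v?_ {n} u (periodic u)

  ord : ∀ u → Order u
  ord u = proj₁ (ord-≤ u)

  deg : Elem → ℕ
  deg u = order (ord u)

  Multiple : Elem → Elem → Set
  Multiple e w = ∃ λ c → c ⋆ e ≡ w

  Multiple? : ∀ e → Decidable (Multiple e)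
  Multiple? e w = ∃v? λ c → c ⋆ e ≡v? w

  multiples-size : ∀ e → #v (Multiple? e) ≡ q ^ deg e
  multiples-size e = ≤-antisym
    (#≤size {finX = finVec (suc n)} {finY = finVec (deg e)} (Multiple? e)
      (λ w (c , _) → proj₁ (Order.span (ord e) c))
      λ { (c , refl) (d , refl) eq → trans (sym (proj₂ (Order.span (ord e) c)))
            (trans (cong (λ z → act z e) eq) (proj₂ (Order.span (ord e) d))) })
    (size≤# {finX = finVec (deg e)} {finY = finVec (suc n)} (Multiple? e) (λ c → act c e)
      (λ c → act c δ , sym (act-as-⋆ c e)) (Order.injective (ord e)))

  annihilator-bound : ∀ e → #v (λ (c : Elem) → c ⋆ e ≡v? 0v) * q ^ deg e ≡ q ^ suc n
  annihilator-bound e = trans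
    (cong (_* q ^ deg e) (annihilator-size (A (suc n)) _≡v?_ (ord e) {l = suc n ∸ deg e} (sym deg+rest)))
    (trans (*-comm (q ^ (suc n ∸ deg e)) _) (trans (sym (^-distribˡ-+-* q (deg e) _)) (cong (q ^_) deg+rest)))
    where deg+rest = m+[n∸m]≡n (proj₂ (ord-≤ e))

  -- The submodule generated by `e` is simple: every nonzero multiple of `e` generates `e` back.
  Simple : Elem → Set
  Simple e = e ≢ 0v × ∀ x → x ⋆ e ≡ 0v ⊎ ∃ λ y → y ⋆ x ⋆ e ≡ e

  Simple? : Decidable Simple
  Simple? e = ¬? (e ≡v? 0v) ×-dec ∀v? λ x → (x ⋆ e ≡v? 0v) ⊎-dec ∃v? λ y → y ⋆ x ⋆ e ≡v? e

  -- If the degree did not drop, expressing the multiples of `x ⋆ u` in the basis of `u` would, by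
  -- counting, reach all coefficient vectors, and hence `u`.
  deg-decreases : ∀ u x → ¬ Multiple (x ⋆ u) u → deg (x ⋆ u) < deg u
  deg-decreases u x ¬mult = ≰⇒> λ le →
    let s , eq = injection-onto 1<N le (proj₁ ∘ spanned) injective (proj₁ u.span-self)
    in ¬mult (act s δ , trans (sym (act-as-⋆ s (x ⋆ u)))
         (trans (sym (proj₂ (spanned s))) (trans (cong (λ c → act c u) eq) (proj₂ u.span-self))))
    where
    module u = Order (ord u)
    module xu = Order (ord (x ⋆ u))
    spanned : (d : Coeffs (deg (x ⋆ u))) → ∃ λ (c : Coeffs (deg u)) → act c u ≡ act d (x ⋆ u)
    spanned d = let c , eq = u.span (act d x) in
      c , trans eq (trans (cong (λ z → act z u) (act-as-⋆ d x))
            (trans (⋆-assoc (act d δ) x u) (sym (act-as-⋆ d (x ⋆ u)))))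
    injective : ∀ {c d} → proj₁ (spanned c) ≡ proj₁ (spanned d) → c ≡ d
    injective {c} {d} eq = xu.injective
      (trans (sym (proj₂ (spanned c))) (trans (cong (λ z → act z u) eq) (proj₂ (spanned d))))

  -- Descent on the degree: if `u` is not simple, some nonzero multiple fails to generate `u` back,
  -- and it has smaller degree.
  simple-multiple : ∀ u → u ≢ 0v → ∃ λ x → Simple (x ⋆ u)
  simple-multiple u u≢0 = search (deg u) u u≢0 ≤-refl
    where
    Reducing : Elem → Pred Elem 0ℓ
    Reducing u x = x ⋆ u ≢ 0v × ¬ Multiple (x ⋆ u) u

    Reducing? : ∀ u → Decidable (Reducing u)
    Reducing? u x = ¬? (x ⋆ u ≡v? 0v) ×-dec ¬? (Multiple? (x ⋆ u) u)

    irreducible : ∀ u → ¬ ∃ (Reducing u) → ∀ x → x ⋆ u ≡ 0v ⊎ Multiple (x ⋆ u) u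
    irreducible u none x = cases (x ⋆ u ≡v? 0v) (Multiple? (x ⋆ u) u)
      where
      cases : Dec (x ⋆ u ≡ 0v) → Dec (Multiple (x ⋆ u) u) → x ⋆ u ≡ 0v ⊎ Multiple (x ⋆ u) u
      cases (yes z) _       = inj₁ z
      cases (no _)  (yes y) = inj₂ y
      cases (no ¬z) (no ¬y) = contradiction (x , ¬z , ¬y) none

    search : ∀ fuel u → u ≢ 0v → deg u ≤ fuel → ∃ λ x → Simple (x ⋆ u)
    reduce : ∀ fuel u → u ≢ 0v → deg u ≤ fuel → Dec (∃ (Reducing u)) → ∃ λ x → Simple (x ⋆ u)

    search fuel u u≢0 le = reduce fuel u u≢0 le (∃v? (Reducing? u))

    reduce fuel u u≢0 le (no none) =
      δ , subst Simple (sym (act-δ {n} u)) (u≢0 , irreducible u none)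
    reduce zero u u≢0 le (yes (x , _ , ¬mult)) =
      contradiction (≤-trans (deg-decreases u x ¬mult) le) λ ()
    reduce (suc fuel) u u≢0 le (yes (x , xu≢0 , ¬mult)) =
      let y , simple = search fuel (x ⋆ u) xu≢0 (≤-pred (≤-trans (deg-decreases u x ¬mult) le))
      in y ⋆ x , subst Simple (sym (⋆-assoc y x u)) simple

  simple-return : ∀ {e w} → Simple e → Multiple e w → w ≢ 0v → Multiple w e
  simple-return (_ , s) (x , refl) w≢0 with s x
  ... | inj₁ z = contradiction z w≢0
  ... | inj₂ m = m

  -- Let g = T^m - c be the annihilator of e of least degree m.  If g kills e′
  -- too, then e′ is one of the q^m solutions of g x = 0, all of which are
  -- multiples of e.
  pair-separator : ∀ e e′ → ¬ Multiple e e′ → ∃ λ a → a ⋆ e ≡ 0v × a ⋆ e′ ≢ 0v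
  pair-separator e e′ ¬mult = g , g⋆e , λ g⋆e′ →
    let s , eq = recurrent-onto relation (λ c → act c e) recurrent injective
                   (sym (x⊕neg-y≡𝟎⇒x≡y (trans (sym (act-g e′)) g⋆e′)))
    in ¬mult (act s δ , trans (sym (act-as-⋆ s e)) eq)
    where
    open Order (ord e)
    g = act relation δ +v neg (iter rotate (deg e) δ)
    act-g : ∀ x → g ⋆ x ≡ act relation x +v neg (iter rotate (deg e) x)
    act-g x = begin
      g ⋆ x                                                         ≡⟨ ⋆-comm g x ⟩
      x ⋆ g                                                         ≡⟨ act-⊕ʳ x _ _ ⟩
      x ⋆ act relation δ +v x ⋆ neg (iter rotate (deg e) δ)         ≡⟨ cong₂ _+v_
        (trans (⋆-comm x _) (sym (act-as-⋆ relation x)))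
        (trans (act-•ʳ x (⊟ 𝟙) _) (cong neg (trans (act-iter x (deg e) δ)
          (cong (iter rotate (deg e)) (act-generator x))))) ⟩
      act relation x +v neg (iter rotate (deg e) x)                 ∎
      where open ≡-Reasoning
    g⋆e : g ⋆ e ≡ 0v
    g⋆e = trans (act-g e) (trans (cong (_+v neg (iter rotate (deg e) e)) relates)
      (trans (comm _ _) (neg-inverseˡ _)))
    recurrent : ∀ s → Recurrent relation (act s e)
    recurrent s = trans (sym (act-iter s (deg e) e))
      (trans (cong (act s) (sym relates)) (act-comm s relation e))

  -- The Chinese remainder idea. In the product `x ⋆ y ⋆ a`, the factor `a` kills the new entry but
  -- not `e`, `y` undoes the effect of `a` on the simple `e`, and `x` is the separator for the
  -- shorter list; commutativity lets each factor act first where it is needed.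
  separator : ∀ {e} → Simple e → ∀ {L} → All (λ e′ → ¬ Multiple e′ e) L →
              ∃ λ x → x ⋆ e ≡ e × All (λ e′ → x ⋆ e′ ≡ 0v) L
  separator {e} simple []            = δ , act-δ {n} e , []
  separator {e} simple (_∷_ {x = e₁} {xs = L} ¬m ¬ms) =
    let x , xe , xL  = separator simple ¬ms
        a , ae₁ , ae = pair-separator e₁ e ¬m
        y , yae      = simple-return simple (a , refl) ae
    in combine x xe xL a ae₁ y yae
    where
    combine : ∀ x → x ⋆ e ≡ e → All (λ e′ → x ⋆ e′ ≡ 0v) L → ∀ a → a ⋆ e₁ ≡ 0v → ∀ y → y ⋆ a ⋆ e ≡ e →
              ∃ λ z → z ⋆ e ≡ e × All (λ e′ → z ⋆ e′ ≡ 0v) (e₁ ∷ L)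
    combine x xe xL a ae₁ y yae = x ⋆ y ⋆ a
      , (begin
        (x ⋆ y ⋆ a) ⋆ e    ≡⟨ ⋆-assoc x (y ⋆ a) e ⟩
        x ⋆ (y ⋆ a) ⋆ e    ≡⟨ cong (x ⋆_) (trans (⋆-assoc y a e) yae) ⟩
        x ⋆ e              ≡⟨ xe ⟩
        e                  ∎)
      , (begin
        (x ⋆ y ⋆ a) ⋆ e₁   ≡⟨ ⋆-assoc x (y ⋆ a) e₁ ⟩
        x ⋆ (y ⋆ a) ⋆ e₁   ≡⟨ cong (x ⋆_) (⋆-assoc y a e₁) ⟩
        x ⋆ y ⋆ a ⋆ e₁     ≡⟨ cong (λ w → x ⋆ y ⋆ w) ae₁ ⟩
        x ⋆ y ⋆ 0v         ≡⟨ cong (x ⋆_) (act-𝟎 y) ⟩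
        x ⋆ 0v             ≡⟨ act-𝟎 x ⟩
        0v                 ∎)
      ∷ All.map (λ {e′} eq → begin
        (x ⋆ y ⋆ a) ⋆ e′   ≡⟨ cong (_⋆ e′) (⋆-comm x (y ⋆ a)) ⟩
        ((y ⋆ a) ⋆ x) ⋆ e′ ≡⟨ ⋆-assoc (y ⋆ a) x e′ ⟩
        (y ⋆ a) ⋆ x ⋆ e′   ≡⟨ cong ((y ⋆ a) ⋆_) eq ⟩
        (y ⋆ a) ⋆ 0v       ≡⟨ act-𝟎 (y ⋆ a) ⟩
        0v                 ∎) xL
      where open ≡-Reasoning

  Inequivalent : List Elem → Set
  Inequivalent = AllPairs (λ e e′ → ¬ Multiple e′ e)

  record Representatives (P : Pred Elem 0ℓ) : Set where
    field
      reps         : List Elem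
      reps-P       : All P reps
      inequivalent : Inequivalent reps
      covers       : ∀ {e} → P e → Any (λ e′ → Multiple e′ e) reps

  representatives : {P : Pred Elem 0ℓ} → Decidable P → Representatives P
  representatives {P} P? = record
    { reps = proj₁ all ; reps-P = proj₁ (proj₂ all) ; inequivalent = proj₁ (proj₂ (proj₂ all))
    ; covers = λ {e} → proj₂ (proj₂ (proj₂ all)) (subst (_∈ elems) (strictlyInverseˡ e) (∈-tabulate⁺ (from e))) }
    where
    open Inverse (finVec {q} (suc n))
    elems = List.tabulate to
    build : ∀ xs → ∃ λ L → All P L × Inequivalent L × ∀ {e} → e ∈ xs → P e → Any (λ e′ → Multiple e′ e) L
    build [] = [] , [] , [] , λ ()
    build (x ∷ xs) with build xs
    ... | L , L-P , ineq , cov with P? x | Any.any? (λ e′ → Multiple? e′ x) L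
    ...   | no ¬Px | _        = L , L-P , ineq , λ { (here refl) Px → contradiction Px ¬Px ; (there i) → cov i }
    ...   | yes _  | yes any  = L , L-P , ineq , λ { (here refl) _ → any ; (there i) → cov i }
    ...   | yes Px | no ¬any  = x ∷ L , Px ∷ L-P , All.¬Any⇒All¬ L ¬any ∷ ineq ,
                                λ { (here refl) _ → here (δ , act-δ {n} x) ; (there i) Pe → there (cov i Pe) }
    all = build elems

  select : Fin 2 → Elem → Elem
  select zero    e = 0v
  select (suc _) e = e

  -- The sum of inequivalent simple submodules is direct. Coefficients 0 and 1 already give 2^length
  -- distinct elements, enough to bound the length.
  subsetSum : (L : List Elem) → Vec (Fin 2) (length L) → Elem
  subsetSum []      []       = 0v
  subsetSum (e ∷ L) (b ∷ bs) = select b e +v subsetSum L bs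

  act-select : ∀ x b {e} → x ⋆ e ≡ e → x ⋆ select b e ≡ select b e
  act-select x zero       _  = act-𝟎 x
  act-select x (suc zero) eq = eq

  act-subsetSum : ∀ x {L} → All (λ e → x ⋆ e ≡ 0v) L → ∀ bs → x ⋆ subsetSum L bs ≡ 0v
  act-subsetSum x []       []                = act-𝟎 x
  act-subsetSum x (z ∷ zs) (zero ∷ bs)       =
    trans (cong (x ⋆_) (identityˡ _)) (act-subsetSum x zs bs)
  act-subsetSum x (z ∷ zs) (suc zero ∷ bs)   =
    trans (act-⊕ʳ x _ _) (trans (cong₂ _+v_ z (act-subsetSum x zs bs)) (identityˡ _))

  select-injective : ∀ {e} → e ≢ 0v → ∀ {b b′} → select b e ≡ select b′ e → b ≡ b′
  select-injective e≢0 {zero}     {zero}     _  = refl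
  select-injective e≢0 {zero}     {suc zero} eq = contradiction (sym eq) e≢0
  select-injective e≢0 {suc zero} {zero}     eq = contradiction eq e≢0
  select-injective e≢0 {suc zero} {suc zero} _  = refl

  -- The separator of the head from the tail fixes the head and kills the rest of the sum, so it
  -- reads off the first bit.
  subsetSum-injective : ∀ {L} → All Simple L → Inequivalent L → ∀ {bs bs′} →
                        subsetSum L bs ≡ subsetSum L bs′ → bs ≡ bs′
  subsetSum-injective []       []              {[]}     {[]}       _  = refl
  subsetSum-injective {e ∷ L} (s ∷ ss) (ineq ∷ ineqs) {b ∷ bs} {b′ ∷ bs′} eq =
    cong₂ _∷_ (select-injective (proj₁ s) heads)
    (subsetSum-injective ss ineqs (cancelˡ (select b e) (trans eq (cong (_+v subsetSum L bs′) (sym heads)))))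
    where
    x = proj₁ (separator s ineq)
    xe = proj₁ (proj₂ (separator s ineq))
    xL = proj₂ (proj₂ (separator s ineq))
    isolate : ∀ b bs → x ⋆ (select b e +v subsetSum L bs) ≡ select b e
    isolate b bs = trans (act-⊕ʳ x _ _)
      (trans (cong₂ _+v_ (act-select x b xe) (act-subsetSum x xL bs)) (identityʳ _))
    heads : select b e ≡ select b′ e
    heads = trans (sym (isolate b bs)) (trans (cong (x ⋆_) eq) (isolate b′ bs′))

  iter-𝟎 : ∀ g → iter rotate g (0v {suc n}) ≡ 0v
  iter-𝟎 zero    = refl
  iter-𝟎 (suc g) = trans (cong rotate (iter-𝟎 g)) T-𝟎

  subsetSum-fixed : ∀ {g L} → All (λ e → iter rotate g e ≡ e) L → ∀ bs → iter rotate g (subsetSum L bs) ≡ subsetSum L bs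
  subsetSum-fixed {g} []           []             = iter-𝟎 g
  subsetSum-fixed {g} {e ∷ L} (fix ∷ fixes) (b ∷ bs) = trans (iter-⊕ g (select b e) (subsetSum L bs))
    (cong₂ _+v_ (select-fixed b) (subsetSum-fixed {g} fixes bs))
    where
    select-fixed : ∀ b → iter rotate g (select b e) ≡ select b e
    select-fixed zero    = iter-𝟎 g
    select-fixed (suc _) = fix

  -- Distinct subset sums are distinct fixed points of T^g.
  length-bound : ∀ {g} → 1 ≤ g → ∀ {L} → All Simple L → Inequivalent L →
                 All (λ e → iter rotate g e ≡ e) L → length L ≤ q * g
  length-bound {g} 1≤g {L} simple ineq fixes = ^-cancelʳ-≤ (length L) (q * g) ≤-refl (begin
    2 ^ length L   ≤⟨ injection⇒^≤^ (coords g ∘ subsetSum L) (λ eq → subsetSum-injective simple ineq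
                        (fixed-injective 1≤g (subsetSum-fixed {g} fixes _) (subsetSum-fixed {g} fixes _) eq)) ⟩
    -- Comparing powers of 2 through `q ≤ 2 ^ q` takes the place of a logarithm and is the source of
    -- the factor `q`.
    q ^ g          ≤⟨ ^-monoˡ-≤ g (<⇒≤ (n<2^n q)) ⟩
    (2 ^ q) ^ g    ≡⟨ ^-*-assoc 2 q g ⟩
    2 ^ (q * g)    ∎)
    where open ≤-Reasoning

  -- End(Ae) is a field with q^deg e elements, in which T is nonzero.
  simple-fixed : ∀ {e} → Simple e → iter rotate (q ^ deg e ∸ 1) e ≡ e
  simple-fixed {e} simple = subst (λ k → iter rotate k e ≡ e) #nonzero
    (iter-# (finVec (suc n)) rotate rotate-injective nonzero? stable e
      (λ i ((x , xe) , w≢0) eq → let y , yw = simple-return simple (x , xe) w≢0 in transfer i y yw eq)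
      (λ i ((x , xe) , _) eq → transfer i x xe eq))
    where
    nonzero? : Decidable (Multiple e ∩ ∁ (_≡ 0v))
    nonzero? = Multiple? e ∩? ∁? (_≡v? 0v)
    stable : ∀ {x} → (Multiple e ∩ ∁ (_≡ 0v)) x → (Multiple e ∩ ∁ (_≡ 0v)) (rotate x)
    stable ((c , refl) , x≢0) =
      (rotate c , Hom.T-homo (orbit-map (A (suc n)) e (periodic e)) c) , λ eq → x≢0 (rotate-injective (trans eq (sym T-𝟎)))
    transfer : ∀ i c {u w} → c ⋆ u ≡ w → iter rotate i u ≡ u → iter rotate i w ≡ w
    transfer i c {u} refl eq = trans (sym (act-iter c i u)) (cong (c ⋆_) eq)
    #zero : #v (Multiple? e ∩? (_≡v? 0v)) ≡ 1
    #zero = #-singleton {fin = finVec (suc n)} (Multiple? e ∩? (_≡v? 0v)) ((0v , act-0v {suc n} e) , refl) proj₂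
    #nonzero : #v nonzero? ≡ q ^ deg e ∸ 1
    #nonzero = begin
      #v nonzero?                                                        ≡⟨ cong (λ k → k + #v nonzero? ∸ 1) #zero ⟨
      #v (Multiple? e ∩? (_≡v? 0v)) + #v nonzero? ∸ 1         ≡⟨ cong (_∸ 1) (#v-split (Multiple? e) (_≡v? 0v)) ⟨
      #v (Multiple? e) ∸ 1                                               ≡⟨ cong (_∸ 1) (multiples-size e) ⟩
      q ^ deg e ∸ 1                                                                 ∎
      where open ≡-Reasoning

-- Common periods, unions and fibres.

iter-gcd : {X : Set} (f : X → X) {x : X} {a b : ℕ} → iter f a x ≡ x → iter f b x ≡ x → iter f (gcd a b) x ≡ x
iter-gcd f {x} {a} {b} fixᵃ fixᵇ with Bézout.identity (gcd-GCD a b)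
... | Bézout.+- i j eq = begin
  iter f (gcd a b) x                        ≡⟨ cong (iter f (gcd a b)) (iter-fixed-* f {b} fixᵇ j) ⟨
  iter f (gcd a b) (iter f (j * b) x)       ≡⟨ iter-+ f (gcd a b) (j * b) x ⟨
  iter f (gcd a b + j * b) x                ≡⟨ cong (λ k → iter f k x) eq ⟩
  iter f (i * a) x                          ≡⟨ iter-fixed-* f {a} fixᵃ i ⟩
  x                                         ∎
  where open ≡-Reasoning
... | Bézout.-+ i j eq = begin
  iter f (gcd a b) x                        ≡⟨ cong (iter f (gcd a b)) (iter-fixed-* f {a} fixᵃ i) ⟨
  iter f (gcd a b) (iter f (i * a) x)       ≡⟨ iter-+ f (gcd a b) (i * a) x ⟨
  iter f (gcd a b + i * a) x                ≡⟨ cong (λ k → iter f k x) eq ⟩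
  iter f (j * b) x                          ≡⟨ iter-fixed-* f {b} fixᵇ j ⟩
  x                                         ∎
  where open ≡-Reasoning

iter-∣ : {X : Set} (f : X → X) {x : X} {a b : ℕ} → iter f a x ≡ x → a ∣ b → iter f b x ≡ x
iter-∣ f {x} {a} fix (divides k eq) = trans (cong (λ i → iter f i x) eq) (iter-fixed-* f {a} fix k)

module _ {X : Set} {fin : Fin N ↔ X} where
  open Counting fin

  ⋃? : {P : ℕ → Pred X 0ℓ} → (∀ i → Decidable (P i)) → ∀ j → Decidable (λ x → ∃ λ i → i < j × P i x)
  ⋃? P? j x = anyUpTo? (λ i → P? i x) j

  #-⋃ : {P : ℕ → Pred X 0ℓ} (P? : ∀ i → Decidable (P i)) → ∀ j →
        # (⋃? P? j) ≤ sumTo (λ i → # (P? i)) j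
  #-⋃ P? zero = ≤-reflexive (#-∅ {fin = fin} (⋃? P? zero) λ { _ (_ , () , _) })
  #-⋃ {P} P? (suc j) = ≤-trans
    (#-mono {fin = fin} (⋃? P? (suc j)) (⋃? P? j ∪? P? j) λ x (i , i<1+j , p) → cases x i p (m≤n⇒m<n∨m≡n (≤-pred i<1+j)))
    (≤-trans (#-∪ {fin = fin} (⋃? P? j) (P? j)) (+-monoˡ-≤ _ (#-⋃ P? j)))
    where
    cases : ∀ x i → P i x → i < j ⊎ i ≡ j → (∃ λ i → i < j × P i x) ⊎ P j x
    cases x i p (inj₁ i<j)  = inj₁ (i , i<j , p)
    cases x i p (inj₂ refl) = inj₂ p

module _ {X Y Z : Set} {L : ℕ} {finX : Fin M ↔ X} {finY : Fin N ↔ Y} {finZ : Fin L ↔ Z}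
         (g : Z → X) (h : Z → Y) (pair : X → Y → Z)
         (g-pair : ∀ x y → g (pair x y) ≡ x) (h-pair : ∀ x y → h (pair x y) ≡ y)
         (pair-gh : ∀ z → pair (g z) (h z) ≡ z) where
  private
    module X = Counting finX
    module Z = Counting finZ
    module fX = Inverse finX

  #-preimage : {Q : Pred X 0ℓ} (Q? : Decidable Q) → Z.# (Q? ∘ g) ≡ X.# Q? * N
  #-preimage {Q} Q? = go (enumerate (Q? ∘ fX.to))
    where
    finKY : Fin (X.# Q? * N) ↔ (Fin (X.# Q?) × Y)
    finKY = (↔-id _ ×-↔ finY) ↔-∘ Fin.*↔×
    go : (Σ (Fin (X.# Q?) → Fin M) λ e → (∀ i → Q (fX.to (e i))) × (∀ {i j} → e i ≡ e j → i ≡ j) ×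
            (∀ {x} → Q (fX.to x) → ∃ λ i → e i ≡ x)) → Z.# (Q? ∘ g) ≡ X.# Q? * N
    go (e , e-Q , e-inj , e-onto) = ≤-antisym
      (#≤size {finX = finZ} {finY = finKY} (Q? ∘ g) (λ z q → proj₁ (index z q) , h z)
        λ {z} {z′} q q′ eq → begin
          z                    ≡⟨ pair-gh z ⟨
          pair (g z) (h z)     ≡⟨ cong₂ pair (trans (sym (proj₂ (index z q)))
                                    (trans (cong (fX.to ∘ e ∘ proj₁) eq) (proj₂ (index z′ q′)))) (cong proj₂ eq) ⟩
          pair (g z′) (h z′)   ≡⟨ pair-gh z′ ⟩
          z′                   ∎)
      (size≤# {finX = finKY} {finY = finZ} (Q? ∘ g) (λ (i , y) → pair (fX.to (e i)) y)
        (λ (i , y) → subst Q (sym (g-pair _ y)) (e-Q i))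
        λ {(i , y)} {(j , y′)} eq → cong₂ _,_
          (e-inj (trans (sym (fX.strictlyInverseʳ _)) (trans (cong fX.from (trans (sym (g-pair _ y))
            (trans (cong g eq) (g-pair _ y′)))) (fX.strictlyInverseʳ _))))
          (trans (sym (h-pair _ y)) (trans (cong h eq) (h-pair _ y′))))
      where
      open ≡-Reasoning
      index : ∀ z → Q (g z) → ∃ λ i → fX.to (e i) ≡ g z
      index z q = let i , eq = e-onto (subst Q (sym (fX.strictlyInverseˡ (g z))) q) in
        i , trans (cong fX.to eq) (fX.strictlyInverseˡ (g z))

-- Codegrees in the cyclic algebra and reduction to a divisor of its degree.

module _ {q : ℕ} (F : FieldOn q) where
  open FieldOn F

  natural : ℕ → Fin q
  natural j = fold 𝟘 (𝟙 ⊞_) j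

  -- k-normality in F[x]/(xⁿ⁺¹ - 1): the parameter n is one less than the degree.
  DegreeComplement : ∀ n → ℕ → Pred (Vec (Fin q) (suc n)) 0ℓ
  DegreeComplement n k c = CyclicAlgebra.deg F n c + k ≡ suc n

  DegreeComplement? : ∀ n k → Decidable (DegreeComplement n k)
  DegreeComplement? n k c = CyclicAlgebra.deg F n c + k ℕ.≟ suc n

  normals : ℕ → ℕ → ℕ
  normals n k = Counting.# (finVec {q} (suc n)) (DegreeComplement? n k)

codegree⇒ : ∀ {g k m} → g ≤ m → k ≡ m ∸ g → g + k ≡ m
codegree⇒ {g} g≤m eq = trans (cong (g +_) eq) (m+[n∸m]≡n g≤m)

codegree⇐ : ∀ {g k m} → g + k ≡ m → k ≡ m ∸ g
codegree⇐ {g} {k} eq = trans (sym (m+n∸m≡n g k)) (cong (_∸ g) eq)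

module Comparison {q : ℕ} (F : FieldOn q) (d′ r′ : ℕ) where
  open FieldOn F
  open OverField F
  open CyclicShift F

  r d n′ n : ℕ
  r = suc r′
  d = suc d′
  -- In this form `n` is definitionally `r * d`, so that `repeat r` lands in `Elem`.
  n′ = d′ + r′ * d
  n = suc n′

  open CyclicAlgebra F n′
  private
    module D = CyclicAlgebra F d′
    module Aᵈ = ShiftModule (A d)
  open ShiftModule (A n)

  push-++ : ∀ {m l} a (v : Coeffs m) (w : Coeffs l) → push a (v ++ w) ≡ push a v ++ push (lastOr a v) w
  push-++ a []      w = refl
  push-++ a (x ∷ v) w = cong (a ∷_) (push-++ x v w)

  lastOr-++ : ∀ {m l} a (v : Coeffs m) (w : Coeffs l) → lastOr a (v ++ w) ≡ lastOr (lastOr a v) w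
  lastOr-++ a []      w = refl
  lastOr-++ a (x ∷ v) w = lastOr-++ x v w

  repeat : ∀ j → Coeffs d → Coeffs (j * d)
  repeat zero    s = []
  repeat (suc j) s = s ++ repeat j s

  push-repeat : ∀ j s → push (last s) (repeat j s) ≡ repeat j (rotate s)
  push-repeat zero    s = refl
  push-repeat (suc j) s = trans (push-++ (last s) s (repeat j s))
    (cong (rotate s ++_) (trans (cong (λ a → push a (repeat j s)) (lastOr-nonempty _ _ s)) (push-repeat j s)))

  lastOr-repeat : ∀ j s → lastOr (last s) (repeat j s) ≡ last s
  lastOr-repeat zero    s = refl
  lastOr-repeat (suc j) s = trans (lastOr-++ (last s) s (repeat j s))
    (trans (cong (λ a → lastOr a (repeat j s)) (lastOr-nonempty _ _ s)) (lastOr-repeat j s))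

  repeat-+ : ∀ j s t → repeat j (s +v t) ≡ repeat j s +v repeat j t
  repeat-+ zero    s t = refl
  repeat-+ (suc j) s t = trans (cong (s +v t ++_) (repeat-+ j s t)) (sym (Vec.zipWith-++ _⊞_ s _ t _))

  repeat-* : ∀ j a s → repeat j (a *v s) ≡ a *v repeat j s
  repeat-* zero    a s = refl
  repeat-* (suc j) a s = trans (cong (a *v s ++_) (repeat-* j a s)) (sym (Vec.map-++ (a ⊠_) s _))

  embedding : Hom (A d) (A n)
  embedding = record
    { ⟦_⟧ = repeat r
    ; ⊕-homo = repeat-+ r
    ; •-homo = repeat-* r
    ; T-homo = λ s → sym (trans (cong (λ a → push a (repeat r s))
        (trans (lastOr-++ 𝟘 s (repeat r′ s)) (lastOr-repeat r′ s))) (push-repeat r s))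
    }

  -- As polynomials, multiplication by 1 + x^d + ... + x^(n - d). It identifies `A d` with the fixed
  -- points of T^d in `A n`.
  ι : Coeffs d → Elem
  ι = repeat r

  ι-injective : ∀ {s t} → ι s ≡ ι t → s ≡ t
  ι-injective = Vec.++-injectiveˡ _ _

  -- Fixed points of T^d solve a recurrence of length `d`, and `ι` already supplies the q^d
  -- solutions that this allows.
  ι-onto : ∀ {x} → iter rotate d x ≡ x → ∃ λ s → ι s ≡ x
  ι-onto {x} fix = recurrent-onto (δ {d′}) ι
    (λ s → trans (sym (Hom.iter-homo embedding d s)) (trans (cong ι (periodic s)) (sym (act-δ {d′} (ι s)))))
    ι-injective (trans fix (sym (act-δ {d′} x)))

  -- Reduction modulo x^d - 1.
  π : Elem → Coeffs d
  π c = Aᵈ.act c δ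

  ⋆-ι : ∀ c s → c ⋆ ι s ≡ ι (s D.⋆ π c)
  ⋆-ι c s = trans (sym (Hom.act-homo embedding c s))
    (cong ι (trans (D.act-as-⋆ c s) (D.⋆-comm (π c) s)))

  PeriodicAnnihilator : Pred Elem 0ℓ
  PeriodicAnnihilator c = ∀ x → x ⋆ c ≡ 0v → iter rotate d x ≡ x

  -- By `⋆-ι`, `c` acts on the copy of `A d` through `π c`. When the annihilator of `c` lies in that
  -- copy, it corresponds to the annihilator of `π c`; the two codegrees are the exponents of `q` in
  -- the two sizes.
  codegree : ∀ c → PeriodicAnnihilator c → n ∸ deg c ≡ d ∸ D.deg (π c)
  codegree c per = ≤-antisym
    (^-cancelʳ-≤ _ _ 1<N (subst₂ _≤_ #n #d
      (#-≤ {finX = finVec n} {finY = finVec d} (λ x → x ⋆ c ≡v? 0v) (λ s → s D.⋆ π c ≡v? 0v)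
        (λ x p → let s , eq = ι-onto (per x p) in s , ι-injective (begin
          ι (s D.⋆ π c)    ≡⟨ ⋆-ι c s ⟨
          c ⋆ ι s          ≡⟨ cong (c ⋆_) eq ⟩
          c ⋆ x            ≡⟨ ⋆-comm c x ⟩
          x ⋆ c            ≡⟨ p ⟩
          0v               ≡⟨ Hom.𝟎-homo embedding ⟨
          ι 0v             ∎))
        λ {x} {y} p p′ eq → trans (sym (proj₂ (ι-onto (per x p))))
          (trans (cong ι eq) (proj₂ (ι-onto (per y p′)))))))
    (^-cancelʳ-≤ _ _ 1<N (subst₂ _≤_ #d #n
      (#-≤ {finX = finVec d} {finY = finVec n} (λ s → s D.⋆ π c ≡v? 0v) (λ x → x ⋆ c ≡v? 0v)
        (λ s p → ι s , trans (⋆-comm (ι s) c) (trans (⋆-ι c s) (trans (cong ι p) (Hom.𝟎-homo embedding))))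
        (λ _ _ → ι-injective))))
    where
    open ≡-Reasoning
    #n : #v (λ (x : Elem) → x ⋆ c ≡v? 0v) ≡ q ^ (n ∸ deg c)
    #n = annihilator-size (A n) _≡v?_ (ord c) (sym (m+[n∸m]≡n (proj₂ (ord-≤ c))))
    #d : #v (λ (s : Coeffs d) → s D.⋆ π c ≡v? 0v) ≡ q ^ (d ∸ D.deg (π c))
    #d = annihilator-size (A d) _≡v?_ (D.ord (π c)) (sym (m+[n∸m]≡n (proj₂ (D.ord-≤ (π c)))))

  complement⇒ : ∀ {c k} → PeriodicAnnihilator c → DegreeComplement F n′ k c → DegreeComplement F d′ k (π c)
  complement⇒ {c} per eq = codegree⇒ (proj₂ (D.ord-≤ (π c))) (trans (codegree⇐ eq) (codegree c per))

  complement⇐ : ∀ {c k} → PeriodicAnnihilator c → DegreeComplement F d′ k (π c) → DegreeComplement F n′ k c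
  complement⇐ {c} per eq = codegree⇒ (proj₂ (ord-≤ c)) (trans (codegree⇐ eq) (sym (codegree c per)))

  π-split : ∀ (c : Coeffs d) (e : Coeffs (r′ * d)) → π (c ++ e) ≡ c +v Aᵈ.act e δ
  π-split c e = trans (Aᵈ.act-++ c e δ) (cong₂ _+v_ (act-generator c) (cong (Aᵈ.act e) generator-periodic))

  #-π : {Q : Pred (Coeffs d) 0ℓ} (Q? : Decidable Q) →
        #v (Q? ∘ π) ≡ #v Q? * q ^ (r′ * d)
  #-π = #-preimage {finX = finVec d} {finY = finVec (r′ * d)} {finZ = finVec n} π (Vec.drop d) pair
    (λ s e → begin
      π (pair s e)                                            ≡⟨ π-split _ e ⟩
      s +v Aᵈ.neg (Aᵈ.act e δ) +v Aᵈ.act e δ                  ≡⟨ Aᵈ.assoc _ _ _ ⟩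
      s +v (Aᵈ.neg (Aᵈ.act e δ) +v Aᵈ.act e δ)                ≡⟨ cong (s +v_) (Aᵈ.neg-inverseˡ _) ⟩
      s +v 0v                                                 ≡⟨ Aᵈ.identityʳ s ⟩
      s                                                       ∎)
    (λ s e → Vec.++-injectiveʳ (Vec.take d (pair s e)) _ (Vec.take++drop≡id d (pair s e)))
    λ c → let t = Vec.take d c ; e = Vec.drop d c in begin
      (π c +v Aᵈ.neg (Aᵈ.act e δ)) ++ e                       ≡⟨ cong (λ s → (s +v Aᵈ.neg (Aᵈ.act e δ)) ++ e)
                                                                   (trans (cong π (sym (Vec.take++drop≡id d c))) (π-split t e)) ⟩
      (t +v Aᵈ.act e δ +v Aᵈ.neg (Aᵈ.act e δ)) ++ e           ≡⟨ cong (_++ e) (trans (Aᵈ.assoc _ _ _)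
                                                                   (trans (cong (t +v_) (trans (Aᵈ.comm _ _) (Aᵈ.neg-inverseˡ _))) (Aᵈ.identityʳ t))) ⟩
      t ++ e                                                  ≡⟨ Vec.take++drop≡id d c ⟩
      c                                                       ∎
    where
    open ≡-Reasoning
    -- Coordinates along the fibres of `π`: the upper coefficients `e` are free, and the lower ones
    -- are corrected so that the reduction is `s`. Hence all fibres have q^(r′ d) elements.
    pair : Coeffs d → Coeffs (r′ * d) → Elem
    pair s e = (s +v Aᵈ.neg (Aᵈ.act e δ)) ++ e

-- The exceptional elements and their number.

module Deviation {q : ℕ} (F : FieldOn q) (d′ r′ J : ℕ) (1≤J : 1 ≤ J) where
  open FieldOn F
  open OverField F
  open CyclicShift F
  open Comparison F d′ r′
  open CyclicAlgebra F n′
  open ShiftModule (A n)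

  rotateᵈ : Elem → Elem
  rotateᵈ = iter rotate d

  -- The operator 1 + T^d + ... + T^((j - 1)d).
  geometric : ℕ → Elem → Elem
  geometric zero    x = 0v
  geometric (suc j) x = x +v geometric j (rotateᵈ x)

  geometric-act : ∀ (c : Elem) j x → geometric j (c ⋆ x) ≡ c ⋆ geometric j x
  geometric-act c zero    x = sym (act-𝟎 c)
  geometric-act c (suc j) x = begin
    c ⋆ x +v geometric j (rotateᵈ (c ⋆ x))    ≡⟨ cong (λ y → c ⋆ x +v geometric j y) (act-iter c d x) ⟨
    c ⋆ x +v geometric j (c ⋆ rotateᵈ x)      ≡⟨ cong (c ⋆ x +v_) (geometric-act c j (rotateᵈ x)) ⟩
    c ⋆ x +v c ⋆ geometric j (rotateᵈ x)      ≡⟨ act-⊕ʳ c _ _ ⟨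
    c ⋆ (x +v geometric j (rotateᵈ x))        ∎
    where open ≡-Reasoning

  geometric-fixed : ∀ j {x} → rotateᵈ x ≡ x → geometric j x ≡ natural F j *v x
  geometric-fixed zero    {x} fix = sym (•-zero x)
  geometric-fixed (suc j) {x} fix = begin
    x +v geometric j (rotateᵈ x)        ≡⟨ cong (λ y → x +v geometric j y) fix ⟩
    x +v geometric j x                  ≡⟨ cong₂ _+v_ (sym (•-identity x)) (geometric-fixed j fix) ⟩
    𝟙 *v x +v natural F j *v x          ≡⟨ •-distribʳ 𝟙 (natural F j) x ⟨
    natural F (suc j) *v x              ∎
    where open ≡-Reasoning

  difference : Elem → Elem
  difference x = rotateᵈ x +v neg x

  difference-+ : ∀ x → difference x +v x ≡ rotateᵈ x
  difference-+ x = trans (assoc _ _ _) (trans (cong (rotateᵈ x +v_) (neg-inverseˡ x)) (identityʳ _))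

  rotateᵈ-difference : ∀ x → rotateᵈ (difference x) ≡ difference (rotateᵈ x)
  rotateᵈ-difference x = trans (iter-⊕ d _ _) (cong (rotateᵈ (rotateᵈ x) +v_) (iter-• d (⊟ 𝟙) x))

  geometric-telescopes : ∀ j x → geometric j (difference x) +v x ≡ iter rotate (j * d) x
  geometric-telescopes zero    x = identityˡ x
  geometric-telescopes (suc j) x = begin
    difference x +v geometric j (rotateᵈ (difference x)) +v x       ≡⟨ cong (_+v x) (comm _ _) ⟩
    geometric j (rotateᵈ (difference x)) +v difference x +v x       ≡⟨ assoc _ _ _ ⟩
    geometric j (rotateᵈ (difference x)) +v (difference x +v x)     ≡⟨ cong₂ (λ y z → geometric j y +v z)
                                                                         (rotateᵈ-difference x) (difference-+ x) ⟩
    geometric j (difference (rotateᵈ x)) +v rotateᵈ x               ≡⟨ geometric-telescopes j (rotateᵈ x) ⟩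
    iter rotate (j * d) (rotateᵈ x)                                 ≡⟨ iter-+ rotate (j * d) d x ⟨
    iter rotate (j * d + d) x                                       ≡⟨ cong (λ k → iter rotate k x) (+-comm (j * d) d) ⟩
    iter rotate (suc j * d) x                                       ∎
    where open ≡-Reasoning

  geometric-difference : ∀ x → geometric r (difference x) ≡ 0v
  geometric-difference x = cancelˡ x (trans (comm _ _)
    (trans (geometric-telescopes r x) (trans (periodic x) (sym (identityʳ x)))))

  -- 1 + T^d + … + T^(n - d) annihilates the image of T^d - 1 and acts as the
  -- unit r on the fixed points of T^d.
  fixed-multiple-of-difference : natural F r ≢ 𝟘 → ∀ y x → rotateᵈ (y ⋆ difference x) ≡ y ⋆ difference x → y ⋆ difference x ≡ 0v
  fixed-multiple-of-difference r≢0 y x fix = begin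
    e                               ≡⟨ •-identity e ⟨
    𝟙 *v e                          ≡⟨ cong (_*v e) (proj₂ (invertible r≢0)) ⟨
    (r⁻¹ ⊠ natural F r) *v e        ≡⟨ •-assoc r⁻¹ (natural F r) e ⟩
    r⁻¹ *v (natural F r *v e)       ≡⟨ cong (r⁻¹ *v_) (geometric-fixed r fix) ⟨
    r⁻¹ *v geometric r e            ≡⟨ cong (r⁻¹ *v_) (geometric-act y r (difference x)) ⟩
    r⁻¹ *v (y ⋆ geometric r (difference x)) ≡⟨ cong (λ z → r⁻¹ *v (y ⋆ z)) (geometric-difference x) ⟩
    r⁻¹ *v (y ⋆ 0v)                 ≡⟨ cong (r⁻¹ *v_) (act-𝟎 y) ⟩
    r⁻¹ *v 0v                       ≡⟨ •-𝟎 r⁻¹ ⟩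
    0v                              ∎
    where
    open ≡-Reasoning
    e = y ⋆ difference x
    r⁻¹ = proj₁ (invertible r≢0)

  difference-annihilates : ∀ {x c} → x ⋆ c ≡ 0v → difference x ⋆ c ≡ 0v
  difference-annihilates {x} {c} eq = begin
    difference x ⋆ c                       ≡⟨ ⋆-comm (difference x) c ⟩
    c ⋆ difference x                       ≡⟨ act-⊕ʳ c _ _ ⟩
    c ⋆ rotateᵈ x +v c ⋆ neg x             ≡⟨ cong₂ _+v_ (act-iter c d x) (act-•ʳ c (⊟ 𝟙) x) ⟩
    rotateᵈ (c ⋆ x) +v neg (c ⋆ x)         ≡⟨ cong (λ z → rotateᵈ z +v neg z) (trans (⋆-comm c x) eq) ⟩
    rotateᵈ 0v +v neg 0v                   ≡⟨ cong₂ _+v_ (iter-𝟎 d) (•-𝟎 (⊟ 𝟙)) ⟩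
    0v +v 0v                               ≡⟨ identityˡ 0v ⟩
    0v                                     ∎
    where open ≡-Reasoning

  SimpleOfDegree : ℕ → Pred Elem 0ℓ
  SimpleOfDegree m e = Simple e × deg e ≡ m

  abstract
    classes : ∀ m → Representatives (SimpleOfDegree m)
    classes m = representatives λ e → Simple? e ×-dec deg e ℕ.≟ m

  open Representatives

  Killed : List Elem → Pred Elem 0ℓ
  Killed L c = Any (λ e → e ⋆ c ≡ 0v) L

  Killed? : ∀ L → Decidable (Killed L)
  Killed? L c = Any.any? (λ e → e ⋆ c ≡v? 0v) L

  -- Union bound: what a single `e` of degree `m` kills is its annihilator, a fraction q^-m of the
  -- algebra.
  killed-bound : ∀ {m} L → All (λ e → deg e ≡ m) L → #v (Killed? L) * q ^ m ≤ length L * q ^ n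
  killed-bound {m} [] [] = ≤-reflexive (cong (_* q ^ m) (#-∅ {fin = finVec n} (Killed? []) λ { _ () }))
  killed-bound {m} (e ∷ L) (refl ∷ degs) = begin
    #v (Killed? (e ∷ L)) * q ^ m              ≤⟨ *-monoˡ-≤ (q ^ m) (≤-trans
      (#-mono {fin = finVec n} (Killed? (e ∷ L)) (kills? ∪? Killed? L)
        λ { c (here eq) → inj₁ (trans (⋆-comm c e) eq) ; c (there any) → inj₂ any })
      (#-∪ {fin = finVec n} kills? (Killed? L))) ⟩
    (#v kills? + #v (Killed? L)) * q ^ m ≡⟨ *-distribʳ-+ (q ^ m) (#v kills?) _ ⟩
    #v kills? * q ^ m + #v (Killed? L) * q ^ m ≤⟨ +-mono-≤
                                                            (≤-reflexive (annihilator-bound e)) (killed-bound L degs) ⟩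
    q ^ n + length L * q ^ n                             ∎
    where
    open ≤-Reasoning
    kills? : Decidable (λ (c : Elem) → c ⋆ e ≡ 0v)
    kills? c = c ⋆ e ≡v? 0v

  periodOf : ℕ → ℕ
  periodOf m = gcd n (q ^ m ∸ 1)

  periodOf-pos : ∀ m → 1 ≤ periodOf m
  periodOf-pos m = n≢0⇒n>0 λ eq → 1+n≢0 (0∣⇒≡0 (subst (_∣ n) eq (gcd[m,n]∣m n (q ^ m ∸ 1))))

  simple-period : ∀ {e m} → SimpleOfDegree m e → iter rotate (periodOf m) e ≡ e
  simple-period {e} (simple , refl) = iter-gcd rotate {a = n} {b = q ^ deg e ∸ 1} (periodic e) (simple-fixed simple)

  classes-bound : ∀ m → #v (Killed? (reps (classes m))) * q ^ m ≤ q * periodOf m * q ^ n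
  classes-bound m = ≤-trans (killed-bound (reps (classes m)) (All.map proj₂ (reps-P (classes m))))
    (*-monoˡ-≤ (q ^ n) (length-bound (periodOf-pos m) (All.map proj₁ (reps-P (classes m)))
      (inequivalent (classes m)) (All.map simple-period (reps-P (classes m)))))

  simple-deg-pos : ∀ {e} → Simple e → 1 ≤ deg e
  simple-deg-pos {e} (e≢0 , _) with ord e
  ... | record { order = zero ; relation = [] ; relates = rel } = contradiction (sym rel) e≢0
  ... | record { order = suc m } = s≤s z≤n

  degreeAt : ℕ → ℕ
  degreeAt i = 2 * J + i

  Bad : ℕ → Pred Elem 0ℓ
  Bad i = Killed (reps (classes (degreeAt i)))

  Bad? : ∀ i → Decidable (Bad i)
  Bad? i = Killed? (reps (classes (degreeAt i)))

  -- Makes T^d the identity on all simple submodules of degree below 2J, so that only the degrees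
  -- `degreeAt i` can be exceptional.
  SmallPeriods : Set
  SmallPeriods = ∀ m → 1 ≤ m → m < 2 * J → periodOf m ∣ d

  -- If `x` annihilates `c` but is moved by T^d, then all multiples of the nonzero `difference x`
  -- annihilate `c`, among them a simple `e`. In small degree T^d would fix `e`, contradicting
  -- `fixed-multiple-of-difference`. In large degree `e` is equivalent to a representative, which
  -- then kills `c` too.
  good : natural F r ≢ 𝟘 → SmallPeriods → ∀ c → ¬ (∃ λ i → i < n × Bad i c) → PeriodicAnnihilator c
  good r≢0 small c ¬bad x xc≡0 = decidable-stable (rotateᵈ x ≡v? x) λ x-not-fixed →
    let u≢0 = λ u≡0 → x-not-fixed (x⊕neg-y≡𝟎⇒x≡y u≡0)
        y , simple = simple-multiple (difference x) u≢0
    in impossible y simple (<-≤-connex (deg (y ⋆ difference x)) (2 * J))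
    where
    impossible : ∀ y → Simple (y ⋆ difference x) → deg (y ⋆ difference x) < 2 * J ⊎ 2 * J ≤ deg (y ⋆ difference x) → ⊥
    impossible y simple (inj₁ m<2J) = proj₁ simple (fixed-multiple-of-difference r≢0 y x
      (iter-∣ rotate {a = periodOf (deg (y ⋆ difference x))} (simple-period (simple , refl))
        (small _ (simple-deg-pos simple) m<2J)))
    impossible y simple (inj₂ 2J≤m) = ¬bad (i , i<n , kill (covers (classes (degreeAt i)) (simple , sym 2J+i)))
      where
      e = y ⋆ difference x
      i = deg e ∸ 2 * J
      2J+i : degreeAt i ≡ deg e
      2J+i = m+[n∸m]≡n 2J≤m
      i<n : i < n
      -- Positivity of `J` makes `i` strictly smaller than the degree of `e`, so the indices below
      -- `n` cover all degrees.
      i<n = <-≤-trans (∸-monoʳ-< (≤-trans 1≤J (m≤n*m J 2)) 2J≤m) (proj₂ (ord-≤ e))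
      e⋆c : e ⋆ c ≡ 0v
      e⋆c = trans (⋆-assoc y (difference x) c) (trans (cong (y ⋆_) (difference-annihilates xc≡0)) (act-𝟎 y))
      kill-one : ∀ {e′} → Simple e′ → Multiple e′ e → e′ ⋆ c ≡ 0v
      kill-one simple′ mult = let z , ze≡e′ = simple-return simple′ mult (proj₁ simple) in
        trans (cong (_⋆ c) (sym ze≡e′)) (trans (⋆-assoc z e c) (trans (cong (z ⋆_) e⋆c) (act-𝟎 z)))
      kill : Any (λ e′ → Multiple e′ e) (reps (classes (degreeAt i))) → Bad i c
      kill any = go any (reps-P (classes (degreeAt i)))
        where
        go : ∀ {L} → Any (λ e′ → Multiple e′ e) L → All (SimpleOfDegree (degreeAt i)) L → Killed L c
        go (here mult) ((s , _) ∷ _)  = here (kill-one s mult)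
        go (there any) (_ ∷ ss) = there (go any ss)

  -- Outside the union of the `Bad i`, `c` and `π c` have the same codegree. Inside it nothing is
  -- claimed, and its size is charged to both inequalities.
  deviation : natural F r ≢ 𝟘 → SmallPeriods → ∃ λ (b : ℕ → ℕ) →
    (∀ i → b i * q ^ degreeAt i ≤ q * periodOf (degreeAt i) * q ^ n) ×
    (∀ k → normals F n′ k ≤ normals F d′ k * q ^ (r′ * d) + sumTo b n ×
           normals F d′ k * q ^ (r′ * d) ≤ normals F n′ k + sumTo b n)
  deviation r≢0 small = (λ i → #v (Bad? i)) , (λ i → classes-bound (degreeAt i)) , λ k →
    ( (begin
        normals F n′ k                                      ≤⟨ #-mono {fin = finVec n} (normal? k) (πnormal? k ∪? bad?)
          (λ c p → cases c (bad? c) λ ¬bad → complement⇒ {c} {k} (good r≢0 small c ¬bad) p) ⟩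
        #v (πnormal? k ∪? bad?)                  ≤⟨ #-∪ {fin = finVec n} (πnormal? k) bad? ⟩
        #v (πnormal? k) + #v bad?     ≤⟨ +-mono-≤ (≤-reflexive (#-π (DegreeComplement? F d′ k))) #bad ⟩
        normals F d′ k * q ^ (r′ * d) + sumTo _ n           ∎)
    , (begin
        normals F d′ k * q ^ (r′ * d)                       ≡⟨ #-π (DegreeComplement? F d′ k) ⟨
        #v (πnormal? k)                          ≤⟨ #-mono {fin = finVec n} (πnormal? k) (normal? k ∪? bad?)
          (λ c p → cases c (bad? c) λ ¬bad → complement⇐ {c} {k} (good r≢0 small c ¬bad) p) ⟩
        #v (normal? k ∪? bad?)                   ≤⟨ #-∪ {fin = finVec n} (normal? k) bad? ⟩
        normals F n′ k + #v bad?                 ≤⟨ +-monoʳ-≤ (normals F n′ k) #bad ⟩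
        normals F n′ k + sumTo _ n                          ∎) )
    where
    open ≤-Reasoning
    bad? = ⋃? {fin = finVec n} Bad? n
    normal? = DegreeComplement? F n′
    πnormal? : ∀ k → Decidable (DegreeComplement F d′ k ∘ π)
    πnormal? k = DegreeComplement? F d′ k ∘ π
    #bad = #-⋃ {fin = finVec n} Bad? n
    cases : ∀ {S : Set} c → Dec (∃ λ i → i < n × Bad i c) → (¬ (∃ λ i → i < n × Bad i c) → S) →
            S ⊎ ∃ λ i → i < n × Bad i c
    cases c (yes b) _ = inj₂ b
    cases c (no ¬b) p = inj₁ (p ¬b)

-- The normal basis theorem.

module NormalBasis {q : ℕ} (F : FieldOn q) (n : ℕ) where
  open FieldOn F
  open OverField F
  open CyclicShift F
  open CyclicAlgebra F n
  private module A = ShiftModule (A (suc n))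

  module _ (V : ShiftModule) (fin : Fin (q ^ suc n) ↔ ShiftModule.Carrier V)
           (T-periodic : ∀ u → iter (ShiftModule.T V) (suc n) u ≡ u)
           (faithful : (c : Elem) → (∀ x → ShiftModule.act V c x ≡ ShiftModule.𝟎 V) → c ≡ 0v) where
    open ShiftModule V
    open Counting fin using () renaming (_≡?_ to _≟_; ∃? to ∃ⱽ?; # to #ⱽ)

    moved : ∀ {c} → c ≢ 0v → ∃ λ x → act c x ≢ 𝟎
    moved {c} c≢0 = decidable-stable (∃ⱽ? λ x → ¬? (act c x ≟ 𝟎)) λ none →
      c≢0 (faithful c λ x → decidable-stable (act c x ≟ 𝟎) λ cx≢0 → none (x , cx≢0))

    -- If `e` kills the `α` found for the later entries, add `act x β`, with `act e β` nonzero and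
    -- `x` the separator of `e`. This changes the value at `e` and leaves the values at the later
    -- entries alone.
    moved-by-all : ∀ {L} → All Simple L → Inequivalent L → ∃ λ α → All (λ e → act e α ≢ 𝟎) L
    moved-by-all []       []              = 𝟎 , []
    moved-by-all {e ∷ L} (s ∷ ss) (ineq ∷ ineqs) =
      let α , moves = moved-by-all ss ineqs in choose α moves (act e α ≟ 𝟎)
      where
      choose : ∀ α → All (λ e → act e α ≢ 𝟎) L → Dec (act e α ≡ 𝟎) → ∃ λ α → All (λ e → act e α ≢ 𝟎) (e ∷ L)
      choose α moves (no eα≢0)  = α , eα≢0 ∷ moves
      choose α moves (yes eα≡0) =
        let x , xe , xL = separator s ineq
            β , eβ≢0 = moved (proj₁ s)
        in α ⊕ act x β
         , (λ eq → eβ≢0 (begin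
             act e β                         ≡⟨ cong (λ z → act z β) xe ⟨
             act (x ⋆ e) β                   ≡⟨ shift x β e ⟨
             act e (act x β)                 ≡⟨ identityˡ _ ⟨
             𝟎 ⊕ act e (act x β)             ≡⟨ cong (_⊕ act e (act x β)) eα≡0 ⟨
             act e α ⊕ act e (act x β)       ≡⟨ act-⊕ʳ e α _ ⟨
             act e (α ⊕ act x β)             ≡⟨ eq ⟩
             𝟎                               ∎))
         ∷ All.zipWith (λ {e′} (xe′ , e′α≢0) eq → e′α≢0 (begin
             act e′ α                        ≡⟨ identityʳ _ ⟨
             act e′ α ⊕ 𝟎                    ≡⟨ cong (act e′ α ⊕_) (act-0v {suc n} β) ⟨
             act e′ α ⊕ act (0v {suc n}) β   ≡⟨ cong (λ z → act e′ α ⊕ act z β) xe′ ⟨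
             act e′ α ⊕ act (x ⋆ e′) β       ≡⟨ cong (act e′ α ⊕_) (shift x β e′) ⟨
             act e′ α ⊕ act e′ (act x β)     ≡⟨ act-⊕ʳ e′ α _ ⟨
             act e′ (α ⊕ act x β)            ≡⟨ eq ⟩
             𝟎                               ∎)) (xL , moves)
        where
        open ≡-Reasoning
        shift : ∀ x β e → act e (act x β) ≡ act (x ⋆ e) β
        shift x β e = trans (act-comm e x β) (sym (act-⋆ V (T-periodic β) x e))

    private
      all-simple : Representatives Simple
      all-simple = representatives Simple?
      open Representatives all-simple

      generator : ∃ λ α → All (λ e → act e α ≢ 𝟎) reps
      generator = moved-by-all reps-P inequivalent

    α : Carrier
    α = proj₁ generator

    -- A nonzero annihilating `c` would have a simple multiple, equivalent to a representative, and
    -- that representative would kill `α`.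
    annihilator-trivial : (c : Elem) → act c α ≡ 𝟎 → c ≡ 0v
    annihilator-trivial c cα≡0 = decidable-stable (c ≡v? 0v) λ c≢0 →
      let y , simple = simple-multiple c c≢0 in clash y simple (covers simple) reps-P (proj₂ generator)
      where
      clash : ∀ y → Simple (y ⋆ c) → ∀ {L} → Any (λ e → Multiple e (y ⋆ c)) L → All Simple L →
              All (λ e → act e α ≢ 𝟎) L → ⊥
      clash y simple (here {x = e} mult) (s ∷ _) (moves ∷ _) =
        let z , eq = simple-return s mult (proj₁ simple) in moves (begin
          act e α                     ≡⟨ cong (λ w → act w α) eq ⟨
          act (z ⋆ y ⋆ c) α           ≡⟨ act-⋆ V (T-periodic α) z (y ⋆ c) ⟩
          act z (act (y ⋆ c) α)       ≡⟨ cong (act z) (act-⋆ V (T-periodic α) y c) ⟩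
          act z (act y (act c α))     ≡⟨ cong (λ w → act z (act y w)) cα≡0 ⟩
          act z (act y 𝟎)             ≡⟨ cong (act z) (act-𝟎 y) ⟩
          act z 𝟎                     ≡⟨ act-𝟎 z ⟩
          𝟎                           ∎)
        where open ≡-Reasoning
      clash y simple (there any) (_ ∷ ss) (_ ∷ ms) = clash y simple any ss ms

    ψ : Hom (A (suc n)) V
    ψ = orbit-map V α (T-periodic α)
    open Hom ψ

    ψ-injective : ∀ {c d} → ⟦ c ⟧ ≡ ⟦ d ⟧ → c ≡ d
    ψ-injective {c} {d} eq = A.x⊕neg-y≡𝟎⇒x≡y (annihilator-trivial _ (begin
      ⟦ c +v A.neg d ⟧       ≡⟨ ⊕-homo c (A.neg d) ⟩
      ⟦ c ⟧ ⊕ ⟦ A.neg d ⟧    ≡⟨ cong₂ _⊕_ eq (•-homo (⊟ 𝟙) d) ⟩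
      ⟦ d ⟧ ⊕ neg ⟦ d ⟧      ≡⟨ trans (comm _ _) (neg-inverseˡ _) ⟩
      𝟎                      ∎))
      where open ≡-Reasoning

    -- Injectivity of `ψ` carries independence over, so orders in `V` are degrees in the cyclic
    -- algebra.
    order-ψ : ∀ c → Order ⟦ c ⟧
    order-ψ c = record
      { order = deg c
      ; relation = relation
      ; relates = trans (sym (act-homo relation c)) (trans (cong ⟦_⟧ relates) (iter-homo (deg c) c))
      ; independent = λ e eq → independent e
          (ψ-injective (trans (act-homo e c) (trans eq (sym 𝟎-homo))))
      }
      where open A.Order (ord c)

    ψ-onto : ∀ v → ∃ λ c → ⟦ c ⟧ ≡ v
    ψ-onto v =
      let c , eq = injective⇒surjective (to vec ∘ from fin ∘ ⟦_⟧)
            (λ eq → ψ-injective (from-inj (to-inj eq))) (to vec (from fin v))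
      in c , from-inj (to-inj eq)
      where
      open Inverse
      vec = finVec {q} (suc n)
      to-inj : ∀ {i j} → to vec i ≡ to vec j → i ≡ j
      to-inj {i} {j} eq = trans (sym (strictlyInverseʳ vec i))
        (trans (cong (from vec) eq) (strictlyInverseʳ vec j))
      from-inj : ∀ {u v} → from fin u ≡ from fin v → u ≡ v
      from-inj {u} {v} eq = trans (sym (strictlyInverseˡ fin u)) (trans (cong (to fin) eq) (strictlyInverseˡ fin v))

    #-normals : ∀ k {ℓ} {P : Pred Carrier ℓ} (P? : Decidable P) →
                (∀ {v} (o : Order v) → P v → order o + k ≡ suc n) →
                (∀ {v} (o : Order v) → order o + k ≡ suc n → P v) → #ⱽ P? ≡ normals F n k
    #-normals k {P = P} P? P⇒ P⇐ = ≤-antisym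
      (#-≤ {finX = fin} {finY = finVec (suc n)} P? (DegreeComplement? F n k)
        (λ v p → let c , eq = ψ-onto v in c , P⇒ (order-ψ c) (subst P (sym eq) p))
        λ {v} {w} _ _ eq → trans (sym (proj₂ (ψ-onto v))) (trans (cong ⟦_⟧ eq) (proj₂ (ψ-onto w))))
      (#-≤ {finX = finVec (suc n)} {finY = fin} (DegreeComplement? F n k) P?
        (λ c p → ⟦ c ⟧ , P⇐ (order-ψ c) p) (λ _ _ → ψ-injective))

-- Frobenius, Fermat's theorem and roots of polynomials in a finite field.

prime∤! : ∀ {p} → Prime p → ∀ {k} → k < p → ¬ p ∣ k !
prime∤! {p} pr {zero}  _   p∣1 = contradiction (∣1⇒≡1 p∣1) (nonTrivial⇒≢1 {{prime⇒nonTrivial pr}})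
prime∤! {p} pr {suc k} k<p p∣  with euclidsLemma (suc k) (k !) pr p∣
... | inj₁ p∣1+k = >⇒∤ k<p p∣1+k
... | inj₂ p∣k!  = prime∤! pr (<-trans (n<1+n k) k<p) p∣k!

prime∣C : ∀ {p} → Prime p → ∀ {k} → 1 ≤ k → k < p → p ∣ p C k
prime∣C {p} pr {k} 1≤k k<p with euclidsLemma (p C k) (k ! * (p ∸ k) !) pr
  (subst (p ∣_) (sym eq) (n∣n! {p} (<-trans 1≤k k<p)))
  where
  instance
    _ : NonZero (k ! * (p ∸ k) !)
    _ = m*n≢0 (k !) ((p ∸ k) !) {{k !≢0}} {{(p ∸ k) !≢0}}
  eq : (p C k) * (k ! * (p ∸ k) !) ≡ p !
  eq = trans (cong (_* (k ! * (p ∸ k) !)) (nCk≡n!/k![n-k]! {p} {k} (<⇒≤ k<p))) (m/n*n≡m {p !} {k ! * (p ∸ k) !} (k![n∸k]!∣n! (<⇒≤ k<p)))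
  n∣n! : ∀ {n} → 0 < n → n ∣ n !
  n∣n! {suc n} _ = m∣m*n (n !)
... | inj₁ p∣C = p∣C
... | inj₂ p∣kk with euclidsLemma (k !) ((p ∸ k) !) pr p∣kk
...   | inj₁ p∣k! = contradiction p∣k! (prime∤! pr k<p)
...   | inj₂ p∣l! = contradiction p∣l! (prime∤! pr (∸-monoʳ-< 1≤k (<⇒≤ k<p)))

module FieldProperties {N : ℕ} (K : FieldOn N) where
  open FieldOn K
  open Exp R.commutativeSemiring public using (^-assocʳ; ^-distrib-*) renaming (_^_ to _↑_)
  open Mult R.semiring using (×1-homo-*; ×-assoc-*) renaming (_×_ to infixr 8 _·_)
  open Sum R.semiring using (sum; sum-init-last; sum-cong-≋; sum-replicate-zero)
  open Binomial R.commutativeSemiring using (theorem)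

  ⊠-cancelˡ : ∀ {a} → a ≢ 𝟘 → ∀ {x y} → a ⊠ x ≡ a ⊠ y → x ≡ y
  ⊠-cancelˡ {a} a≢0 {x} {y} eq = trans (sym (lemma x)) (trans (cong (a⁻¹ ⊠_) eq) (lemma y))
    where
    a⁻¹ = proj₁ (invertible a≢0)
    lemma : ∀ z → a⁻¹ ⊠ (a ⊠ z) ≡ z
    lemma z = trans (sym (R.*-assoc a⁻¹ a z)) (trans (cong (_⊠ z) (proj₂ (invertible a≢0))) (R.*-identityˡ z))

  ⊠-cancelʳ : ∀ {a} → a ≢ 𝟘 → ∀ {x y} → x ⊠ a ≡ y ⊠ a → x ≡ y
  ⊠-cancelʳ {a} a≢0 eq = ⊠-cancelˡ a≢0 (trans (R.*-comm a _) (trans eq (R.*-comm _ a)))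

  integral : ∀ {a b} → a ⊠ b ≡ 𝟘 → a ≢ 𝟘 → b ≡ 𝟘
  integral {a} ab≡0 a≢0 = ⊠-cancelˡ a≢0 (trans ab≡0 (sym (R.zeroʳ a)))

  natural≡× : ∀ j → natural K j ≡ j · 𝟙
  natural≡× zero    = refl
  natural≡× (suc j) = cong (𝟙 ⊞_) (natural≡× j)

  iter-1+ : ∀ i x → iter (𝟙 ⊞_) i x ≡ natural K i ⊞ x
  iter-1+ zero    x = sym (R.+-identityˡ x)
  iter-1+ (suc i) x = trans (cong (𝟙 ⊞_) (iter-1+ i x)) (sym (R.+-assoc 𝟙 _ x))

  -- Under adding 1 all points have the same stabiliser, by cancellation, so the orbit count applies
  -- to the whole field.
  natural-size : natural K N ≡ 𝟘
  natural-size = subst (λ k → natural K k ≡ 𝟘) (Counting.#-⊤ (↔-id (Fin N)) U? _)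
    (iter-# (↔-id (Fin N)) (𝟙 ⊞_) (RP.+-cancelˡ 𝟙 _ _) U? _ 𝟘
      (λ {x} i _ eq → RP.+-identityˡ-unique (natural K i) x (trans (sym (iter-1+ i x)) eq))
      (λ {x} i _ eq → trans (iter-1+ i x) (trans (cong (_⊞ x) eq) (R.+-identityˡ x))))

  -- If the multiples `j` and `N` of 1 both vanish, so does their gcd multiple, which here is 1
  -- itself.
  natural-coprime : ∀ {j} → Coprime j N → natural K j ≢ 𝟘
  natural-coprime {j} cop eq = 𝟙≢𝟘 (trans (sym (R.+-identityʳ 𝟙))
    (subst (λ k → natural K k ≡ 𝟘) (coprime⇒gcd≡1 cop) (iter-gcd (𝟙 ⊞_) {a = j} {b = N} eq natural-size)))

  natural-* : ∀ i j → natural K (i * j) ≡ natural K i ⊠ natural K j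
  natural-* i j = trans (natural≡× (i * j)) (trans (×1-homo-* i j) (sym (cong₂ _⊠_ (natural≡× i) (natural≡× j))))

  -- The vanishing multiple `N` of 1 is a power of the multiple `p` of 1, and a field has no zero
  -- divisors.
  natural-prime : ∀ {p} e → N ≡ p ^ e → natural K p ≡ 𝟘
  natural-prime {p} e refl = decidable-stable (natural K p Fin.≟ 𝟘) λ p≢0 → power p≢0 e natural-size
    where
    power : natural K p ≢ 𝟘 → ∀ e → natural K (p ^ e) ≢ 𝟘
    power p≢0 zero    eq = 𝟙≢𝟘 (trans (sym (R.+-identityʳ 𝟙)) eq)
    power p≢0 (suc e) eq = power p≢0 e (integral (trans (sym (natural-* p (p ^ e))) eq) p≢0)

  multiple-zero : ∀ {p j} → natural K p ≡ 𝟘 → p ∣ j → ∀ x → j · x ≡ 𝟘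
  multiple-zero {p} {j} char (divides k eq) x = begin
    j · x                            ≡⟨ cong (j ·_) (R.*-identityˡ x) ⟨
    j · (𝟙 ⊠ x)                      ≡⟨ ×-assoc-* j 𝟙 x ⟨
    (j · 𝟙) ⊠ x                      ≡⟨ cong (_⊠ x) (natural≡× j) ⟨
    natural K j ⊠ x                  ≡⟨ cong (λ i → natural K i ⊠ x) eq ⟩
    natural K (k * p) ⊠ x            ≡⟨ cong (_⊠ x) (natural-* k p) ⟩
    natural K k ⊠ natural K p ⊠ x    ≡⟨ cong (λ y → natural K k ⊠ y ⊠ x) char ⟩
    natural K k ⊠ 𝟘 ⊠ x              ≡⟨ cong (_⊠ x) (R.zeroʳ _) ⟩
    𝟘 ⊠ x                            ≡⟨ R.zeroˡ x ⟩
    𝟘                                ∎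
    where open ≡-Reasoning

  frobenius-prime : ∀ {p} → Prime p → natural K p ≡ 𝟘 → ∀ x y → (x ⊞ y) ↑ p ≡ x ↑ p ⊞ y ↑ p
  frobenius-prime {zero}  pr char x y = contradiction refl (≢-nonZero⁻¹ 0 {{prime⇒nonZero pr}})
  frobenius-prime {suc p} pr char x y = begin
    (x ⊞ y) ↑ suc p                                       ≡⟨ theorem (suc p) x y ⟩
    term zero ⊞ sum (term ∘ suc)                          ≡⟨ cong (term zero ⊞_) (sum-init-last (term ∘ suc)) ⟩
    term zero ⊞ (sum (term ∘ suc ∘ Fin.inject₁) ⊞ term (Fin.fromℕ (suc p)))
      ≡⟨ cong₂ _⊞_ first (cong₂ _⊞_ (trans (sum-cong-≋ middle) (sum-replicate-zero p)) last-term) ⟩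
    y ↑ suc p ⊞ (𝟘 ⊞ x ↑ suc p)                           ≡⟨ cong (y ↑ suc p ⊞_) (R.+-identityˡ _) ⟩
    y ↑ suc p ⊞ x ↑ suc p                                 ≡⟨ R.+-comm _ _ ⟩
    x ↑ suc p ⊞ y ↑ suc p                                 ∎
    where
    open ≡-Reasoning
    term : Fin (suc (suc p)) → Fin N
    term k = (suc p C toℕ k) · (x ↑ toℕ k ⊠ y ↑ (suc p ∸ toℕ k))
    first : term zero ≡ y ↑ suc p
    first = trans (R.+-identityʳ _) (R.*-identityˡ _)
    middle : ∀ i → term (suc (Fin.inject₁ i)) ≡ 𝟘
    middle i = multiple-zero char (prime∣C pr (s≤s z≤n)
      (s≤s (subst (_< p) (sym (Fin.toℕ-inject₁ i)) (Fin.toℕ<n i)))) _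
    last-term : term (Fin.fromℕ (suc p)) ≡ x ↑ suc p
    last-term = trans (cong (λ k → (suc p C k) · (x ↑ k ⊠ y ↑ (suc p ∸ k))) (Fin.toℕ-fromℕ (suc p)))
      (trans (cong₂ (λ a b → a · (x ↑ suc p ⊠ y ↑ b)) (nCn≡1 (suc p)) (n∸n≡0 p))
        (trans (R.+-identityʳ _) (R.*-identityʳ _)))

  frobenius : ∀ {p} → Prime p → natural K p ≡ 𝟘 → ∀ e x y → (x ⊞ y) ↑ (p ^ e) ≡ x ↑ (p ^ e) ⊞ y ↑ (p ^ e)
  frobenius {p} pr char zero    x y = trans (R.*-identityʳ _) (sym (cong₂ _⊞_ (R.*-identityʳ x) (R.*-identityʳ y)))
  frobenius {p} pr char (suc e) x y = begin
    (x ⊞ y) ↑ (p * p ^ e)                        ≡⟨ ^-assocʳ (x ⊞ y) p (p ^ e) ⟨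
    ((x ⊞ y) ↑ p) ↑ (p ^ e)                      ≡⟨ cong (_↑ (p ^ e)) (frobenius-prime pr char x y) ⟩
    (x ↑ p ⊞ y ↑ p) ↑ (p ^ e)                    ≡⟨ frobenius pr char e (x ↑ p) (y ↑ p) ⟩
    (x ↑ p) ↑ (p ^ e) ⊞ (y ↑ p) ↑ (p ^ e)        ≡⟨ cong₂ _⊞_ (^-assocʳ x p (p ^ e)) (^-assocʳ y p (p ^ e)) ⟩
    x ↑ (p * p ^ e) ⊞ y ↑ (p * p ^ e)            ∎
    where open ≡-Reasoning

  iter-⊠ : ∀ a i x → iter (a ⊠_) i x ≡ a ↑ i ⊠ x
  iter-⊠ a zero    x = sym (R.*-identityˡ x)
  iter-⊠ a (suc i) x = trans (cong (a ⊠_) (iter-⊠ a i x)) (sym (R.*-assoc a (a ↑ i) x))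

  -- Multiplication by a nonzero `a` permutes the `N - 1` nonzero elements with equal orbit lengths,
  -- so `a ↑ (N - 1)` is 1. The additional factor `a` covers `a` zero.
  ↑-size : ∀ a → a ↑ N ≡ a
  ↑-size a = subst (λ k → a ↑ k ≡ a) N≡ (cases (a Fin.≟ 𝟘))
    where
    open ≡-Reasoning
    open Counting (↔-id (Fin N)) using (#; #-split; #-⊤)
    nonzero? : Decidable (∁ (_≡ 𝟘))
    nonzero? = ∁? (Fin._≟ 𝟘)
    #zero : # (U? ∩? (Fin._≟ 𝟘)) ≡ 1
    #zero = #-singleton {fin = ↔-id (Fin N)} (U? ∩? (Fin._≟ 𝟘)) (tt , refl) proj₂
    N≡ : suc (# (U? ∩? nonzero?)) ≡ N
    N≡ = trans (cong (_+ # (U? ∩? nonzero?)) (sym #zero)) (trans (sym (#-split U? (Fin._≟ 𝟘))) (#-⊤ U? _))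
    cases : Dec (a ≡ 𝟘) → a ↑ suc (# (U? ∩? nonzero?)) ≡ a
    cases (yes refl) = R.zeroˡ _
    cases (no a≢0) = trans (cong (a ⊠_) (trans (sym (R.*-identityʳ _)) (trans (sym (iter-⊠ a (# (U? ∩? nonzero?)) 𝟙)) fixed))) (R.*-identityʳ a)
      where
      fixed : iter (a ⊠_) (# (U? ∩? nonzero?)) 𝟙 ≡ 𝟙
      fixed = iter-# (↔-id (Fin N)) (a ⊠_) (⊠-cancelˡ a≢0) (U? ∩? nonzero?)
        (λ (_ , x≢0) → tt , λ ax≡0 → x≢0 (integral ax≡0 a≢0)) 𝟙
        (λ { {x} i (_ , x≢0) eq → ⊠-cancelʳ x≢0 (begin
          iter (a ⊠_) i 𝟙 ⊠ x        ≡⟨ cong (_⊠ x) (trans (iter-⊠ a i 𝟙) (R.*-identityʳ (a ↑ i))) ⟩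
          a ↑ i ⊠ x                  ≡⟨ iter-⊠ a i x ⟨
          iter (a ⊠_) i x            ≡⟨ eq ⟩
          x                          ≡⟨ R.*-identityˡ x ⟨
          𝟙 ⊠ x                      ∎) })
        (λ { {x} i _ eq → begin
          iter (a ⊠_) i x            ≡⟨ iter-⊠ a i x ⟩
          a ↑ i ⊠ x                  ≡⟨ cong (_⊠ x) (R.*-identityʳ (a ↑ i)) ⟨
          a ↑ i ⊠ 𝟙 ⊠ x              ≡⟨ cong (_⊠ x) (trans (sym (iter-⊠ a i 𝟙)) eq) ⟩
          𝟙 ⊠ x                      ≡⟨ R.*-identityˡ x ⟩
          x                          ∎ })

module Polynomials {N : ℕ} (K : FieldOn N) where
  open FieldOn K
  open FieldProperties K
  open Solver R.commutativeSemiring using (solve; _:=_; _:+_; _:*_)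

  -- Lead s a f: f is a polynomial function a xˢ + (lower terms), where a may be 0.
  Lead : ℕ → Fin N → (Fin N → Fin N) → Set
  Lead zero    a f = ∀ x → f x ≡ a
  Lead (suc s) a f = ∃₂ λ b g → Lead s a g × ∀ x → f x ≡ b ⊞ x ⊠ g x

  DegreeBelow : ℕ → (Fin N → Fin N) → Set
  DegreeBelow zero    f = ∀ x → f x ≡ 𝟘
  DegreeBelow (suc s) f = ∃₂ λ b g → DegreeBelow s g × ∀ x → f x ≡ b ⊞ x ⊠ g x

  -- f x = f r + (x - r) h x, without subtraction
  divide : ∀ s {a f} → Lead (suc s) a f → ∀ r →
           ∃ λ h → Lead s a h × ∀ x → f x ⊞ r ⊠ h x ≡ f r ⊞ x ⊠ h x
  divide zero {a} {f} (b , g , g≡a , f≡) r = (λ _ → a) , (λ _ → refl) , λ x → begin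
    f x ⊞ r ⊠ a            ≡⟨ cong (_⊞ r ⊠ a) (trans (f≡ x) (cong (λ z → b ⊞ x ⊠ z) (g≡a x))) ⟩
    b ⊞ x ⊠ a ⊞ r ⊠ a      ≡⟨ solve 3 (λ b u v → (b :+ u) :+ v := (b :+ v) :+ u) refl b (x ⊠ a) (r ⊠ a) ⟩
    b ⊞ r ⊠ a ⊞ x ⊠ a      ≡⟨ cong (_⊞ x ⊠ a) (trans (f≡ r) (cong (λ z → b ⊞ r ⊠ z) (g≡a r))) ⟨
    f r ⊞ x ⊠ a            ∎
    where open ≡-Reasoning
  divide (suc s) {a} {f} (b , g , lead , f≡) r =
    let h , lead-h , g≡ = divide s lead r in
    (λ x → g r ⊞ x ⊠ h x) , (g r , h , lead-h , λ _ → refl) , λ x → begin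
    f x ⊞ r ⊠ (g r ⊞ x ⊠ h x)                ≡⟨ cong (_⊞ r ⊠ (g r ⊞ x ⊠ h x)) (f≡ x) ⟩
    b ⊞ x ⊠ g x ⊞ r ⊠ (g r ⊞ x ⊠ h x)        ≡⟨ solve 6 (λ b x r u v w →
                                                  (b :+ x :* v) :+ r :* (u :+ x :* w) :=
                                                  (b :+ r :* u) :+ x :* (v :+ r :* w)) refl b x r (g r) (g x) (h x) ⟩
    b ⊞ r ⊠ g r ⊞ x ⊠ (g x ⊞ r ⊠ h x)        ≡⟨ cong₂ (λ y z → y ⊞ x ⊠ z) (sym (f≡ r)) (g≡ x) ⟩
    f r ⊞ x ⊠ (g r ⊞ x ⊠ h x)                ∎
    where open ≡-Reasoning

  -- Dividing by the linear factor of one root keeps the leading coefficient and the other roots;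
  -- the last root is a root of the constant `a`.
  too-many-roots : ∀ s {a f} → Lead s a f → (r : Fin (suc s) → Fin N) → (∀ {i j} → r i ≡ r j → i ≡ j) →
                   (∀ i → f (r i) ≡ 𝟘) → a ≡ 𝟘
  too-many-roots zero    lead r r-inj roots = trans (sym (lead (r zero))) (roots zero)
  too-many-roots (suc s) {f = f} lead r r-inj roots =
    let h , lead-h , f≡ = divide s lead (r zero) in
    too-many-roots s lead-h (r ∘ suc) (λ eq → Fin.suc-injective (r-inj eq)) λ i →
      decidable-stable (h (r (suc i)) Fin.≟ 𝟘) λ h≢0 →
        Fin.0≢1+n (r-inj (⊠-cancelʳ h≢0 (begin
          r zero ⊠ h (r (suc i))                       ≡⟨ R.+-identityˡ _ ⟨
          𝟘 ⊞ r zero ⊠ h (r (suc i))                   ≡⟨ cong (_⊞ r zero ⊠ h (r (suc i))) (roots (suc i)) ⟨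
          f (r (suc i)) ⊞ r zero ⊠ h (r (suc i))       ≡⟨ f≡ (r (suc i)) ⟩
          f (r zero) ⊞ r (suc i) ⊠ h (r (suc i))       ≡⟨ cong (_⊞ r (suc i) ⊠ h (r (suc i))) (roots zero) ⟩
          𝟘 ⊞ r (suc i) ⊠ h (r (suc i))                ≡⟨ R.+-identityˡ _ ⟩
          r (suc i) ⊠ h (r (suc i))                    ∎)))
    where open ≡-Reasoning

  zero-below : ∀ s {f} → (∀ x → f x ≡ 𝟘) → DegreeBelow s f
  zero-below zero    f≡0 = f≡0
  zero-below (suc s) f≡0 = 𝟘 , (λ _ → 𝟘) , zero-below s (λ _ → refl) ,
    λ x → trans (f≡0 x) (sym (trans (R.+-identityˡ _) (R.zeroʳ x)))

  below-weaken : ∀ {s t f} → s ≤ t → DegreeBelow s f → DegreeBelow t f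
  below-weaken {t = t} z≤n f≡0 = zero-below t f≡0
  below-weaken (s≤s s≤t) (b , g , below , f≡) = b , g , below-weaken s≤t below , f≡

  private
    add : ∀ b c x u v → (b ⊞ x ⊠ u) ⊞ (c ⊞ x ⊠ v) ≡ (b ⊞ c) ⊞ x ⊠ (u ⊞ v)
    add = solve 5 (λ b c x u v → (b :+ x :* u) :+ (c :+ x :* v) := (b :+ c) :+ x :* (u :+ v)) refl

  below-+ : ∀ s {f g} → DegreeBelow s f → DegreeBelow s g → DegreeBelow s (λ x → f x ⊞ g x)
  below-+ zero    f≡0 g≡0 x = trans (cong₂ _⊞_ (f≡0 x) (g≡0 x)) (R.+-identityˡ 𝟘)
  below-+ (suc s) (b , f′ , below-f , f≡) (c , g′ , below-g , g≡) =
    b ⊞ c , (λ x → f′ x ⊞ g′ x) , below-+ s below-f below-g ,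
    λ x → trans (cong₂ _⊞_ (f≡ x) (g≡ x)) (add b c x (f′ x) (g′ x))

  lead-+ : ∀ s {a f g} → DegreeBelow s f → Lead s a g → Lead s a (λ x → f x ⊞ g x)
  lead-+ zero    f≡0 g≡a x = trans (cong₂ _⊞_ (f≡0 x) (g≡a x)) (R.+-identityˡ _)
  lead-+ (suc s) (b , f′ , below-f , f≡) (c , g′ , lead-g , g≡) =
    b ⊞ c , (λ x → f′ x ⊞ g′ x) , lead-+ s below-f lead-g ,
    λ x → trans (cong₂ _⊞_ (f≡ x) (g≡ x)) (add b c x (f′ x) (g′ x))

  private
    step : ∀ a s x → a ⊠ x ↑ suc s ≡ 𝟘 ⊞ x ⊠ (a ⊠ x ↑ s)
    step a s x = begin
      a ⊠ (x ⊠ x ↑ s)          ≡⟨ R.*-assoc a x _ ⟨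
      a ⊠ x ⊠ x ↑ s            ≡⟨ cong (_⊠ x ↑ s) (R.*-comm a x) ⟩
      x ⊠ a ⊠ x ↑ s            ≡⟨ R.*-assoc x a _ ⟩
      x ⊠ (a ⊠ x ↑ s)          ≡⟨ R.+-identityˡ _ ⟨
      𝟘 ⊞ x ⊠ (a ⊠ x ↑ s)      ∎
      where open ≡-Reasoning

  lead-monomial : ∀ a s → Lead s a (λ x → a ⊠ x ↑ s)
  lead-monomial a zero    x = R.*-identityʳ a
  lead-monomial a (suc s) = 𝟘 , (λ x → a ⊠ x ↑ s) , lead-monomial a s , step a s

  below-monomial : ∀ a i {s} → i < s → DegreeBelow s (λ x → a ⊠ x ↑ i)
  below-monomial a zero    {suc s} _ = a , (λ _ → 𝟘) , zero-below s (λ _ → refl) ,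
    λ x → trans (R.*-identityʳ a) (sym (trans (cong (a ⊞_) (R.zeroʳ x)) (R.+-identityʳ a)))
  below-monomial a (suc i) {suc s} (s≤s i<s) = 𝟘 , (λ x → a ⊠ x ↑ i) , below-monomial a i i<s , step a i

-- The extension field as a module under Frobenius.

module FieldExtension {q : ℕ} (F : FieldOn q) (n : ℕ) (K : FieldOn (q ^ suc n)) {p e : ℕ} (p-prime : Prime p)
  (q≡p^e : q ≡ p ^ e) (ε : Fin q → Fin (q ^ suc n))
  (ε-+ : ∀ a b → ε (FieldOn._⊞_ F a b) ≡ FieldOn._⊞_ K (ε a) (ε b))
  (ε-* : ∀ a b → ε (FieldOn._⊠_ F a b) ≡ FieldOn._⊠_ K (ε a) (ε b))
  (ε-0 : ε (FieldOn.𝟘 F) ≡ FieldOn.𝟘 K) (ε-1 : ε (FieldOn.𝟙 F) ≡ FieldOn.𝟙 K) where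

  private
    module F = FieldOn F
  open FieldOn K
  open FieldProperties K
  open FieldProperties F using () renaming (_↑_ to _↑ᶠ_; ↑-size to ↑ᶠ-size)
  open Polynomials K
  open OverField F using (ShiftModule; Coeffs; 0v; 0v-∷ʳ)

  ε-injective₀ : ∀ {a} → ε a ≡ 𝟘 → a ≡ F.𝟘
  ε-injective₀ {a} eq = decidable-stable (a Fin.≟ F.𝟘) λ a≢0 → let b , ba≡1 = F.invertible a≢0 in
    𝟙≢𝟘 (begin
      𝟙                ≡⟨ ε-1 ⟨
      ε F.𝟙            ≡⟨ cong ε ba≡1 ⟨
      ε (b F.⊠ a)      ≡⟨ ε-* b a ⟩
      ε b ⊠ ε a        ≡⟨ cong (ε b ⊠_) eq ⟩
      ε b ⊠ 𝟘          ≡⟨ R.zeroʳ _ ⟩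
      𝟘                ∎)
    where open ≡-Reasoning

  ε-↑ : ∀ a i → ε (a ↑ᶠ i) ≡ ε a ↑ i
  ε-↑ a zero    = ε-1
  ε-↑ a (suc i) = trans (ε-* a _) (cong (ε a ⊠_) (ε-↑ a i))

  characteristic : natural K p ≡ 𝟘
  characteristic = natural-prime (e * suc n) (trans (cong (_^ suc n) q≡p^e) (^-*-assoc p e (suc n)))

  V : ShiftModule
  V = record
    { Carrier = Fin (q ^ suc n)
    ; _⊕_ = _⊞_
    ; 𝟎 = 𝟘
    ; _•_ = λ a x → ε a ⊠ x
    ; T = _↑ q
    ; isCommutativeMonoid = R.+-isCommutativeMonoid
    ; •-distribˡ = λ a → R.distribˡ (ε a)
    ; •-distribʳ = λ a b x → trans (cong (_⊠ x) (ε-+ a b)) (R.distribʳ x (ε a) (ε b))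
    ; •-assoc = λ a b x → trans (cong (_⊠ x) (ε-* a b)) (R.*-assoc (ε a) (ε b) x)
    ; •-identity = λ x → trans (cong (_⊠ x) ε-1) (R.*-identityˡ x)
    ; •-zero = λ x → trans (cong (_⊠ x) ε-0) (R.zeroˡ x)
    ; T-⊕ = λ x y → subst (λ k → (x ⊞ y) ↑ k ≡ x ↑ k ⊞ y ↑ k) (sym q≡p^e) (frobenius p-prime characteristic e x y)
    ; T-• = λ a x → trans (^-distrib-* (ε a) x q)
        (cong (_⊠ x ↑ q) (trans (sym (ε-↑ a q)) (cong ε (↑ᶠ-size a))))
    }

  open ShiftModule V

  iter-T : ∀ i x → iter T i x ≡ x ↑ (q ^ i)
  iter-T zero    x = sym (R.*-identityʳ x)
  iter-T (suc i) x = begin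
    iter T i x ↑ q           ≡⟨ cong (_↑ q) (iter-T i x) ⟩
    (x ↑ (q ^ i)) ↑ q        ≡⟨ ^-assocʳ x (q ^ i) q ⟩
    x ↑ (q ^ i * q)          ≡⟨ cong (x ↑_) (*-comm (q ^ i) q) ⟩
    x ↑ (q * q ^ i)          ∎
    where open ≡-Reasoning

  T-periodic : ∀ x → iter T (suc n) x ≡ x
  T-periodic x = trans (iter-T (suc n) x) (↑-size x)

  below-cong : ∀ s {f g} → (∀ x → g x ≡ f x) → DegreeBelow s f → DegreeBelow s g
  below-cong zero    eq f≡0 x = trans (eq x) (f≡0 x)
  below-cong (suc s) eq (b , h , below , f≡) = b , h , below , λ x → trans (eq x) (f≡ x)

  lead-cong : ∀ s {a f g} → (∀ x → g x ≡ f x) → Lead s a f → Lead s a g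
  lead-cong zero    eq f≡a x = trans (eq x) (f≡a x)
  lead-cong (suc s) eq (b , h , lead , f≡) = b , h , lead , λ x → trans (eq x) (f≡ x)

  act-snoc : ∀ {m} (c : Coeffs m) a x → act (c ∷ʳ a) x ≡ act c x ⊞ ε a ⊠ x ↑ (q ^ m)
  act-snoc {m} c a x = trans (act-∷ʳ c a x) (cong (λ y → act c x ⊞ ε a ⊠ y) (iter-T m x))

  act-below : ∀ {m} (c : Coeffs m) → DegreeBelow (q ^ m) (act c)
  act-below {zero}  [] = zero-below 1 λ _ → refl
  act-below {suc m} c with Vec.initLast c
  ... | d , a , refl = below-cong (q ^ suc m) (act-snoc d a) (below-+ (q ^ suc m)
    (below-weaken (<⇒≤ q^m<) (act-below d)) (below-monomial (ε a) (q ^ m) q^m<))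
    where q^m< = ^-monoʳ-< q F.1<N (n<1+n m)

  -- The operator of `c` is a linearised polynomial, with powers of `q` as exponents. The exponent
  -- q^m of its top term is less than the number q^(n + 1) of elements on which it vanishes, so the
  -- top coefficient is 0; the remaining ones follow by induction.
  faithful : ∀ {m} (c : Coeffs m) → m ≤ suc n → (∀ x → act c x ≡ 𝟘) → c ≡ 0v
  faithful {zero}  [] _ _ = refl
  faithful {suc m} c m<1+n zero-on with Vec.initLast c
  ... | d , a , refl = trans (cong₂ _∷ʳ_ d≡0 a≡0) 0v-∷ʳ
    where
    q^m< = ^-monoʳ-< q F.1<N m<1+n
    a≡0 : a ≡ F.𝟘
    a≡0 = ε-injective₀ (too-many-roots (q ^ m)
      (lead-cong (q ^ m) (act-snoc d a) (lead-+ (q ^ m) (act-below d) (lead-monomial (ε a) (q ^ m))))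
      (λ i → Fin.inject≤ i q^m<) (Fin.inject≤-injective q^m< q^m< _ _) (λ _ → zero-on _))
    d≡0 : d ≡ 0v
    d≡0 = faithful d (<⇒≤ m<1+n) λ x → begin
      act d x                            ≡⟨ identityʳ _ ⟨
      act d x ⊞ 𝟘                        ≡⟨ cong (act d x ⊞_) (R.zeroˡ _) ⟨
      act d x ⊞ 𝟘 ⊠ x ↑ (q ^ m)          ≡⟨ cong (λ z → act d x ⊞ z ⊠ x ↑ (q ^ m)) (trans (cong ε a≡0) ε-0) ⟨
      act d x ⊞ ε a ⊠ x ↑ (q ^ m)        ≡⟨ act-snoc d a x ⟨
      act (d ∷ʳ a) x                     ≡⟨ zero-on x ⟩
      𝟘                                  ∎
      where open ≡-Reasoning

-- Transfer from finite fields with a setoid equality.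

module Strictification {N : ℕ} {c ℓ₁ ℓ₂} (K : FiniteField N c ℓ₁ ℓ₂) (1<N : 1 < N) where
  private
    module E = FiniteField K
    module index = Inverse E.enumeration
  open E using (Carrier; _≈_; 0#; 1#; element; index)
    renaming (_+_ to _+ᴷ_; _*_ to _*ᴷ_; -_ to -ᴷ_; refl to ≈-refl; sym to ≈-sym; trans to ≈-trans)

  element-index : ∀ x → element (index x) ≈ x
  element-index = index.strictlyInverseˡ

  index-element : ∀ i → index (element i) ≡ i
  index-element = index.strictlyInverseʳ

  index-cong : ∀ {x y} → x ≈ y → index x ≡ index y
  index-cong = index.from-cong

  element-injective : ∀ {i j} → element i ≈ element j → i ≡ j
  element-injective {i} {j} eq = trans (sym (index-element i)) (trans (index-cong eq) (index-element j))

  indexRing : RawRing 0ℓ 0ℓ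
  indexRing = record
    { Carrier = Fin N
    ; _≈_ = _≡_
    ; _+_ = λ i j → index (element i +ᴷ element j)
    ; _*_ = λ i j → index (element i *ᴷ element j)
    ; -_ = λ i → index (-ᴷ element i)
    ; 0# = index 0#
    ; 1# = index 1#
    }

  element-isRingMonomorphism : IsRingMonomorphism indexRing E.rawRing element
  element-isRingMonomorphism = record
    { isRingHomomorphism = record
      { isSemiringHomomorphism = record
        { isNearSemiringHomomorphism = record
          { +-isMonoidHomomorphism = record
            { isMagmaHomomorphism = record
              { isRelHomomorphism = record { cong = λ eq → E.reflexive (cong element eq) }
              ; homo = λ _ _ → element-index _
              }
            ; ε-homo = element-index _
            }
          ; *-homo = λ _ _ → element-index _
          }
        ; 1#-homo = element-index _
        }
      ; -‿homo = λ _ → element-index _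
      }
    ; injective = element-injective
    }

  -- The hypothesis provides no apartness to invert. Searching all elements decides the existence of
  -- an inverse: if there is none, apartness from 0 is refuted, and tightness makes `x` zero.
  invert : ∀ {x} → ¬ x ≈ 0# → ∃ λ y → y *ᴷ x ≈ 1#
  invert {x} x≉0 = decide (Fin.any? λ j → (element j *ᴷ x) E.≟ 1#)
    where
    decide : Dec (∃ λ j → element j *ᴷ x ≈ 1#) → ∃ λ y → y *ᴷ x ≈ 1#
    decide (yes (j , eq)) = element j , eq
    decide (no none) = contradiction (proj₁ (E.tight x 0#) λ x#0 →
      let y , yx≈1 , _ = E.#⇒invertible x#0 in
      none (index y , ≈-trans (E.*-cong (element-index y) (≈-trans (≈-sym (E.+-identityʳ x)) (E.+-congˡ (≈-sym -0≈0)))) yx≈1)) x≉0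
      where
      -0≈0 : -ᴷ 0# ≈ 0#
      -0≈0 = ≈-trans (≈-sym (E.+-identityˡ (-ᴷ 0#))) (E.-‿inverseʳ 0#)

  strict : FieldOn N
  strict = record
    { _⊞_ = RawRing._+_ indexRing
    ; _⊠_ = RawRing._*_ indexRing
    ; ⊟_ = RawRing.-_ indexRing
    ; 𝟘 = index 0#
    ; 𝟙 = index 1#
    ; isCommutativeRing = RingMonomorphism.isCommutativeRing element-isRingMonomorphism
        (CommutativeRing.isCommutativeRing E.commutativeRing)
    ; invertible = λ {i} i≢0 →
        let y , eq = invert {element i} (λ i≈0 → i≢0 (element-injective (≈-trans i≈0 (≈-sym (element-index 0#)))))
        in index y , index-cong (≈-trans (E.*-congʳ (element-index y)) eq)
    -- Nontriviality comes from the cardinality: with 1 ≈ 0 all elements would coincide.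
    ; 𝟙≢𝟘 = λ 1≡0 → <⇒≱ 1<N (collapse (≈-trans (≈-sym (element-index 1#)) (≈-trans (E.reflexive (cong element 1≡0)) (element-index 0#))))
    }
    where
    collapse : 1# ≈ 0# → N ≤ 1
    collapse 1≈0 = Fin.injective⇒≤ {f = λ _ → zero} λ {i} {j} _ → element-injective
      (≈-trans (all-zero (element i)) (≈-sym (all-zero (element j))))
      where
      all-zero : ∀ x → x ≈ 0#
      all-zero x = ≈-trans (≈-sym (E.*-identityˡ x)) (≈-trans (E.*-congʳ 1≈0) (E.zeroˡ x))

-- Orders under Frobenius as dimensions of spans of conjugates.

module Normality {q : ℕ} {c ℓ₁ ℓ₂} (F : FiniteField q c ℓ₁ ℓ₂) (n : ℕ) (K : Extension F (suc n))
                 {p e : ℕ} (p-prime : Prime p) (q≡p^e : q ≡ p ^ e) (1<q : 1 < q) where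
  private
    module F = FiniteField F
    module Fˢ = Strictification F 1<q
  module E = Extension K
  open E using (Carrier; _≈_; 0#; 1#; element; index; embed)
    renaming (_+_ to _+ᴷ_; _*_ to _*ᴷ_; refl to ≈-refl; sym to ≈-sym; trans to ≈-trans)
  private
    module embed = IsRingHomomorphism E.embed-isHomomorphism
    1<qⁿ : 1 < q ^ suc n
    1<qⁿ = ^-monoʳ-< q 1<q {0} {suc n} (s≤s z≤n)
    module Kˢ = Strictification E.field′ 1<qⁿ

  Fˢ : FieldOn q
  Fˢ = Fˢ.strict

  Kˢ : FieldOn (q ^ suc n)
  Kˢ = Kˢ.strict

  ε : Fin q → Fin (q ^ suc n)
  ε a = index (embed (F.element a))

  open FieldExtension Fˢ n Kˢ {p} {e} p-prime q≡p^e ε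
    (λ a b → Kˢ.index-cong (≈-trans (embed.⟦⟧-cong (Fˢ.element-index _)) (≈-trans (embed.+-homo _ _)
      (E.+-cong (≈-sym (Kˢ.element-index _)) (≈-sym (Kˢ.element-index _))))))
    (λ a b → Kˢ.index-cong (≈-trans (embed.⟦⟧-cong (Fˢ.element-index _)) (≈-trans (embed.*-homo _ _)
      (E.*-cong (≈-sym (Kˢ.element-index _)) (≈-sym (Kˢ.element-index _))))))
    (Kˢ.index-cong (≈-trans (embed.⟦⟧-cong (Fˢ.element-index _)) embed.0#-homo))
    (Kˢ.index-cong (≈-trans (embed.⟦⟧-cong (Fˢ.element-index _)) embed.1#-homo))
  open OverField Fˢ using (ShiftModule; module ShiftModule; Hom; module Hom; Coeffs; 0v; δ; _+v_; _*v_)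
  open CyclicShift Fˢ using (A; rotate; orbit-map)
  open ShiftModule V using (_⊕_; _•_; act; act-δ; act-0v; act-+ˡ; act-*ˡ; T; Order; module Order; order)
  open FieldProperties Kˢ using (_↑_)
  open LinearAlgebra E.vectorSpace
  open SemiringExp E.semiring using () renaming (_^_ to _^ᴷ_; ^-assocʳ to ^ᴷ-assocʳ; ^-congˡ to ^ᴷ-congˡ)
  open SetoidReasoning E.setoid

  element-↑ : ∀ i k → element (i ↑ k) ≈ element i ^ᴷ k
  element-↑ i zero    = Kˢ.element-index 1#
  element-↑ i (suc k) = ≈-trans (Kˢ.element-index _) (E.*-congˡ (element-↑ i k))

  powers : ∀ m → Carrier → Fin m → Carrier
  powers m x i = x ^ᴷ (q ^ toℕ i)

  element-iter : ∀ j i → element (iter T j i) ≈ element i ^ᴷ (q ^ j)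
  element-iter j i = ≈-trans (E.reflexive (cong element (iter-T j i))) (element-↑ i (q ^ j))

  scalars : ∀ {m} → Coeffs m → Fin m → F.Carrier
  scalars c i = F.element (lookup c i)

  element-act : ∀ {m} (c : Coeffs m) i → element (act c i) ≈ linearCombination (scalars c) (powers m (element i))
  element-act         []      i = Kˢ.element-index 0#
  element-act {suc m} (a ∷ c) i = begin
    element (act (a ∷ c) i)
      ≈⟨ Kˢ.element-index _ ⟩
    element (index (element (ε a) *ᴷ element i)) +ᴷ element (act c (T i))
      ≈⟨ E.+-cong (≈-trans (Kˢ.element-index _) (E.*-cong (Kˢ.element-index _) (≈-sym (E.*-identityʳ _)))) (element-act c (T i)) ⟩
    embed (F.element a) *ᴷ element i ^ᴷ 1 +ᴷ linearCombination (scalars c) (powers m (element (T i)))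
      ≈⟨ E.+-congˡ (linearCombination-cong {a = scalars c} (λ _ → F.refl) shifted) ⟩
    linearCombination (scalars (a ∷ c)) (powers (suc m) (element i)) ∎
    where
    shifted : ∀ j → powers m (element (T i)) j ≈ powers (suc m) (element i) (suc j)
    shifted j = ≈-trans (^ᴷ-congˡ (q ^ toℕ j) (element-↑ i q)) (^ᴷ-assocʳ (element i) q (q ^ toℕ j))

  coefficients : ∀ {m} → (Fin m → F.Carrier) → Coeffs m
  coefficients a = tabulate (F.index ∘ a)

  scalars-coefficients : ∀ {m} (a : Fin m → F.Carrier) i → scalars (coefficients a) i F.≈ a i
  scalars-coefficients a i = F.trans (F.reflexive (cong F.element (Vec.lookup∘tabulate (F.index ∘ a) i))) (Fˢ.element-index (a i))

  element-act-coefficients : ∀ {m} (a : Fin m → F.Carrier) i →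
    element (act (coefficients a) i) ≈ linearCombination a (powers m (element i))
  element-act-coefficients {m} a i = ≈-trans (element-act (coefficients a) i)
    (linearCombination-cong {v = powers m (element i)} (scalars-coefficients a) (λ _ → refl′))
    where refl′ = λ {x} → ≈-refl {x}

  Conjugates : Fin (q ^ suc n) → Pred Carrier _
  Conjugates i = Span (conjugates K (element i))

  cyclic⇒ : ∀ i (c : Coeffs (suc n)) {x} → element (act c i) ≈ x → Conjugates i x
  cyclic⇒ i c eq = scalars c , ≈-trans (≈-sym eq) (element-act c i)

  cyclic⇐ : ∀ i {x} → Conjugates i x → ∃ λ (c : Coeffs (suc n)) → element (act c i) ≈ x
  cyclic⇐ i (a , eq) = coefficients a , ≈-trans (element-act-coefficients a i) (≈-sym eq)

  -- The first `order o` conjugates form a basis: independence and spanning are what an `Order`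
  -- provides.
  order⇒dimension : ∀ {i} (o : Order i) → order o ≤ suc n → HasDimension (Conjugates i) (order o)
  order⇒dimension {i} o m≤n = powers m (element i) , in-span , independent , spanning
    where
    open Order o using (span) renaming (independent to act-independent)
    m = order o
    orbit = orbit-map V i (T-periodic i)
    in-span : ∀ j → Conjugates i (powers m (element i) j)
    in-span j = cyclic⇒ i (iter rotate (toℕ j) δ) (≈-trans
      (E.reflexive (cong element (trans (Hom.iter-homo orbit (toℕ j) δ) (cong (iter T (toℕ j)) (act-δ {n} i)))))
      (element-iter (toℕ j) i))
    independent : LinearlyIndependent (powers m (element i))
    independent a eq j = F.trans (F.sym (scalars-coefficients a j)) (F.trans
      (F.reflexive (cong F.element (trans (cong (λ v → lookup v j) a≡0) (Vec.lookup-replicate j _))))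
      (Fˢ.element-index F.0#))
      where
      a≡0 : coefficients a ≡ 0v
      a≡0 = act-independent (coefficients a) (Kˢ.element-injective
        (≈-trans (element-act-coefficients a i) (≈-trans eq (≈-sym (Kˢ.element-index 0#)))))
    spanning : ∀ {x} → Conjugates i x → Span (powers m (element i)) x
    spanning x∈ = let c , eq = cyclic⇐ i x∈ ; d , dc = span c in
      scalars d , ≈-trans (≈-sym eq) (≈-trans (E.reflexive (cong element (sym dc))) (element-act d i))

  combination-cyclic : ∀ {i} (o : Order i) d (a : Fin d → F.Carrier) {b : Fin d → Carrier} → (∀ j → Conjugates i (b j)) →
                       ∃ λ (c : Coeffs (order o)) → element (act c i) ≈ linearCombination a b
  combination-cyclic {i} o zero    a b∈ = 0v , ≈-trans (E.reflexive (cong element (act-0v {order o} i))) (Kˢ.element-index 0#)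
  combination-cyclic {i} o (suc d) a {b} b∈ =
    let c , eq  = combination-cyclic o d (a ∘ suc) (b∈ ∘ suc)
        s , eqₛ = cyclic⇐ i (b∈ zero)
        t , eqₜ = Order.span o s
        α = F.index (a zero)
    in α *v t +v c , (begin
      element (act (α *v t +v c) i)
        ≡⟨ cong element (trans (act-+ˡ (α *v t) c i) (cong (λ y → y ⊕ act c i) (act-*ˡ α t i))) ⟩
      element (α • act t i ⊕ act c i)
        ≈⟨ Kˢ.element-index _ ⟩
      element (α • act t i) +ᴷ element (act c i)
        ≈⟨ E.+-cong (≈-trans (Kˢ.element-index _) (E.*-cong
             (≈-trans (Kˢ.element-index _) (embed.⟦⟧-cong (Fˢ.element-index (a zero))))
             (≈-trans (E.reflexive (cong element eqₜ)) eqₛ))) eq ⟩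
      linearCombination a b ∎)

  linearCombination-injective : ∀ {d} {b : Fin d → Carrier} → LinearlyIndependent b → ∀ a a′ →
    linearCombination a b ≈ linearCombination a′ b → ∀ j → a j F.≈ a′ j
  linearCombination-injective {d} {b} indep a a′ eq j =
    GroupProperties.x∙y⁻¹≈ε⇒x≈y (CommutativeRing.+-group F.commutativeRing) _ _ (indep (λ i → a i F.+ F.- a′ i) (begin
      linearCombination (λ i → a i F.+ F.- a′ i) b
        ≈⟨ GroupProperties.∙-cancelʳ (CommutativeRing.+-group E.commutativeRing) (linearCombination a′ b) _ _ (begin
          linearCombination (λ i → a i F.+ F.- a′ i) b +ᴷ linearCombination a′ b
            ≈⟨ ∑-distrib-+ (λ i → embed (a i F.+ F.- a′ i) *ᴷ b i) (λ i → embed (a′ i) *ᴷ b i) ⟨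
          sum (λ i → embed (a i F.+ F.- a′ i) *ᴷ b i +ᴷ embed (a′ i) *ᴷ b i)
            ≈⟨ sum-cong-≋ (λ i → ≈-trans (≈-sym (E.distribʳ (b i) _ _)) (E.*-congʳ (≈-trans (≈-sym (embed.+-homo _ _))
                 (embed.⟦⟧-cong (F.trans (F.+-assoc _ _ _) (F.trans (F.+-congˡ (F.-‿inverseˡ (a′ i))) (F.+-identityʳ (a i)))))))) ⟩
          linearCombination a b
            ≈⟨ ≈-trans eq (≈-sym (E.+-identityˡ _)) ⟩
          0# +ᴷ linearCombination a′ b ∎) ⟩
      0# ∎) j)
    where open CommutativeMonoidSum (CommutativeRing.+-commutativeMonoid E.commutativeRing) using (sum; ∑-distrib-+; sum-cong-≋)

  -- Invariance of dimension by counting: the q^d coordinate vectors for the basis `b` and the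
  -- q^order ones for the first conjugates inject into each other.
  dimension⇒order : ∀ {i} (o : Order i) {d} → HasDimension (Conjugates i) d → d ≡ order o
  dimension⇒order {i} o {d} (b , b∈ , indep , spans) = ≤-antisym
    (^-cancelʳ-≤ d (order o) 1<q (injection⇒^≤^ to-order to-order-injective))
    (^-cancelʳ-≤ (order o) d 1<q (injection⇒^≤^ to-basis to-basis-injective))
    where
    to-order : Coeffs d → Coeffs (order o)
    to-order s = proj₁ (combination-cyclic o d (scalars s) b∈)
    to-order-injective : ∀ {s t} → to-order s ≡ to-order t → s ≡ t
    to-order-injective {s} {t} eq = lookup-injective λ j → Fˢ.element-injective
      (linearCombination-injective indep (scalars s) (scalars t) (begin
        linearCombination (scalars s) b      ≈⟨ proj₂ (combination-cyclic o d (scalars s) b∈) ⟨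
        element (act (to-order s) i)         ≡⟨ cong (λ c → element (act c i)) eq ⟩
        element (act (to-order t) i)         ≈⟨ proj₂ (combination-cyclic o d (scalars t) b∈) ⟩
        linearCombination (scalars t) b      ∎) j)
      where
      lookup-injective : ∀ {m} {s t : Coeffs m} → (∀ j → lookup s j ≡ lookup t j) → s ≡ t
      lookup-injective {s = []}    {[]}    _  = refl
      lookup-injective {s = x ∷ s} {y ∷ t} eq = cong₂ _∷_ (eq zero) (lookup-injective (eq ∘ suc))
    member : (s : Coeffs (order o)) → Conjugates i (element (act s i))
    member s = let c , eq = in-cyclic s in cyclic⇒ i c (E.reflexive (cong element eq))
      where
      orbit = orbit-map V i (T-periodic i)
      in-cyclic : (s : Coeffs (order o)) → ∃ λ (c : Coeffs (suc n)) → act c i ≡ act s i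
      in-cyclic s = ShiftModule.act (A (suc n)) s δ ,
        trans (Hom.act-homo orbit s δ) (cong (act s) (act-δ {n} i))
    to-basis : Coeffs (order o) → Coeffs d
    to-basis s = coefficients (proj₁ (spans (member s)))
    to-basis-injective : ∀ {s t} → to-basis s ≡ to-basis t → s ≡ t
    to-basis-injective {s} {t} eq = Order.injective o (Kˢ.element-injective (begin
      element (act s i)                                          ≈⟨ lemma s ⟩
      linearCombination (scalars (to-basis s)) b                 ≡⟨ cong (λ c → linearCombination (scalars c) b) eq ⟩
      linearCombination (scalars (to-basis t)) b                 ≈⟨ lemma t ⟨
      element (act t i)                                          ∎))
      where
      lemma : ∀ s → element (act s i) ≈ linearCombination (scalars (to-basis s)) b
      lemma s = ≈-trans (proj₂ (spans (member s)))
        (linearCombination-cong {v = b} (λ j → F.sym (scalars-coefficients _ j)) (λ _ → ≈-refl))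

  normalCount≡normals : ∀ k → normalCount K k ≡ normals Fˢ n k
  normalCount≡normals k = trans (count-tabulate (IsNormal? K k) element)
    (NormalBasis.#-normals Fˢ n V (↔-id _) T-periodic (λ c → faithful c ≤-refl) k (IsNormal? K k ∘ element)
      (λ o (k≤n , dim) → trans (cong (_+ k) (sym (dimension⇒order o dim))) (m∸n+n≡m k≤n))
      (λ o eq → ≤-trans (m≤n+m k (order o)) (≤-reflexive eq) ,
        subst (HasDimension (Conjugates _)) (trans (sym (m+n∸n≡m (order o) k)) (cong (_∸ k) eq))
          (order⇒dimension o (≤-trans (m≤m+n (order o) k) (≤-reflexive eq)))))

-- Sums over divisors

sumTo-+ : ∀ f g N → sumTo (λ i → f i + g i) N ≡ sumTo f N + sumTo g N
sumTo-+ f g zero    = refl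
sumTo-+ f g (suc N) = trans (cong (_+ (f N + g N)) (sumTo-+ f g N)) (+-interchange (sumTo f N) (sumTo g N) (f N) (g N))
  where open CommutativeSemigroupProperties +-commutativeSemigroup renaming (interchange to +-interchange)

sumTo-mono : ∀ {f g} N → (∀ i → f i ≤ g i) → sumTo f N ≤ sumTo g N
sumTo-mono zero    le = z≤n
sumTo-mono (suc N) le = +-mono-≤ (sumTo-mono N le) (le N)

sumTo-* : ∀ c f N → sumTo (λ i → c * f i) N ≡ c * sumTo f N
sumTo-* c f zero    = sym (*-zeroʳ c)
sumTo-* c f (suc N) = trans (cong (_+ c * f N) (sumTo-* c f N)) (sym (*-distribˡ-+ c (sumTo f N) (f N)))

sumTo-cong : ∀ {f g} N → (∀ i → f i ≡ g i) → sumTo f N ≡ sumTo g N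
sumTo-cong zero    eq = refl
sumTo-cong (suc N) eq = cong₂ _+_ (sumTo-cong N eq) (eq N)

sumTo-const : ∀ c N → sumTo (λ _ → c) N ≡ N * c
sumTo-const c zero    = refl
sumTo-const c (suc N) = trans (cong (_+ c) (sumTo-const c N)) (+-comm (N * c) c)

sumTo-swap : ∀ (f : ℕ → ℕ → ℕ) M N → sumTo (λ i → sumTo (f i) N) M ≡ sumTo (λ j → sumTo (λ i → f i j) M) N
sumTo-swap f zero    N = sym (trans (sumTo-const 0 N) (*-zeroʳ N))
sumTo-swap f (suc M) N = trans (cong (_+ sumTo (f M) N) (sumTo-swap f M N)) (sym (sumTo-+ (λ j → sumTo (λ i → f i j) M) (f M) N))

term≤sumTo : ∀ f {i N} → i < N → f i ≤ sumTo f N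
term≤sumTo f {i} {suc N} i<1+N with m≤n⇒m<n∨m≡n (≤-pred i<1+N)
... | inj₁ i<N  = ≤-trans (term≤sumTo f i<N) (m≤m+n _ (f N))
... | inj₂ refl = m≤n+m (f N) _

indicator : ∀ {P : Set} → Dec P → ℕ
indicator (yes _) = 1
indicator (no _)  = 0

-- The weight `d` makes the mean over `n` at most 1 for every `d`.
multipleOf : ℕ → ℕ → ℕ
multipleOf d n = indicator (d ∣? n) * d

-- The multiples of d in {1, …, N} contribute d ⌊N/d⌋.
sum-multiples : ∀ d N → sumTo (multipleOf d ∘ suc) N ≤ N
sum-multiples zero    N = ≤-trans (≤-reflexive (trans (sum-zero N) (*-zeroʳ N))) z≤n
  where
  sum-zero : ∀ N → sumTo (multipleOf 0 ∘ suc) N ≡ N * 0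
  sum-zero N = ≤-antisym (≤-trans (sumTo-mono N (λ i → ≤-reflexive (*-zeroʳ (indicator (0 ∣? suc i))))) (≤-reflexive (sumTo-const 0 N)))
    (≤-trans (≤-reflexive (*-zeroʳ N)) z≤n)
sum-multiples d@(suc d′) N = let r , _ , eq , _ = invariant N in ≤-trans (m≤m+n _ r) (≤-reflexive eq)
  where
  invariant : ∀ N → ∃ λ r → r < d × sumTo (multipleOf d ∘ suc) N + r ≡ N × d ∣ sumTo (multipleOf d ∘ suc) N
  invariant zero = 0 , s≤s z≤n , refl , d ∣0
  invariant (suc N) with invariant N | d ∣? suc N
  ... | r , r<d , eq , d∣s | yes d∣1+N = 0 , s≤s z≤n , trans (+-identityʳ _)
          (trans (cong (sumTo (multipleOf d ∘ suc) N +_) (trans (+-identityʳ d) (sym 1+r≡d))) sum≡)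
        , ∣m∣n⇒∣m+n d∣s (subst (d ∣_) (sym (+-identityʳ d)) ∣-refl)
    where
    sum≡ : sumTo (multipleOf d ∘ suc) N + suc r ≡ suc N
    sum≡ = trans (+-suc _ r) (cong suc eq)
    1+r≡d : suc r ≡ d
    1+r≡d = ≤-antisym r<d (∣⇒≤ (∣m+n∣m⇒∣n (subst (d ∣_) (sym sum≡) d∣1+N) d∣s))
  ... | r , r<d , eq , d∣s | no d∤1+N = suc r , ≤∧≢⇒< r<d (λ 1+r≡d → d∤1+N (subst (d ∣_) sum≡ (∣m∣n⇒∣m+n d∣s (subst (d ∣_) (sym 1+r≡d) ∣-refl))))
        , trans (cong (_+ suc r) (+-identityʳ _)) sum≡ , subst (d ∣_) (sym (+-identityʳ _)) d∣s
    where
    sum≡ : sumTo (multipleOf d ∘ suc) N + suc r ≡ suc N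
    sum≡ = trans (+-suc _ r) (cong suc eq)

multipleOf-∣ : ∀ {d n} → d ∣ n → multipleOf d n ≡ d
multipleOf-∣ {d} {n} d∣n with d ∣? n
... | yes _  = +-identityʳ d
... | no d∤n = contradiction d∣n d∤n

-- A divisor of Q exceeding R is Q / f for some f ≤ R′.
gcd-bound : ∀ {Q R R′} → 1 ≤ Q → Q ≤ R * R′ → ∀ n →
            gcd n Q ≤ R + sumTo (λ f → multipleOf (Q / suc f) n) R′
gcd-bound {Q} {R} {R′} 1≤Q Q≤RR′ n = cases (gcd n Q ≤? R) (gcd[m,n]∣n n Q)
  where
  open ≤-Reasoning
  cases : Dec (gcd n Q ≤ R) → gcd n Q ∣ Q → gcd n Q ≤ R + sumTo (λ f → multipleOf (Q / suc f) n) R′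
  cases (yes g≤R) _ = ≤-trans g≤R (m≤m+n R _)
  cases (no _) (divides zero Q≡0) = contradiction (≤-trans 1≤Q (≤-reflexive Q≡0)) λ ()
  cases (no g≰R) (divides (suc f) Q≡) = begin
    gcd n Q                                               ≡⟨ multipleOf-∣ (gcd[m,n]∣m n Q) ⟨
    multipleOf (gcd n Q) n                                ≡⟨ cong (λ g → multipleOf g n) Q/1+f≡g ⟨
    multipleOf (Q / suc f) n                              ≤⟨ term≤sumTo (λ f → multipleOf (Q / suc f) n) f<R′ ⟩
    sumTo (λ f → multipleOf (Q / suc f) n) R′             ≤⟨ m≤n+m _ R ⟩
    R + sumTo (λ f → multipleOf (Q / suc f) n) R′         ∎
    where
    Q/1+f≡g : Q / suc f ≡ gcd n Q
    Q/1+f≡g = trans (cong (_/ suc f) (trans Q≡ (*-comm (suc f) (gcd n Q)))) (m*n/n≡m (gcd n Q) (suc f))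
    f<R′ : f < R′
    f<R′ = ≰⇒> λ R′≤f → <⇒≱ (begin-strict
      R * R′             ≡⟨ *-comm R R′ ⟩
      R′ * R             <⟨ *-mono-< (s≤s R′≤f) (≰⇒> g≰R) ⟩
      suc f * gcd n Q    ≡⟨ Q≡ ⟨
      Q                  ∎) Q≤RR′

-- In `gcd-bound` the small divisors cost `R` for each `n`, while each of the `R′` large ones
-- contributes at most `N` in total, by `sum-multiples`.
gcd-sum : ∀ {Q R R′} → 1 ≤ Q → Q ≤ R * R′ → ∀ N → sumTo (λ i → gcd (suc i) Q) N ≤ N * (R + R′)
gcd-sum {Q} {R} {R′} 1≤Q Q≤RR′ N = begin
  sumTo (λ i → gcd (suc i) Q) N
    ≤⟨ sumTo-mono N (λ i → gcd-bound {Q} {R} {R′} 1≤Q Q≤RR′ (suc i)) ⟩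
  sumTo (λ i → R + sumTo (λ f → multipleOf (Q / suc f) (suc i)) R′) N
    ≡⟨ sumTo-+ (λ _ → R) (λ i → sumTo (λ f → multipleOf (Q / suc f) (suc i)) R′) N ⟩
  sumTo (λ _ → R) N + sumTo (λ i → sumTo (λ f → multipleOf (Q / suc f) (suc i)) R′) N
    ≡⟨ cong₂ _+_ (sumTo-const R N) (sumTo-swap (λ i f → multipleOf (Q / suc f) (suc i)) N R′) ⟩
  N * R + sumTo (λ f → sumTo (λ i → multipleOf (Q / suc f) (suc i)) N) R′
    ≤⟨ +-monoʳ-≤ (N * R) (sumTo-mono R′ (λ f → sum-multiples (Q / suc f) N)) ⟩
  N * R + sumTo (λ _ → N) R′
    ≡⟨ cong (N * R +_) (trans (sumTo-const N R′) (*-comm R′ N)) ⟩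
  N * R + N * R′
    ≡⟨ *-distribˡ-+ N R R′ ⟨
  N * (R + R′) ∎
  where open ≤-Reasoning

-- The split into two halves makes both the small and the large divisors of
-- q^m - 1 negligible against q^m.
power-gcd-sum : ∀ {q} → 1 < q → ∀ {m} → 1 ≤ m → ∀ N →
                sumTo (λ i → gcd (suc i) (q ^ m ∸ 1)) N * 2 ^ ⌊ m /2⌋ ≤ 2 * N * q ^ m
power-gcd-sum {q} 1<q {m} 1≤m N = begin
  sumTo (λ i → gcd (suc i) (q ^ m ∸ 1)) N * 2 ^ h      ≤⟨ *-mono-≤ (gcd-sum {R = q ^ h} {R′ = q ^ h′} 1≤Q Q≤ N) (^-monoˡ-≤ h 1<q) ⟩
  N * (q ^ h + q ^ h′) * q ^ h                         ≤⟨ *-monoˡ-≤ (q ^ h) (*-monoʳ-≤ N (+-monoˡ-≤ (q ^ h′) (^-monoʳ-≤ q (⌊n/2⌋≤⌈n/2⌉ m)))) ⟩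
  N * (q ^ h′ + q ^ h′) * q ^ h                        ≡⟨ cong (λ k → N * (q ^ h′ + k) * q ^ h) (+-identityʳ (q ^ h′)) ⟨
  N * (2 * q ^ h′) * q ^ h                             ≡⟨ cong (_* q ^ h) (trans (sym (*-assoc N 2 (q ^ h′))) (cong (_* q ^ h′) (*-comm N 2))) ⟩
  2 * N * q ^ h′ * q ^ h                               ≡⟨ *-assoc (2 * N) (q ^ h′) (q ^ h) ⟩
  2 * N * (q ^ h′ * q ^ h)                             ≡⟨ cong (2 * N *_) (trans (*-comm (q ^ h′) (q ^ h)) q^h*q^h′) ⟩
  2 * N * q ^ m                                        ∎
  where
  open ≤-Reasoning
  h = ⌊ m /2⌋
  h′ = ⌈ m /2⌉
  instance
    q≢0 : NonZero q
    q≢0 = >-nonZero (<-trans (s≤s z≤n) 1<q)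
  q^h*q^h′ : q ^ h * q ^ h′ ≡ q ^ m
  q^h*q^h′ = trans (sym (^-distribˡ-+-* q h h′)) (cong (q ^_) (⌊n/2⌋+⌈n/2⌉≡n m))
  Q≤ : q ^ m ∸ 1 ≤ q ^ h * q ^ h′
  Q≤ = ≤-trans (m∸n≤m (q ^ m) 1) (≤-reflexive (sym q^h*q^h′))
  1≤Q : 1 ≤ q ^ m ∸ 1
  1≤Q = ∸-monoˡ-≤ 1 (≤-trans 1<q (≤-trans (≤-reflexive (sym (^-identityʳ q))) (^-monoʳ-≤ q 1≤m)))

-- Rational estimates

module Estimates where
  open +-*-Solver using (solve; _:=_; _:+_; _:*_; _:-_; :-_)

  -- Abstract, because unfolding it exposes the normalisation of fractions.
  abstract
    ι : ℕ → ℚ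
    ι n = ℤ.+ n ℚ./ 1

    ι-def : ∀ n → ι n ≡ ℤ.+ n ℚ./ 1
    ι-def n = refl

    ι-0 : ι 0 ≡ 0ℚ
    ι-0 = refl

    ι-1 : ι 1 ≡ 1ℚ
    ι-1 = refl

    toℚᵘ-ι : ∀ n → ℚ.toℚᵘ (ι n) ℚᵘ.≃ ℚᵘ.mkℚᵘ (ℤ.+ n) 0
    toℚᵘ-ι n = ℚ.toℚᵘ-fromℚᵘ (ℚᵘ.mkℚᵘ (ℤ.+ n) 0)

    0≤ι : ∀ n → 0ℚ ≤ℚ ι n
    0≤ι n = ℚ.nonNegative⁻¹ (ι n) {{ℚ.normalize-nonNeg n 1}}

  ι-+ : ∀ m n → ι (m + n) ≡ ι m +ℚ ι n
  ι-+ m n = ℚ.toℚᵘ-injective (begin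
    ℚ.toℚᵘ (ι (m + n))                                        ≈⟨ toℚᵘ-ι (m + n) ⟩
    ℚᵘ.mkℚᵘ (ℤ.+ (m + n)) 0                                   ≈⟨ ℚᵘ.*≡* (cong (ℤ._* ℤ.1ℤ) (trans (ℤ.pos-+ m n)
                                                                   (sym (cong₂ ℤ._+_ (ℤ.*-identityʳ (ℤ.+ m)) (ℤ.*-identityʳ (ℤ.+ n)))))) ⟩
    ℚᵘ.mkℚᵘ (ℤ.+ m) 0 ℚᵘ.+ ℚᵘ.mkℚᵘ (ℤ.+ n) 0                  ≈⟨ ℚᵘ.+-cong (toℚᵘ-ι m) (toℚᵘ-ι n) ⟨
    ℚ.toℚᵘ (ι m) ℚᵘ.+ ℚ.toℚᵘ (ι n)                            ≈⟨ ℚ.toℚᵘ-homo-+ (ι m) (ι n) ⟨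
    ℚ.toℚᵘ (ι m +ℚ ι n)                                       ∎)
    where open SetoidReasoning ℚᵘ.≃-setoid

  ι-* : ∀ m n → ι (m * n) ≡ ι m *ℚ ι n
  ι-* m n = ℚ.toℚᵘ-injective (begin
    ℚ.toℚᵘ (ι (m * n))                                        ≈⟨ toℚᵘ-ι (m * n) ⟩
    ℚᵘ.mkℚᵘ (ℤ.+ (m * n)) 0                                   ≈⟨ ℚᵘ.*≡* (cong (ℤ._* ℤ.1ℤ) (ℤ.pos-* m n)) ⟩
    ℚᵘ.mkℚᵘ (ℤ.+ m) 0 ℚᵘ.* ℚᵘ.mkℚᵘ (ℤ.+ n) 0                  ≈⟨ ℚᵘ.*-cong (toℚᵘ-ι m) (toℚᵘ-ι n) ⟨
    ℚ.toℚᵘ (ι m) ℚᵘ.* ℚ.toℚᵘ (ι n)                            ≈⟨ ℚ.toℚᵘ-homo-* (ι m) (ι n) ⟨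
    ℚ.toℚᵘ (ι m *ℚ ι n)                                       ∎)
    where open SetoidReasoning ℚᵘ.≃-setoid

  x≤x+ : ∀ x {e} → 0ℚ ≤ℚ e → x ≤ℚ x +ℚ e
  x≤x+ x 0≤e = ℚ.≤-trans (ℚ.≤-reflexive (sym (ℚ.+-identityʳ x))) (ℚ.+-monoʳ-≤ x 0≤e)

  ι-mono : ∀ {m n} → m ≤ n → ι m ≤ℚ ι n
  ι-mono {m} {n} m≤n = ℚ.≤-trans (x≤x+ (ι m) (0≤ι (n ∸ m)))
    (ℚ.≤-reflexive (trans (sym (ι-+ m (n ∸ m))) (cong ι (m+[n∸m]≡n m≤n))))

  0<1 : 0ℚ <ℚ 1ℚ
  0<1 = ℚ.positive⁻¹ 1ℚ

  0<ι : ∀ {n} → 1 ≤ n → 0ℚ <ℚ ι n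
  0<ι 1≤n = ℚ.<-≤-trans 0<1 (ℚ.≤-trans (ℚ.≤-reflexive (sym ι-1)) (ι-mono 1≤n))

  ≢0 : ∀ {x} → 0ℚ <ℚ x → x ≢ 0ℚ
  ≢0 0<x x≡0 = ℚ.<⇒≢ 0<x (sym x≡0)

  *-monoˡ : ∀ {x y z} → 0ℚ ≤ℚ z → x ≤ℚ y → z *ℚ x ≤ℚ z *ℚ y
  *-monoˡ {z = z} 0≤z = ℚ.*-monoˡ-≤-nonNeg z {{ℚ.nonNegative 0≤z}}

  *-monoʳ : ∀ {x y z} → 0ℚ ≤ℚ z → x ≤ℚ y → x *ℚ z ≤ℚ y *ℚ z
  *-monoʳ {z = z} 0≤z = ℚ.*-monoʳ-≤-nonNeg z {{ℚ.nonNegative 0≤z}}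

  *-cancelʳ : ∀ {x y z} → 0ℚ <ℚ z → x *ℚ z ≤ℚ y *ℚ z → x ≤ℚ y
  *-cancelʳ {z = z} 0<z = ℚ.*-cancelʳ-≤-pos z {{ℚ.positive 0<z}}

  0≤* : ∀ {x y} → 0ℚ ≤ℚ x → 0ℚ ≤ℚ y → 0ℚ ≤ℚ x *ℚ y
  0≤* {x} 0≤x 0≤y = ℚ.≤-trans (ℚ.≤-reflexive (sym (ℚ.*-zeroʳ x))) (*-monoˡ 0≤x 0≤y)

  0<* : ∀ {x y} → 0ℚ <ℚ x → 0ℚ <ℚ y → 0ℚ <ℚ x *ℚ y
  0<* {x} {y} 0<x 0<y = ℚ.positive⁻¹ (x *ℚ y) {{ℚ.pos*pos⇒pos x {{ℚ.positive 0<x}} y {{ℚ.positive 0<y}}}}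

  0<recip : ∀ {x} → 0ℚ <ℚ x → 0ℚ <ℚ recip x
  0<recip {x} 0<x = ℚ.≰⇒> λ r≤0 → ℚ.<-irrefl refl (ℚ.<-≤-trans 0<1 (begin
    1ℚ               ≡⟨ recip-inverseˡ x (≢0 0<x) ⟨
    recip x *ℚ x     ≤⟨ *-monoʳ (ℚ.<⇒≤ 0<x) r≤0 ⟩
    0ℚ *ℚ x          ≡⟨ ℚ.*-zeroˡ x ⟩
    0ℚ               ∎))
    where open ℚ.≤-Reasoning

  infixl 7 _÷_
  _÷_ : ℚ → ℚ → ℚ
  x ÷ y = x *ℚ recip y

  ÷-*-cancel : ∀ x {y} → 0ℚ <ℚ y → x ÷ y *ℚ y ≡ x
  ÷-*-cancel x {y} 0<y = trans (ℚ.*-assoc x (recip y) y)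
    (trans (cong (x *ℚ_) (recip-inverseˡ y (≢0 0<y))) (ℚ.*-identityʳ x))

  *-÷-cancel : ∀ x {y} → 0ℚ <ℚ y → x *ℚ y ÷ y ≡ x
  *-÷-cancel x {y} 0<y = trans (ℚ.*-assoc x y (recip y))
    (trans (cong (x *ℚ_) (trans (ℚ.*-comm y (recip y)) (recip-inverseˡ y (≢0 0<y)))) (ℚ.*-identityʳ x))

  ≤⇒÷≤ : ∀ {x y z} → 0ℚ <ℚ y → x ≤ℚ z *ℚ y → x ÷ y ≤ℚ z
  ≤⇒÷≤ {x} {y} {z} 0<y le = *-cancelʳ 0<y (ℚ.≤-trans (ℚ.≤-reflexive (÷-*-cancel x 0<y)) le)

  0≤÷ : ∀ {x y} → 0ℚ ≤ℚ x → 0ℚ <ℚ y → 0ℚ ≤ℚ x ÷ y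
  0≤÷ 0≤x 0<y = 0≤* 0≤x (ℚ.<⇒≤ (0<recip 0<y))

  /≡÷ : ∀ m n .{{_ : NonZero n}} → ℤ.+ m ℚ./ n ≡ ι m ÷ ι n
  /≡÷ m n@(suc _) = trans (sym (*-÷-cancel (ℤ.+ m ℚ./ n) 0<n)) (cong (_÷ ι n) (ℚ.toℚᵘ-injective (begin
    ℚ.toℚᵘ ((ℤ.+ m ℚ./ n) *ℚ ι n)                       ≈⟨ ℚ.toℚᵘ-homo-* (ℤ.+ m ℚ./ n) (ι n) ⟩
    ℚ.toℚᵘ (ℤ.+ m ℚ./ n) ℚᵘ.* ℚ.toℚᵘ (ι n)              ≈⟨ ℚᵘ.*-cong (ℚ.toℚᵘ-fromℚᵘ (ℚᵘ.mkℚᵘ (ℤ.+ m) (pred n))) (toℚᵘ-ι n) ⟩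
    ℚᵘ.mkℚᵘ (ℤ.+ m) (pred n) ℚᵘ.* ℚᵘ.mkℚᵘ (ℤ.+ n) 0     ≈⟨ ℚᵘ.*≡* (trans (ℤ.*-identityʳ _) (cong (ℤ.+ m ℤ.*_) (cong ℤ.+_ (sym (*-identityʳ n))))) ⟩
    ℚᵘ.mkℚᵘ (ℤ.+ m) 0                                   ≈⟨ toℚᵘ-ι m ⟨
    ℚ.toℚᵘ (ι m)                                        ∎)))
    where
    open SetoidReasoning ℚᵘ.≃-setoid
    0<n = 0<ι {n} (s≤s z≤n)

  -- The denominator of `ε` serves as `D`: the product is the numerator, a positive integer.
  archimedean : ∀ {ε} → 0ℚ <ℚ ε → ∃ λ D → 1ℚ ≤ℚ ε *ℚ ι D
  archimedean {ε} 0<ε = ℚ.↧ₙ ε , (begin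
    1ℚ                                     ≡⟨ ι-1 ⟨
    ι 1                                    ≤⟨ ι-mono (positive-numerator ε 0<ε) ⟩
    ι (ℤ.∣ ℚ.↥ ε ∣)                         ≡⟨ ÷-*-cancel (ι ℤ.∣ ℚ.↥ ε ∣) 0<d ⟨
    ι (ℤ.∣ ℚ.↥ ε ∣) ÷ ι (ℚ.↧ₙ ε) *ℚ ι (ℚ.↧ₙ ε) ≡⟨ cong (_*ℚ ι (ℚ.↧ₙ ε)) (begin-equality
      ι (ℤ.∣ ℚ.↥ ε ∣) ÷ ι (ℚ.↧ₙ ε)            ≡⟨ /≡÷ ℤ.∣ ℚ.↥ ε ∣ (ℚ.↧ₙ ε) ⟨
      ℤ.+ ℤ.∣ ℚ.↥ ε ∣ ℚ./ ℚ.↧ₙ ε              ≡⟨ cong (ℚ._/ ℚ.↧ₙ ε) (ℤ.0≤i⇒+∣i∣≡i (numerator-nonNeg ε 0<ε)) ⟩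
      ℚ.↥ ε ℚ./ ℚ.↧ₙ ε                        ≡⟨ ℚ.↥p/↧p≡p ε ⟩
      ε                                       ∎) ⟩
    ε *ℚ ι (ℚ.↧ₙ ε)                        ∎)
    where
    open ℚ.≤-Reasoning
    0<d = 0<ι {ℚ.↧ₙ ε} (s≤s z≤n)
    positive-numerator : ∀ ε → 0ℚ <ℚ ε → 1 ≤ ℤ.∣ ℚ.↥ ε ∣
    positive-numerator (ℚ.mkℚ ℤ.+[1+ n ] _ _) _ = s≤s z≤n
    positive-numerator (ℚ.mkℚ ℤ.+0 _ _) (ℚ.*<* (ℤ.+<+ ()))
    positive-numerator (ℚ.mkℚ ℤ.-[1+ n ] _ _) (ℚ.*<* ())
    numerator-nonNeg : ∀ ε → 0ℚ <ℚ ε → ℤ.0ℤ ℤ.≤ ℚ.↥ ε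
    numerator-nonNeg (ℚ.mkℚ (ℤ.+ n) _ _) _ = ℤ.+≤+ z≤n
    numerator-nonNeg (ℚ.mkℚ ℤ.-[1+ n ] _ _) (ℚ.*<* ())

  archimedean-* : ∀ {ε} → 0ℚ <ℚ ε → ∀ c → ∃ λ D → ∀ {n} → D ≤ n → ι c ≤ℚ ε *ℚ ι n
  archimedean-* {ε} 0<ε c = let D , 1≤εD = archimedean 0<ε in D * c , λ {n} le → begin
    ι c                        ≡⟨ ℚ.*-identityˡ (ι c) ⟨
    1ℚ *ℚ ι c                  ≤⟨ *-monoʳ (0≤ι c) 1≤εD ⟩
    ε *ℚ ι D *ℚ ι c            ≡⟨ trans (ℚ.*-assoc ε (ι D) (ι c)) (cong (ε *ℚ_) (sym (ι-* D c))) ⟩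
    ε *ℚ ι (D * c)             ≤⟨ *-monoˡ (ℚ.<⇒≤ 0<ε) (ι-mono le) ⟩
    ε *ℚ ι n                   ∎
    where open ℚ.≤-Reasoning

  -- Two inequalities in place of an absolute value, so that estimates combine by monotonicity
  -- alone.
  Near : ℚ → ℚ → ℚ → Set
  Near e x y = x ≤ℚ y +ℚ e × y ≤ℚ x +ℚ e

  near-refl : ∀ {e x} → 0ℚ ≤ℚ e → Near e x x
  near-refl {x = x} 0≤e = x≤x+ x 0≤e , x≤x+ x 0≤e

  near-sym : ∀ {e x y} → Near e x y → Near e y x
  near-sym (a , b) = b , a

  near-mono : ∀ {e e′ x y} → e ≤ℚ e′ → Near e x y → Near e′ x y
  near-mono {x = x} {y} le (a , b) = ℚ.≤-trans a (ℚ.+-monoʳ-≤ y le) , ℚ.≤-trans b (ℚ.+-monoʳ-≤ x le)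

  near-trans : ∀ {e e′ x y z} → Near e x y → Near e′ y z → Near (e +ℚ e′) x z
  near-trans {e} {e′} {x} {y} {z} (a , b) (c , d) =
    ℚ.≤-trans a (ℚ.≤-trans (ℚ.+-monoˡ-≤ e c)
      (ℚ.≤-reflexive (solve 3 (λ z e e′ → (z :+ e′) :+ e := z :+ (e :+ e′)) refl z e e′))) ,
    ℚ.≤-trans d (ℚ.≤-trans (ℚ.+-monoˡ-≤ e′ b)
      (ℚ.≤-reflexive (solve 3 (λ x e e′ → (x :+ e) :+ e′ := x :+ (e :+ e′)) refl x e e′)))

  near-+ : ∀ {e e′ x y x′ y′} → Near e x y → Near e′ x′ y′ → Near (e +ℚ e′) (x +ℚ x′) (y +ℚ y′)
  near-+ {e} {e′} {x} {y} {x′} {y′} (a , b) (c , d) = combine y y′ a c , combine x x′ b d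
    where
    combine : ∀ {u u′} y y′ → u ≤ℚ y +ℚ e → u′ ≤ℚ y′ +ℚ e′ → u +ℚ u′ ≤ℚ y +ℚ y′ +ℚ (e +ℚ e′)
    combine y y′ p p′ = ℚ.≤-trans (ℚ.+-mono-≤ p p′)
      (ℚ.≤-reflexive (solve 4 (λ y y′ e e′ → (y :+ e) :+ (y′ :+ e′) := (y :+ y′) :+ (e :+ e′)) refl y y′ e e′))

  near-* : ∀ {e x y z} → 0ℚ ≤ℚ z → Near e x y → Near (e *ℚ z) (x *ℚ z) (y *ℚ z)
  near-* {e} {x} {y} {z} 0≤z (a , b) = scale y a , scale x b
    where
    scale : ∀ {u} y → u ≤ℚ y +ℚ e → u *ℚ z ≤ℚ y *ℚ z +ℚ e *ℚ z
    scale y p = ℚ.≤-trans (*-monoʳ 0≤z p) (ℚ.≤-reflexive (ℚ.*-distribʳ-+ z y e))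

  near-interval : ∀ {e x y} → 0ℚ ≤ℚ x → x ≤ℚ e → 0ℚ ≤ℚ y → y ≤ℚ e → Near e x y
  near-interval {e} {x} {y} 0≤x x≤e 0≤y y≤e = half 0≤y x≤e , half 0≤x y≤e
    where
    half : ∀ {x y} → 0ℚ ≤ℚ y → x ≤ℚ e → x ≤ℚ y +ℚ e
    half {y = y} 0≤y x≤e = ℚ.≤-trans x≤e (ℚ.≤-trans (x≤x+ e 0≤y) (ℚ.≤-reflexive (ℚ.+-comm e y)))

  near⇒∣-∣≤ : ∀ {e x y} → Near e x y → ℚ.∣ x -ℚ y ∣ ≤ℚ e
  near⇒∣-∣≤ {e} {x} {y} (a , b) with ℚ.∣p∣≡p∨∣p∣≡-p (x -ℚ y)
  ... | inj₁ eq = ℚ.≤-trans (ℚ.≤-reflexive eq) (ℚ.≤-trans (ℚ.+-monoˡ-≤ (-ℚ y) a)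
        (ℚ.≤-reflexive (solve 2 (λ y e → (y :+ e) :- y := e) refl y e)))
  ... | inj₂ eq = ℚ.≤-trans (ℚ.≤-reflexive (trans eq (solve 2 (λ x y → :- (x :- y) := y :- x) refl x y)))
        (ℚ.≤-trans (ℚ.+-monoˡ-≤ (-ℚ x) b) (ℚ.≤-reflexive (solve 2 (λ x e → (x :+ e) :- x := e) refl x e)))

  sumℚ : (ℕ → ℚ) → ℕ → ℚ
  sumℚ f zero    = 0ℚ
  sumℚ f (suc N) = sumℚ f N +ℚ f N

  sumℚ-+ : ∀ f g N → sumℚ (λ i → f i +ℚ g i) N ≡ sumℚ f N +ℚ sumℚ g N
  sumℚ-+ f g zero    = refl
  sumℚ-+ f g (suc N) = trans (cong (_+ℚ (f N +ℚ g N)) (sumℚ-+ f g N))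
    (solve 4 (λ a b c d → (a :+ b) :+ (c :+ d) := (a :+ c) :+ (b :+ d)) refl (sumℚ f N) (sumℚ g N) (f N) (g N))

  sumℚ-mono : ∀ {f g} N → (∀ i → i < N → f i ≤ℚ g i) → sumℚ f N ≤ℚ sumℚ g N
  sumℚ-mono zero    le = ℚ.≤-refl
  sumℚ-mono (suc N) le = ℚ.+-mono-≤ (sumℚ-mono N (λ i i<N → le i (m≤n⇒m≤1+n i<N))) (le N ≤-refl)

  sumℚ-nonNeg : ∀ {f} N → (∀ i → 0ℚ ≤ℚ f i) → 0ℚ ≤ℚ sumℚ f N
  sumℚ-nonNeg zero    nn = ℚ.≤-refl
  sumℚ-nonNeg (suc N) nn = ℚ.+-mono-≤ (sumℚ-nonNeg N nn) (nn N)

  sumℚ-* : ∀ f c N → sumℚ (λ i → f i *ℚ c) N ≡ sumℚ f N *ℚ c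
  sumℚ-* f c zero    = sym (ℚ.*-zeroˡ c)
  sumℚ-* f c (suc N) = trans (cong (_+ℚ f N *ℚ c) (sumℚ-* f c N)) (sym (ℚ.*-distribʳ-+ c (sumℚ f N) (f N)))

  sumℚ-swap : ∀ (f : ℕ → ℕ → ℚ) M N → sumℚ (λ i → sumℚ (f i) N) M ≡ sumℚ (λ j → sumℚ (λ i → f i j) M) N
  sumℚ-swap f zero    N = sym (sum-0 N)
    where
    sum-0 : ∀ N → sumℚ (λ _ → 0ℚ) N ≡ 0ℚ
    sum-0 zero    = refl
    sum-0 (suc N) = cong (_+ℚ 0ℚ) (sum-0 N)
  sumℚ-swap f (suc M) N = trans (cong (_+ℚ sumℚ (f M) N) (sumℚ-swap f M N))
    (sym (sumℚ-+ (λ j → sumℚ (λ i → f i j) M) (f M) N))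

  sumℚ-extend : ∀ {f} → (∀ i → 0ℚ ≤ℚ f i) → ∀ {M N} → M ≤ N → sumℚ f M ≤ℚ sumℚ f N
  sumℚ-extend {f} nn {M} {N} M≤N = go (≤⇒≤′ M≤N)
    where
    go : ∀ {N} → M ≤′ N → sumℚ f M ≤ℚ sumℚ f N
    go ≤′-refl = ℚ.≤-refl
    go (≤′-step {N} le) = ℚ.≤-trans (go le) (x≤x+ (sumℚ f N) (nn N))

  ι-sum : ∀ f N → ι (sumTo f N) ≡ sumℚ (ι ∘ f) N
  ι-sum f zero    = ι-0
  ι-sum f (suc N) = trans (ι-+ (sumTo f N) (f N)) (cong (_+ℚ ι (f N)) (ι-sum f N))

  near-sum : ∀ {w f g} N → (∀ i → i < N → Near (w i) (f i) (g i)) → Near (sumℚ w N) (sumℚ f N) (sumℚ g N)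
  near-sum zero    near = near-refl ℚ.≤-refl
  near-sum (suc N) near = near-+ (near-sum N (λ i i<N → near i (m≤n⇒m≤1+n i<N))) (near N ≤-refl)

-- Mean values of limit-periodic sequences.

module MeanValues where
  open Estimates
  open +-*-Solver using (solve; _:=_; _:+_; :-_)
  open ℚ.≤-Reasoning

  abstract
    halve : ∀ {ε} → 0ℚ <ℚ ε → ∃ λ δ → 0ℚ <ℚ δ × δ +ℚ δ ≡ ε
    halve {ε} 0<ε = ℚ.½ *ℚ ε , 0<* (ℚ.positive⁻¹ ℚ.½) 0<ε ,
      trans (sym (ℚ.*-distribʳ-+ ε ℚ.½ ℚ.½)) (ℚ.*-identityˡ ε)

  Eventually : (ℕ → Set) → Set
  Eventually P = ∃ λ K → ∀ j → K ≤ j → P j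

  both : {P Q : ℕ → Set} → Eventually P → Eventually Q → Eventually (λ j → P j × Q j)
  both (K , p) (L , q) = K ⊔ L , λ j le → p j (m⊔n≤o⇒m≤o K L le) , q j (m⊔n≤o⇒n≤o K L le)

  UnitInterval : ℚ → Set
  UnitInterval x = 0ℚ ≤ℚ x × x ≤ℚ 1ℚ

  sum-≤ : ∀ {f} → (∀ i → UnitInterval (f i)) → ∀ N → sumℚ f N ≤ℚ ι N
  sum-≤ bounds zero    = 0≤ι 0
  sum-≤ {f} bounds (suc N) = begin
    sumℚ f N +ℚ f N      ≤⟨ ℚ.+-mono-≤ (sum-≤ bounds N) (proj₂ (bounds N)) ⟩
    ι N +ℚ 1ℚ            ≡⟨ cong (ι N +ℚ_) ι-1 ⟨
    ι N +ℚ ι 1           ≡⟨ ι-+ N 1 ⟨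
    ι (N + 1)            ≡⟨ cong ι (+-comm N 1) ⟩
    ι (suc N)            ∎

  ι-suc : ∀ N → ι (suc N) ≡ ι N +ℚ 1ℚ
  ι-suc N = trans (cong ι (+-comm 1 N)) (trans (ι-+ N 1) (cong (ι N +ℚ_) ι-1))

  module Periodic (b : ℕ → ℚ) (M : ℕ) (1≤M : 1 ≤ M) (bounds : ∀ i → UnitInterval (b i))
                  (b-periodic : ∀ i → b (M + i) ≡ b i) where

    mean : ℚ
    mean = sumℚ b M ÷ ι M

    0≤mean : 0ℚ ≤ℚ mean
    0≤mean = 0≤÷ (sumℚ-nonNeg M (proj₁ ∘ bounds)) (0<ι 1≤M)

    mean≤1 : mean ≤ℚ 1ℚ
    mean≤1 = ≤⇒÷≤ (0<ι 1≤M) (ℚ.≤-trans (sum-≤ bounds M) (ℚ.≤-reflexive (sym (ℚ.*-identityˡ (ι M)))))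

    sum-block : ∀ N → sumℚ b (M + N) ≡ sumℚ b M +ℚ sumℚ b N
    sum-block zero    = trans (cong (sumℚ b) (+-identityʳ M)) (sym (ℚ.+-identityʳ _))
    sum-block (suc N) = trans (cong (sumℚ b) (+-suc M N)) (trans (cong₂ _+ℚ_ (sum-block N) (b-periodic N))
      (ℚ.+-assoc (sumℚ b M) (sumℚ b N) (b N)))

    near-mean-short : ∀ {N} → N ≤ M → Near (ι M) (sumℚ b N) (mean *ℚ ι N)
    near-mean-short {N} N≤M = near-interval (sumℚ-nonNeg N (proj₁ ∘ bounds))
      (ℚ.≤-trans (sum-≤ bounds N) (ι-mono N≤M)) (0≤* 0≤mean (0≤ι N)) (begin
        mean *ℚ ι N    ≤⟨ *-monoʳ (0≤ι N) mean≤1 ⟩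
        1ℚ *ℚ ι N      ≡⟨ ℚ.*-identityˡ (ι N) ⟩
        ι N            ≤⟨ ι-mono N≤M ⟩
        ι M            ∎)

    -- A full block contributes exactly `mean *ℚ ι M`, so the error comes from the incomplete block
    -- only.
    near-mean-blocks : ∀ s {t} → t ≤ M → Near (ι M) (sumℚ b (s * M + t)) (mean *ℚ ι (s * M + t))
    near-mean-blocks zero    t≤M = near-mean-short t≤M
    near-mean-blocks (suc s) {t} t≤M = subst₂ (Near (ι M))
      (sym (trans (cong (sumℚ b) (+-assoc M (s * M) t)) (sum-block L)))
      (begin-equality
        sumℚ b M +ℚ mean *ℚ ι L          ≡⟨ cong (_+ℚ mean *ℚ ι L) (÷-*-cancel (sumℚ b M) (0<ι 1≤M)) ⟨
        mean *ℚ ι M +ℚ mean *ℚ ι L       ≡⟨ ℚ.*-distribˡ-+ mean (ι M) (ι L) ⟨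
        mean *ℚ (ι M +ℚ ι L)             ≡⟨ cong (mean *ℚ_) (ι-+ M L) ⟨
        mean *ℚ ι (M + L)                ≡⟨ cong (λ k → mean *ℚ ι k) (+-assoc M (s * M) t) ⟨
        mean *ℚ ι (M + s * M + t)        ∎)
      (subst (λ e → Near e (sumℚ b M +ℚ sumℚ b L) (sumℚ b M +ℚ mean *ℚ ι L)) (ℚ.+-identityˡ (ι M))
        (near-+ (near-refl {x = sumℚ b M} ℚ.≤-refl) (near-mean-blocks s t≤M)))
      where L = s * M + t

    near-mean : ∀ N → Near (ι M) (sumℚ b N) (mean *ℚ ι N)
    near-mean N = subst (λ k → Near (ι M) (sumℚ b k) (mean *ℚ ι k))
      (trans (+-comm (N / M * M) (N % M)) (sym (m≡m%n+[m/n]*n N M)))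
      (near-mean-blocks (N / M) (<⇒≤ (m%n<n N M)))
      where
      instance
        M≢0 : NonZero M
        M≢0 = >-nonZero 1≤M

  -- Approximation in mean: single terms may be far apart, as the weights `w` are bounded only in
  -- sum. They may depend on `N`, which later admits error series truncated at `N`.
  LimitPeriodic : (ℕ → ℚ) → Set
  LimitPeriodic a = ∀ {δ} → 0ℚ <ℚ δ → ∃ λ M → 1 ≤ M × ∃ λ (b : ℕ → ℚ) →
    (∀ i → UnitInterval (b i)) × (∀ i → b (M + i) ≡ b i) ×
    (∀ N → ∃ λ w → (∀ i → i < N → Near (w i) (a i) (b i)) × sumℚ w N ≤ℚ δ *ℚ ι N)

  module _ (a : ℕ → ℚ) (bounds : ∀ i → UnitInterval (a i)) (limit-periodic : LimitPeriodic a) where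

    average : ℕ → ℚ
    average j = sumℚ a (suc j) ÷ ι (suc j)

    0≤average : ∀ j → 0ℚ ≤ℚ average j
    0≤average j = 0≤÷ (sumℚ-nonNeg (suc j) (proj₁ ∘ bounds)) (0<ι {suc j} (s≤s z≤n))

    -- `ρ` is the mean of the periodic approximation `b`. Replacing `a` by `b` costs at most `δ` in
    -- mean; the incomplete period costs `M` over the number of terms, at most `δ` once there are
    -- enough terms. Since `ρ` varies with `ε`, this gives the Cauchy property and not yet a limit.
    average-settles : ∀ {ε} → 0ℚ <ℚ ε → ∃₂ λ ρ N → ∀ j → N ≤ j → Near ε (average j) ρ
    average-settles {ε} 0<ε =
      let δ , 0<δ , δ+δ≡ε = halve 0<ε
          M , 1≤M , b , b-bounds , b-periodic , close = limit-periodic 0<δ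
          D , M≤δ* = archimedean-* 0<δ M
          open Periodic b M 1≤M b-bounds b-periodic
      in mean , D , λ j D≤j →
        let w , near , sum-w = close (suc j)
        in settle {δ} δ+δ≡ε j 1≤M sum-w (M≤δ* (m≤n⇒m≤1+n D≤j))
             (near-trans (near-sum (suc j) near) (near-mean (suc j)))
      where
      settle : ∀ {δ} → δ +ℚ δ ≡ ε → ∀ j {M w mean} → 1 ≤ M → w ≤ℚ δ *ℚ ι (suc j) → ι M ≤ℚ δ *ℚ ι (suc j) →
               Near (w +ℚ ι M) (sumℚ a (suc j)) (mean *ℚ ι (suc j)) → Near ε (average j) mean
      settle {δ} δ+δ≡ε j {M} {w} {mean} 1≤M w≤ M≤ near =
        subst₂ (λ e ρ → Near e (average j) ρ) (*-÷-cancel ε 0<n) (*-÷-cancel mean 0<n)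
          (near-* (ℚ.<⇒≤ (0<recip 0<n)) (near-mono (begin
            w +ℚ ι M                                    ≤⟨ ℚ.+-mono-≤ w≤ M≤ ⟩
            δ *ℚ ι (suc j) +ℚ δ *ℚ ι (suc j)            ≡⟨ ℚ.*-distribʳ-+ (ι (suc j)) δ δ ⟨
            (δ +ℚ δ) *ℚ ι (suc j)                       ≡⟨ cong (_*ℚ ι (suc j)) δ+δ≡ε ⟩
            ε *ℚ ι (suc j)                              ∎) near))
        where 0<n = 0<ι {suc j} (s≤s z≤n)

    average-near : ∀ {ε} → 0ℚ <ℚ ε → ∃ λ N → ∀ i j → N ≤ i → N ≤ j → Near ε (average i) (average j)
    average-near {ε} 0<ε =
      let δ , 0<δ , δ+δ≡ε = halve 0<ε
          ρ , N , near = average-settles 0<δ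
      in N , λ i j N≤i N≤j → subst (λ e → Near e (average i) (average j)) δ+δ≡ε
           (near-trans (near i N≤i) (near-sym (near j N≤j)))

    average-cauchy : IsCauchy average
    average-cauchy ε 0<ε =
      let δ , 0<δ , δ+δ≡ε = halve 0<ε
          N , near = average-near 0<δ
      in N , λ i j N≤i N≤j → ℚ.≤-<-trans (near⇒∣-∣≤ (near i j N≤i N≤j)) (half< 0<δ δ+δ≡ε)
      where
      half< : ∀ {δ} → 0ℚ <ℚ δ → δ +ℚ δ ≡ ε → δ <ℚ ε
      half< {δ} 0<δ δ+δ≡ε = begin-strict
        δ                                ≡⟨ ℚ.+-identityˡ δ ⟨
        0ℚ +ℚ δ                          <⟨ ℚ.+-monoˡ-< δ 0<δ ⟩
        δ +ℚ δ                           ≡⟨ δ+δ≡ε ⟩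
        ε                                ∎

    -- The averages themselves are the Cauchy sequence that represents the limit.
    limit : ℝ
    limit = mkℝ average average-cauchy

    limit-nonNeg : 0ᴿ ≤ᴿ limit
    limit-nonNeg ε 0<ε = 0 , λ n _ → ℚ.≤-trans (0≤average n) (x≤x+ (average n) (ℚ.<⇒≤ 0<ε))

    ι-cancel-≤ : ∀ {m n} → ι m ≤ℚ ι n → m ≤ n
    ι-cancel-≤ {m} {n} le = ≮⇒≥ λ n<m → ℚ.<-irrefl refl (begin-strict
      ι n                  ≡⟨ ℚ.+-identityʳ (ι n) ⟨
      ι n +ℚ 0ℚ            <⟨ ℚ.+-monoʳ-< (ι n) 0<1 ⟩
      ι n +ℚ 1ℚ            ≡⟨ ι-suc n ⟨
      ι (suc n)            ≤⟨ ι-mono n<m ⟩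
      ι m                  ≤⟨ le ⟩
      ι n                  ∎)

    -- Dividing a sum of j + 1 terms by some t with j ≤ t ≤ j + 2 instead of
    -- by j + 1 changes the result by at most 1 / t.
    near-average : ∀ {δ t} j → 0ℚ <ℚ t → ι j ≤ℚ t → t ≤ℚ ι (suc (suc j)) → 1ℚ ≤ℚ δ *ℚ t →
                   Near δ (recip t *ℚ sumℚ a (suc j)) (average j)
    near-average {δ} {t} j 0<t j≤t t≤j+2 1≤δt =
      *-cancelʳ 0<t (begin
        recip t *ℚ x *ℚ t            ≡⟨ recip-t ⟩
        x                            ≡⟨ y*n≡x ⟨
        y *ℚ ι (suc j)               ≡⟨ cong (y *ℚ_) (ι-suc j) ⟩
        y *ℚ (ι j +ℚ 1ℚ)             ≡⟨ trans (ℚ.*-distribˡ-+ y (ι j) 1ℚ) (cong (y *ℚ ι j +ℚ_) (ℚ.*-identityʳ y)) ⟩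
        y *ℚ ι j +ℚ y                ≤⟨ ℚ.+-mono-≤ (*-monoˡ 0≤y j≤t) (ℚ.≤-trans y≤1 1≤δt) ⟩
        y *ℚ t +ℚ δ *ℚ t             ≡⟨ ℚ.*-distribʳ-+ t y δ ⟨
        (y +ℚ δ) *ℚ t                ∎) ,
      *-cancelʳ 0<t (begin
        y *ℚ t                       ≤⟨ *-monoˡ 0≤y t≤j+2 ⟩
        y *ℚ ι (suc (suc j))         ≡⟨ cong (y *ℚ_) (ι-suc (suc j)) ⟩
        y *ℚ (ι (suc j) +ℚ 1ℚ)       ≡⟨ trans (ℚ.*-distribˡ-+ y (ι (suc j)) 1ℚ) (cong₂ _+ℚ_ y*n≡x (ℚ.*-identityʳ y)) ⟩
        x +ℚ y                       ≤⟨ ℚ.+-monoʳ-≤ x (ℚ.≤-trans y≤1 1≤δt) ⟩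
        x +ℚ δ *ℚ t                  ≡⟨ cong (_+ℚ δ *ℚ t) recip-t ⟨
        recip t *ℚ x *ℚ t +ℚ δ *ℚ t  ≡⟨ ℚ.*-distribʳ-+ t (recip t *ℚ x) δ ⟨
        (recip t *ℚ x +ℚ δ) *ℚ t     ∎)
      where
      x = sumℚ a (suc j)
      y = average j
      0<n = 0<ι {suc j} (s≤s z≤n)
      0≤y : 0ℚ ≤ℚ y
      0≤y = 0≤average j
      y≤1 : y ≤ℚ 1ℚ
      y≤1 = ≤⇒÷≤ 0<n (ℚ.≤-trans (sum-≤ bounds (suc j)) (ℚ.≤-reflexive (sym (ℚ.*-identityˡ (ι (suc j))))))
      y*n≡x : y *ℚ ι (suc j) ≡ x
      y*n≡x = ÷-*-cancel x 0<n
      recip-t : recip t *ℚ x *ℚ t ≡ x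
      recip-t = trans (cong (_*ℚ t) (ℚ.*-comm (recip t) x)) (÷-*-cancel x 0<t)

    module _ (f : ∀ n → .⦃ NonZero n ⦄ → ℚ) (f≡a : ∀ i → f (suc i) ≡ a i) where

      partialSum≡ : ∀ N → partialSum f N ≡ sumℚ a N
      partialSum≡ zero    = refl
      partialSum≡ (suc N) = cong₂ _+ℚ_ (partialSum≡ N) (f≡a N)

      -- Reals are compared termwise from some index `j` on. Dividing by the rational term of `t`
      -- costs `δ` by `near-average`, passing to `average j` costs another `δ`, and `η` is the gap
      -- that the strict inequality demands; `δ + δ + η` is `ε₀`.
      limit-isMean : HasMeanValue f limit
      limit-isMean ε (ε₀ , 0<ε₀ , K , ε₀≤ε) =
        -- The lower bound on `t` is used with tolerance 1, and `t` is below N + 1; so 3 + (N₀ ⊔ D)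
        -- is at most N + 2. Hence `N` is a successor whose predecessor passes both thresholds.
        fromℕ (3 + (N₀ ⊔ D)) , λ t 0<t T≤t N floor → bound t 0<t N floor (via-ι (3 + (N₀ ⊔ D)) (T≤t 1ℚ 0<1)) (via-ι N (proj₁ floor 1ℚ 0<1))
        where
        half₁ = halve 0<ε₀
        η = proj₁ half₁
        0<η = proj₁ (proj₂ half₁)
        η+η≡ε₀ = proj₂ (proj₂ half₁)
        half₂ = halve 0<η
        δ = proj₁ half₂
        0<δ = proj₁ (proj₂ half₂)
        δ+δ≡η = proj₂ (proj₂ half₂)
        N₀ = proj₁ (average-near 0<δ)
        near = proj₂ (average-near 0<δ)
        D = proj₁ (archimedean-* 0<δ 1)
        1≤δ* = proj₂ (archimedean-* 0<δ 1)
        via-ι : ∀ n {x : ℕ → ℚ} → Eventually (λ j → ℤ.+ n ℚ./ 1 ≤ℚ x j) → Eventually (λ j → ι n ≤ℚ x j)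
        via-ι n (K , le) = K , λ j K≤j → ℚ.≤-trans (ℚ.≤-reflexive (ι-def n)) (le j K≤j)
        bound : ∀ t (0<t : 0ᴿ <ᴿ t) N → IsFloor N t →
                Eventually (λ j → ι (3 + (N₀ ⊔ D)) ≤ℚ seq t j +ℚ 1ℚ) → Eventually (λ j → ι N ≤ℚ seq t j +ℚ 1ℚ) →
                ∣ inverse t 0<t *ᴿ fromℚ (partialSum f N) -ᴿ limit ∣ᴿ <ᴿ ε
        bound t (ζ , 0<ζ , K₁ , ζ≤t) N (N≤t , ξ , 0<ξ , K₂ , t≤1+N) T≤t+1 N≤t+1 = η , 0<η , proj₁ eventually ,
          λ j le → let (0<tⱼ , tⱼ≤) , (T≤ , N≤) , (N₀≤j , K≤j) = proj₂ eventually j le in within N 0<tⱼ tⱼ≤ N≤ T≤ j N₀≤j K≤j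
          where
          positive : Eventually λ j → 0ℚ <ℚ seq t j
          positive = K₁ , λ j K₁≤j → ℚ.<-≤-trans 0<ζ (ℚ.≤-trans (ℚ.≤-reflexive (sym (ℚ.+-identityˡ ζ))) (ζ≤t j K₁≤j))

          above : Eventually λ j → seq t j ≤ℚ ι (suc N)
          above = K₂ , λ j K₂≤j → ℚ.≤-trans (x≤x+ (seq t j) (ℚ.<⇒≤ 0<ξ)) (ℚ.≤-trans (t≤1+N j K₂≤j) (ℚ.≤-reflexive (sym (ι-def (suc N)))))

          eventually = both (both positive above) (both (both T≤t+1 N≤t+1) (both (N₀ , λ _ → id) (K , λ _ → id)))

          within : ∀ N {tⱼ} → 0ℚ <ℚ tⱼ → tⱼ ≤ℚ ι (suc N) → ι N ≤ℚ tⱼ +ℚ 1ℚ → ι (3 + (N₀ ⊔ D)) ≤ℚ tⱼ +ℚ 1ℚ →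
                   ∀ j → N₀ ≤ j → K ≤ j → ℚ.∣ recip tⱼ *ℚ partialSum f N -ℚ average j ∣ +ℚ η ≤ℚ seq ε j
          within N {tⱼ} 0<tⱼ tⱼ≤ N≤ T≤ j N₀≤j K≤j = go N tⱼ≤ N≤ large
            where
            large : suc (N₀ ⊔ D) ≤ N
            large = ≤-pred (≤-pred (ι-cancel-≤ {3 + (N₀ ⊔ D)} {suc (suc N)} (begin
              ι (3 + (N₀ ⊔ D))       ≤⟨ T≤ ⟩
              tⱼ +ℚ 1ℚ               ≤⟨ ℚ.+-monoˡ-≤ 1ℚ tⱼ≤ ⟩
              ι (suc N) +ℚ 1ℚ        ≡⟨ ι-suc (suc N) ⟨
              ι (suc (suc N))        ∎)))
            go : ∀ N → tⱼ ≤ℚ ι (suc N) → ι N ≤ℚ tⱼ +ℚ 1ℚ → suc (N₀ ⊔ D) ≤ N →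
                 ℚ.∣ recip tⱼ *ℚ partialSum f N -ℚ average j ∣ +ℚ η ≤ℚ seq ε j
            go (suc i) tⱼ≤ N≤ (s≤s large) = begin
              ℚ.∣ recip tⱼ *ℚ partialSum f (suc i) -ℚ average j ∣ +ℚ η
                ≡⟨ cong (λ x → ℚ.∣ recip tⱼ *ℚ x -ℚ average j ∣ +ℚ η) (partialSum≡ (suc i)) ⟩
              ℚ.∣ recip tⱼ *ℚ sumℚ a (suc i) -ℚ average j ∣ +ℚ η
                ≤⟨ ℚ.+-monoˡ-≤ η (near⇒∣-∣≤ (near-trans (near-average {δ} {tⱼ} i 0<tⱼ i≤tⱼ tⱼ≤ 1≤δtⱼ)
                     (near i j (≤-trans (m≤m⊔n N₀ D) large) N₀≤j))) ⟩
              δ +ℚ δ +ℚ η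
                ≡⟨ trans (cong (_+ℚ η) δ+δ≡η) η+η≡ε₀ ⟩
              ε₀
                ≡⟨ ℚ.+-identityˡ ε₀ ⟨
              0ℚ +ℚ ε₀
                ≤⟨ ε₀≤ε j K≤j ⟩
              seq ε j ∎
              where
              i≤tⱼ : ι i ≤ℚ tⱼ
              i≤tⱼ = begin
                ι i                       ≡⟨ solve 2 (λ x y → x := (x :+ y) :+ (:- y)) refl (ι i) 1ℚ ⟩
                ι i +ℚ 1ℚ +ℚ -ℚ 1ℚ        ≡⟨ cong (_+ℚ -ℚ 1ℚ) (ι-suc i) ⟨
                ι (suc i) +ℚ -ℚ 1ℚ        ≤⟨ ℚ.+-monoˡ-≤ (-ℚ 1ℚ) N≤ ⟩
                tⱼ +ℚ 1ℚ +ℚ -ℚ 1ℚ         ≡⟨ solve 2 (λ x y → (x :+ y) :+ (:- y) := x) refl tⱼ 1ℚ ⟩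
                tⱼ                        ∎
              1≤δtⱼ : 1ℚ ≤ℚ δ *ℚ tⱼ
              1≤δtⱼ = ℚ.≤-trans (ℚ.≤-trans (ℚ.≤-reflexive (sym ι-1)) (1≤δ* (≤-trans (m≤n⊔m N₀ D) large))) (*-monoˡ (ℚ.<⇒≤ 0<δ) i≤tⱼ)

  mean-value : (a : ℕ → ℚ) → (∀ i → UnitInterval (a i)) → LimitPeriodic a →
               (f : ∀ n → .⦃ NonZero n ⦄ → ℚ) → (∀ i → f (suc i) ≡ a i) →
               ∃ λ (L : ℝ) → 0ᴿ ≤ᴿ L × HasMeanValue f L
  mean-value a bounds lp f f≡a = limit a bounds lp , limit-nonNeg a bounds lp , limit-isMean a bounds lp f f≡a

-- Periodic approximation of the density of k-normal elements.

coprime-power : ∀ {p r} → Prime p → ¬ p ∣ r → ∀ e → Coprime r (p ^ e)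
coprime-power pr p∤r zero    (_ , d∣1) = ∣1⇒≡1 d∣1
coprime-power {p} pr p∤r (suc e) {d} (d∣r , d∣pp) =
  coprime-power pr p∤r e (d∣r , coprime-divisor d-p d∣pp)
  where
  d-p : Coprime d p
  d-p (c∣d , c∣p) with prime⇒irreducible pr c∣p
  ... | inj₁ c≡1  = c≡1
  ... | inj₂ refl = contradiction (∣-trans c∣d d∣r) p∤r

≤⇒∣! : ∀ {x y} → 1 ≤ x → x ≤ y → x ∣ y !
≤⇒∣! {suc x} _ x≤y = ∣-trans (m∣m*n (x !)) (m≤n⇒m!∣n! x≤y)

gcd-periodic : ∀ M m → gcd (M + m) M ≡ gcd m M
gcd-periodic M m = ∣-antisym
  (gcd-greatest (∣m+n∣m⇒∣n (gcd[m,n]∣m (M + m) M) (gcd[m,n]∣n (M + m) M)) (gcd[m,n]∣n (M + m) M))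
  (gcd-greatest (∣m∣n⇒∣m+n (gcd[m,n]∣n m M) (gcd[m,n]∣m m M)) (gcd[m,n]∣n m M))

-- If p^J divides M but not n, then gcd n M contains the full power of p
-- dividing n.
cofactor-prime-to : ∀ {p} → Prime p → ∀ {J M n r d} → p ^ J ∣ M → ¬ p ^ J ∣ n → n ≡ r * d → 1 ≤ d → d ≡ gcd n M → ¬ p ∣ r
cofactor-prime-to {p} pr {J} {M} {n} {r} {d@(suc d′)} pJ∣M pJ∤n n≡rd _ d≡ p∣r
  with subst (_∣ M) (sym d≡) (gcd[m,n]∣n n M)
... | divides s M≡sd = pJ∤n (∣-trans
  (coprime-divisor (λ (c∣p , c∣s) → coprime-power pr p∤s J (c∣s , c∣p)) (subst (p ^ J ∣_) M≡sd pJ∣M))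
  (divides r n≡rd))
  where
  p∤s : ¬ p ∣ s
  -- If `p` divided both cofactors `r` and `s`, then `p * d` would divide the gcd, which is `d`.
  p∤s p∣s = nonTrivial⇒≢1 {{prime⇒nonTrivial pr}} (∣1⇒≡1 (*-cancelʳ-∣ d (subst (p * d ∣_) (sym (*-identityˡ d))
    (subst (p * d ∣_) (sym d≡) (gcd-greatest
      (subst (p * d ∣_) (sym n≡rd) (*-monoˡ-∣ d p∣r))
      (subst (p * d ∣_) (sym M≡sd) (*-monoˡ-∣ d p∣s)))))))

error-coefficient : ∀ q N → 4 * (q * (2 * N)) + N ≡ (8 * q + 1) * N
error-coefficient = solve 2 (λ q N → con 4 :* (q :* (con 2 :* N)) :+ N := (con 8 :* q :+ con 1) :* N) refl
  where open ℕSolver.+-*-Solver using (solve; con; _:*_; _:+_; _:=_)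

module Density {q p e : ℕ} (p-prime : Prime p) (q≡p^e : q ≡ p ^ e) (F : FieldOn q) (k : ℕ) where
  open FieldOn F using () renaming (1<N to 1<q)
  open Estimates
  open MeanValues
  open +-*-Solver using (solve; _:=_; _:+_)
  open ℚ.≤-Reasoning

  -- The density of k-normal elements in degree i + 1.
  density : ℕ → ℚ
  density i = ι (normals F i k) ÷ ι (q ^ suc i)

  private
    instance
      q≢0 : NonZero q
      q≢0 = >-nonZero (<-trans (s≤s z≤n) 1<q)
      p≢0 : NonZero p
      p≢0 = prime⇒nonZero p-prime

  0<q^ : ∀ m → 0ℚ <ℚ ι (q ^ m)
  0<q^ m = 0<ι (m^n>0 q m)

  normals-≤ : ∀ i → normals F i k ≤ q ^ suc i
  normals-≤ i = #≤size {finX = finVec {q} (suc i)} {finY = finVec {q} (suc i)} (DegreeComplement? F i k) (λ c _ → c) (λ _ _ → id)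

  bounds : ∀ i → UnitInterval (density i)
  bounds i = 0≤÷ (0≤ι (normals F i k)) (0<q^ (suc i)) ,
    ≤⇒÷≤ (0<q^ (suc i)) (ℚ.≤-trans (ι-mono (normals-≤ i)) (ℚ.≤-reflexive (sym (ℚ.*-identityˡ _))))

  fraction-≤ : ∀ {x y x′ y′} → 1 ≤ y → 1 ≤ y′ → x * y′ ≤ x′ * y → ι x ÷ ι y ≤ℚ ι x′ ÷ ι y′
  fraction-≤ {x} {y} {x′} {y′} 1≤y 1≤y′ le = ≤⇒÷≤ {ι x} {ι y} {ι x′ ÷ ι y′} (0<ι 1≤y)
    (*-cancelʳ {ι x} {ι x′ ÷ ι y′ *ℚ ι y} {ι y′} (0<ι 1≤y′) (begin
    ι x *ℚ ι y′                       ≡⟨ ι-* x y′ ⟨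
    ι (x * y′)                        ≤⟨ ι-mono le ⟩
    ι (x′ * y)                        ≡⟨ trans (ι-* x′ y) (cong (_*ℚ ι y) (sym (÷-*-cancel (ι x′) (0<ι 1≤y′)))) ⟩
    ι x′ ÷ ι y′ *ℚ ι y′ *ℚ ι y        ≡⟨ trans (ℚ.*-assoc (ι x′ ÷ ι y′) (ι y′) (ι y))
                                           (trans (cong (ι x′ ÷ ι y′ *ℚ_) (ℚ.*-comm (ι y′) (ι y))) (sym (ℚ.*-assoc (ι x′ ÷ ι y′) (ι y) (ι y′)))) ⟩
    ι x′ ÷ ι y′ *ℚ ι y *ℚ ι y′        ∎))

  fraction-≡ : ∀ {x y x′ y′} → 1 ≤ y → 1 ≤ y′ → x * y′ ≡ x′ * y → ι x ÷ ι y ≡ ι x′ ÷ ι y′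
  fraction-≡ 1≤y 1≤y′ eq = ℚ.≤-antisym (fraction-≤ 1≤y 1≤y′ (≤-reflexive eq)) (fraction-≤ 1≤y′ 1≤y (≤-reflexive (sym eq)))

  module Approximation (J : ℕ) (1≤J : 1 ≤ J) where

    -- Every `q ^ m ∸ 1` with 1 ≤ m < 2J divides the factorial, whence gcd(n, q^m - 1) divides
    -- gcd(n, M). The factor `p ^ J` is what `cofactor-prime-to` asks for.
    modulus : ℕ
    modulus = p ^ J * (q ^ (2 * J)) !

    1≤modulus : 1 ≤ modulus
    1≤modulus = *-mono-≤ (m^n>0 p J) (1≤n! (q ^ (2 * J)))

    -- In degree `i + 1`, bounds the fraction of elements killed by simple submodules of dimension
    -- `2 * J + j`: the bound on their number, times the fraction killed by each.
    simpleBound : ℕ → ℕ → ℚ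
    simpleBound i j = ι (q * gcd (suc i) (q ^ (2 * J + j) ∸ 1)) ÷ ι (q ^ (2 * J + j))

    simpleError : ℕ → ℕ → ℚ
    simpleError N i = sumℚ (simpleBound i) N

    0≤simpleBound : ∀ i j → 0ℚ ≤ℚ simpleBound i j
    0≤simpleBound i j = 0≤÷ (0≤ι _) (0<q^ (2 * J + j))

    near-divisor : ∀ d′ r′ → let n′ = d′ + r′ * suc d′ in suc d′ ≡ gcd (suc n′) modulus → ¬ p ^ J ∣ suc n′ →
                   Near (simpleError (suc n′) n′) (density n′) (density d′)
    near-divisor d′ r′ d≡ pJ∤n = near-mono error≤ (subst (Near (ι B ÷ ι (q ^ n)) (density n′)) density-d
      (near-* {ι B} {ι (normals F n′ k)} {ι (normals F d′ k * q ^ (r′ * d))} (ℚ.<⇒≤ (0<recip (0<q^ n))) (near₁ , near₂)))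
      where
      d = suc d′
      n′ = d′ + r′ * d
      n = suc n′
      open Deviation F d′ r′ J 1≤J using (deviation; SmallPeriods)
      r≢0 : natural F (suc r′) ≢ FieldOn.𝟘 F
      r≢0 = FieldProperties.natural-coprime F (subst (Coprime (suc r′)) (sym q≡p^e)
        (coprime-power p-prime (cofactor-prime-to p-prime {J} {modulus} (m∣m*n ((q ^ (2 * J)) !)) pJ∤n refl (s≤s z≤n) d≡) e))
      small : SmallPeriods
      small m 1≤m m<2J = subst (gcd n (q ^ m ∸ 1) ∣_) (sym d≡) (gcd-greatest (gcd[m,n]∣m n (q ^ m ∸ 1))
        (∣-trans (gcd[m,n]∣n n (q ^ m ∸ 1)) (∣-trans (≤⇒∣! 1≤Q Q≤) (n∣m*n (p ^ J)))))
        where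
        1≤Q : 1 ≤ q ^ m ∸ 1
        1≤Q = ∸-monoˡ-≤ 1 (≤-trans 1<q (≤-trans (≤-reflexive (sym (^-identityʳ q))) (^-monoʳ-≤ q 1≤m)))
        Q≤ : q ^ m ∸ 1 ≤ q ^ (2 * J)
        Q≤ = ≤-trans (m∸n≤m (q ^ m) 1) (^-monoʳ-≤ q (<⇒≤ m<2J))
      dev = deviation r≢0 small
      b = proj₁ dev
      B = sumTo b n
      near₁ : ι (normals F n′ k) ≤ℚ ι (normals F d′ k * q ^ (r′ * d)) +ℚ ι B
      near₁ = ℚ.≤-trans (ι-mono (proj₁ (proj₂ (proj₂ dev) k))) (ℚ.≤-reflexive (ι-+ _ B))
      near₂ : ι (normals F d′ k * q ^ (r′ * d)) ≤ℚ ι (normals F n′ k) +ℚ ι B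
      near₂ = ℚ.≤-trans (ι-mono (proj₂ (proj₂ (proj₂ dev) k))) (ℚ.≤-reflexive (ι-+ _ B))
      density-d : ι (normals F d′ k * q ^ (r′ * d)) ÷ ι (q ^ n) ≡ density d′
      density-d = fraction-≡ (m^n>0 q n) (m^n>0 q d) (trans (*-assoc (normals F d′ k) _ _)
        (cong (normals F d′ k *_) (trans (*-comm (q ^ (r′ * d)) (q ^ d)) (sym (^-distribˡ-+-* q d (r′ * d))))))
      error≤ : ι B ÷ ι (q ^ n) ≤ℚ simpleError n n′
      error≤ = begin
        ι B ÷ ι (q ^ n)                            ≡⟨ cong (_÷ ι (q ^ n)) (ι-sum b n) ⟩
        sumℚ (ι ∘ b) n ÷ ι (q ^ n)                 ≡⟨ sumℚ-* (ι ∘ b) (recip (ι (q ^ n))) n ⟨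
        sumℚ (λ j → ι (b j) ÷ ι (q ^ n)) n         ≤⟨ sumℚ-mono n (λ j _ → fraction-≤ (m^n>0 q n) (m^n>0 q (2 * J + j)) (proj₁ (proj₂ dev) j)) ⟩
        simpleError n n′                           ∎

    -- `density` is indexed by the degree minus one, hence `pred`.
    periodic : ℕ → ℚ
    periodic i = density (pred (gcd (suc i) modulus))

    periodic-periodic : ∀ i → periodic (modulus + i) ≡ periodic i
    periodic-periodic i = cong (density ∘ pred) (trans (cong (λ k → gcd k modulus) (sym (+-suc modulus i))) (gcd-periodic modulus (suc i)))

    error : ℕ → ℕ → ℚ
    error N i = simpleError N i +ℚ ι (indicator (p ^ J ∣? suc i))

    near-periodic : ∀ N i → i < N → Near (error N i) (density i) (periodic i)
    near-periodic N i i<N = cases (p ^ J ∣? suc i)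
      where
      cases : (d : Dec (p ^ J ∣ suc i)) → Near (simpleError N i +ℚ ι (indicator d)) (density i) (periodic i)
      cases (yes _) = near-mono (begin
        1ℚ                          ≡⟨ ℚ.+-identityˡ 1ℚ ⟨
        0ℚ +ℚ 1ℚ                    ≤⟨ ℚ.+-monoˡ-≤ 1ℚ (sumℚ-nonNeg N (0≤simpleBound i)) ⟩
        simpleError N i +ℚ 1ℚ       ≡⟨ cong (simpleError N i +ℚ_) ι-1 ⟨
        simpleError N i +ℚ ι 1      ∎)
        (near-interval (proj₁ (bounds i)) (proj₂ (bounds i)) (proj₁ (bounds _)) (proj₂ (bounds _)))
      cases (no pJ∤n) = near-mono {e = simpleError (suc i) i} (begin
        -- Lengthening the sum from `i + 1` to `N` terms gives every `i` the same range, so that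
        -- `error-sum` can exchange the two summations.
        simpleError (suc i) i       ≤⟨ sumℚ-extend (0≤simpleBound i) i<N ⟩
        simpleError N i             ≡⟨ ℚ.+-identityʳ _ ⟨
        simpleError N i +ℚ 0ℚ       ≡⟨ cong (simpleError N i +ℚ_) ι-0 ⟨
        simpleError N i +ℚ ι 0      ∎)
        (factor (gcd (suc i) modulus) refl (gcd[m,n]∣m (suc i) modulus))
        where
        factor : ∀ d → d ≡ gcd (suc i) modulus → d ∣ suc i → Near (simpleError (suc i) i) (density i) (density (pred d))
        factor d        d≡ (divides zero ())
        factor zero     d≡ (divides (suc r′) eq) = contradiction (trans eq (*-zeroʳ (suc r′))) λ ()
        factor (suc d′) d≡ (divides (suc r′) eq) = subst (λ i → Near (simpleError (suc i) i) (density i) (density d′))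
          (sym (suc-injective eq)) (near-divisor d′ r′ (trans d≡ (cong (λ n → gcd n modulus) eq)) (pJ∤n ∘ subst (p ^ J ∣_) (sym eq)))

    halfPower : ℕ → ℕ → ℚ
    halfPower x j = ι x ÷ ι (2 ^ ⌊ 2 * J + j /2⌋)

    halfPower-step : ∀ x j → halfPower x (2 + j) +ℚ halfPower x (2 + j) ≡ halfPower x j
    halfPower-step x j = begin-equality
      halfPower x (2 + j) +ℚ halfPower x (2 + j)      ≡⟨ ℚ.*-distribʳ-+ _ (ι x) (ι x) ⟨
      (ι x +ℚ ι x) ÷ ι (2 ^ ⌊ 2 * J + (2 + j) /2⌋)    ≡⟨ cong₂ (λ y m → y ÷ ι (2 ^ ⌊ m /2⌋)) (sym (ι-+ x x))
                                                           (trans (+-suc (2 * J) (suc j)) (cong suc (+-suc (2 * J) j))) ⟩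
      ι (x + x) ÷ ι (2 ^ suc h)                       ≡⟨ fraction-≡ (m^n>0 2 (suc h)) (m^n>0 2 h) (trans (*-distribʳ-+ (2 ^ h) x x)
                                                           (trans (sym (*-distribˡ-+ x (2 ^ h) (2 ^ h))) (cong (λ y → x * (2 ^ h + y)) (sym (+-identityʳ (2 ^ h)))))) ⟩
      halfPower x j                                   ∎
      where h = ⌊ 2 * J + j /2⌋

    -- The terms halve every two steps, so the infinite tail from `N` on amounts to twice
    -- `y N +ℚ y (suc N)`. Adding it back to the partial sum gives an exact identity for the
    -- induction.
    halfPower-sum : ∀ x N → let y = halfPower x in
      sumℚ y N +ℚ ((y N +ℚ y (suc N)) +ℚ (y N +ℚ y (suc N))) ≡ (y 0 +ℚ y 1) +ℚ (y 0 +ℚ y 1)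
    halfPower-sum x zero    = ℚ.+-identityˡ _
    halfPower-sum x (suc N) = begin-equality
      (sumℚ y N +ℚ y N) +ℚ ((y (1 + N) +ℚ y (2 + N)) +ℚ (y (1 + N) +ℚ y (2 + N)))
        ≡⟨ solve 4 (λ s u v w → (s :+ u) :+ ((v :+ w) :+ (v :+ w)) := s :+ ((u :+ v) :+ ((w :+ w) :+ v)))
             refl (sumℚ y N) (y N) (y (1 + N)) (y (2 + N)) ⟩
      sumℚ y N +ℚ ((y N +ℚ y (1 + N)) +ℚ ((y (2 + N) +ℚ y (2 + N)) +ℚ y (1 + N)))
        ≡⟨ cong (λ z → sumℚ y N +ℚ ((y N +ℚ y (1 + N)) +ℚ (z +ℚ y (1 + N)))) (halfPower-step x N) ⟩
      sumℚ y N +ℚ ((y N +ℚ y (1 + N)) +ℚ (y N +ℚ y (1 + N)))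
        ≡⟨ halfPower-sum x N ⟩
      (y 0 +ℚ y 1) +ℚ (y 0 +ℚ y 1) ∎
      where y = halfPower x

    0≤halfPower : ∀ x j → 0ℚ ≤ℚ halfPower x j
    0≤halfPower x j = 0≤÷ (0≤ι x) (0<ι (m^n>0 2 ⌊ 2 * J + j /2⌋))

    halfPower-≤ : ∀ x j → halfPower x j ≤ℚ ι x ÷ ι (2 ^ J)
    halfPower-≤ x j = fraction-≤ (m^n>0 2 ⌊ 2 * J + j /2⌋) (m^n>0 2 J)
      (*-monoʳ-≤ x (^-monoʳ-≤ 2 (≤-trans (≤-reflexive (n≡⌊n+n/2⌋ J)) (⌊n/2⌋-mono J+J≤))))
      where
      J+J≤ : J + J ≤ 2 * J + j
      J+J≤ = ≤-trans (≤-reflexive (cong (J +_) (sym (+-identityʳ J)))) (m≤m+n (2 * J) j)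

    -- Without the tail, twice `y 0 +ℚ y 1` remains. Both terms are at most x / 2^J, because half of
    -- 2J + j is at least J; hence the factor 4, and hence the choice of 2J.
    halfPower-sum-≤ : ∀ x N → sumℚ (halfPower x) N ≤ℚ ι (4 * x) ÷ ι (2 ^ J)
    halfPower-sum-≤ x N = begin
      sumℚ y N                                                            ≡⟨ ℚ.+-identityʳ _ ⟨
      sumℚ y N +ℚ 0ℚ                                                      ≤⟨ ℚ.+-monoʳ-≤ (sumℚ y N) (0≤+ (0≤+ (nn N) (nn (suc N))) (0≤+ (nn N) (nn (suc N)))) ⟩
      sumℚ y N +ℚ ((y N +ℚ y (suc N)) +ℚ (y N +ℚ y (suc N)))              ≡⟨ halfPower-sum x N ⟩
      (y 0 +ℚ y 1) +ℚ (y 0 +ℚ y 1)                                        ≤⟨ ℚ.+-mono-≤ (ℚ.+-mono-≤ (le 0) (le 1)) (ℚ.+-mono-≤ (le 0) (le 1)) ⟩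
      (z +ℚ z) +ℚ (z +ℚ z)                                                ≡⟨ cong₂ _+ℚ_ (sym (ℚ.*-distribʳ-+ _ (ι x) (ι x))) (sym (ℚ.*-distribʳ-+ _ (ι x) (ι x))) ⟩
      (ι x +ℚ ι x) ÷ ι (2 ^ J) +ℚ (ι x +ℚ ι x) ÷ ι (2 ^ J)                ≡⟨ ℚ.*-distribʳ-+ _ (ι x +ℚ ι x) (ι x +ℚ ι x) ⟨
      ((ι x +ℚ ι x) +ℚ (ι x +ℚ ι x)) ÷ ι (2 ^ J)                          ≡⟨ cong (_÷ ι (2 ^ J)) four ⟩
      ι (4 * x) ÷ ι (2 ^ J)                                               ∎
      where
      y = halfPower x
      z = ι x ÷ ι (2 ^ J)
      nn = 0≤halfPower x
      le = halfPower-≤ x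
      0≤+ : ∀ {u v} → 0ℚ ≤ℚ u → 0ℚ ≤ℚ v → 0ℚ ≤ℚ u +ℚ v
      0≤+ = ℚ.+-mono-≤
      four : (ι x +ℚ ι x) +ℚ (ι x +ℚ ι x) ≡ ι (4 * x)
      four = trans (cong₂ _+ℚ_ (sym (ι-+ x x)) (sym (ι-+ x x))) (trans (sym (ι-+ (x + x) (x + x)))
        (cong ι (trans (+-assoc x x (x + x)) (cong (λ k → x + (x + (x + k))) (sym (+-identityʳ x))))))

    -- Summing over the degrees before summing over `j` brings in `power-gcd-sum`, whose saving of
    -- 2^⌊m/2⌋ makes the series in `j` converge.
    simpleBound-sum : ∀ N j → sumℚ (λ i → simpleBound i j) N ≤ℚ halfPower (q * (2 * N)) j
    simpleBound-sum N j = begin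
      sumℚ (λ i → simpleBound i j) N          ≡⟨ sumℚ-* (λ i → ι (q * g i)) (recip (ι (q ^ m))) N ⟩
      sumℚ (λ i → ι (q * g i)) N ÷ ι (q ^ m)  ≡⟨ cong (_÷ ι (q ^ m)) (ι-sum (λ i → q * g i) N) ⟨
      ι (sumTo (λ i → q * g i) N) ÷ ι (q ^ m) ≤⟨ fraction-≤ (m^n>0 q m) (m^n>0 2 ⌊ m /2⌋) (≤-trans (≤-reflexive
                                                   (trans (cong (_* 2 ^ ⌊ m /2⌋) (sumTo-* q g N)) (*-assoc q (sumTo g N) _)))
                                                   (≤-trans (*-monoʳ-≤ q (power-gcd-sum 1<q 1≤m N)) (≤-reflexive (sym (*-assoc q (2 * N) _))))) ⟩
      halfPower (q * (2 * N)) j               ∎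
      where
      m = 2 * J + j
      g : ℕ → ℕ
      g i = gcd (suc i) (q ^ m ∸ 1)
      1≤m : 1 ≤ m
      1≤m = ≤-trans 1≤J (≤-trans (m≤m+n J (J + 0)) (m≤m+n (2 * J) j))

    indicator-sum : ∀ N → ι (sumTo (λ i → indicator (p ^ J ∣? suc i)) N) ≤ℚ ι N ÷ ι (2 ^ J)
    indicator-sum N = ℚ.≤-trans (ℚ.≤-reflexive (sym (*-÷-cancel _ 0<2^J)))
      (*-monoʳ (ℚ.<⇒≤ (0<recip 0<2^J)) (ℚ.≤-trans (ℚ.≤-reflexive (sym (ι-* s (2 ^ J)))) (ι-mono bound)))
      where
      0<2^J = 0<ι (m^n>0 2 J)
      s = sumTo (λ i → indicator (p ^ J ∣? suc i)) N
      bound : s * 2 ^ J ≤ N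
      bound = ≤-trans (*-monoʳ-≤ s (^-monoˡ-≤ J (nonTrivial⇒n>1 p {{prime⇒nonTrivial p-prime}})))
        (≤-trans (≤-reflexive (trans (*-comm s (p ^ J)) (trans (sym (sumTo-* (p ^ J) (λ i → indicator (p ^ J ∣? suc i)) N))
          (sumTo-cong N λ i → *-comm (p ^ J) _)))) (sum-multiples (p ^ J) N))

    -- In the constant, 8q is the 4 of the halving series, times the `q` from the number of simple
    -- submodules, times the 2 of the divisor sum. The 1 accounts for multiples of `p ^ J`, as
    -- `p ^ J` is at least `2 ^ J`.
    error-sum : ∀ N → sumℚ (error N) N ≤ℚ ι ((8 * q + 1) * N) ÷ ι (2 ^ J)
    error-sum N = begin
      sumℚ (error N) N
        ≡⟨ sumℚ-+ (simpleError N) (λ i → ι (indicator (p ^ J ∣? suc i))) N ⟩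
      sumℚ (simpleError N) N +ℚ sumℚ (λ i → ι (indicator (p ^ J ∣? suc i))) N
        ≡⟨ cong₂ _+ℚ_ (sumℚ-swap simpleBound N N) (sym (ι-sum (λ i → indicator (p ^ J ∣? suc i)) N)) ⟩
      sumℚ (λ j → sumℚ (λ i → simpleBound i j) N) N +ℚ ι (sumTo (λ i → indicator (p ^ J ∣? suc i)) N)
        ≤⟨ ℚ.+-mono-≤ (ℚ.≤-trans (sumℚ-mono N (λ j _ → simpleBound-sum N j)) (halfPower-sum-≤ (q * (2 * N)) N)) (indicator-sum N) ⟩
      ι (4 * (q * (2 * N))) ÷ ι (2 ^ J) +ℚ ι N ÷ ι (2 ^ J)
        ≡⟨ trans (sym (ℚ.*-distribʳ-+ _ (ι (4 * (q * (2 * N)))) (ι N))) (cong (_÷ ι (2 ^ J)) (sym (ι-+ (4 * (q * (2 * N))) N))) ⟩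
      ι (4 * (q * (2 * N)) + N) ÷ ι (2 ^ J)
        ≡⟨ cong (λ x → ι x ÷ ι (2 ^ J)) (error-coefficient q N) ⟩
      ι ((8 * q + 1) * N) ÷ ι (2 ^ J) ∎

  limit-periodic : LimitPeriodic density
  limit-periodic {δ} 0<δ = modulus , 1≤modulus , periodic , (λ _ → bounds _) , periodic-periodic ,
    λ N → error N , near-periodic N , (begin
      sumℚ (error N) N                         ≤⟨ error-sum N ⟩
      ι ((8 * q + 1) * N) ÷ ι (2 ^ suc D)      ≤⟨ ≤⇒÷≤ (0<ι (m^n>0 2 (suc D))) (begin
        ι ((8 * q + 1) * N)                      ≡⟨ ι-* (8 * q + 1) N ⟩
        ι (8 * q + 1) *ℚ ι N                     ≤⟨ *-monoʳ (0≤ι N) (small (<⇒≤ (<-trans (n<1+n D) (n<2^n (suc D))))) ⟩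
        δ *ℚ ι (2 ^ suc D) *ℚ ι N                ≡⟨ trans (ℚ.*-assoc δ _ _) (trans (cong (δ *ℚ_) (ℚ.*-comm (ι (2 ^ suc D)) (ι N))) (sym (ℚ.*-assoc δ _ _))) ⟩
        δ *ℚ ι N *ℚ ι (2 ^ suc D)                ∎) ⟩
      δ *ℚ ι N                                 ∎)
    where
    -- With J = D + 1, `2 ^ J` is at least `D`, so (8q + 1) / 2^J is at most `δ`; the successor also
    -- makes `J` positive.
    D = proj₁ (archimedean-* 0<δ (8 * q + 1))
    small = proj₂ (archimedean-* 0<δ (8 * q + 1))
    open Approximation (suc D) (s≤s z≤n)

-- From the cyclic algebra back to the given extensions.

module Densities {c ℓ₁ ℓ₂} {q p e : ℕ} (p-prime : Prime p) (q≡p^e : q ≡ p ^ e) (1<q : 1 < q) (F : FiniteField q c ℓ₁ ℓ₂) where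
  open Estimates using (ι; _÷_; /≡÷)
  open Density {q} {p} {e} p-prime q≡p^e (Strictification.strict F 1<q) using (density)

  normalDensity≡÷ : ∀ {n} (K : Extension F n) k → normalDensity K k ≡ ι (normalCount K k) ÷ ι (q ^ n)
  normalDensity≡÷ {n} K k = /≡÷ (normalCount K k) (q ^ n) {{Extension.order-nonZero K}}

  counts : ∀ {n} (K : Extension F (suc n)) k → normalCount K k ≡ normals (Strictification.strict F 1<q) n k
  counts {n} K k = Normality.normalCount≡normals F n K {p} {e} p-prime q≡p^e 1<q k

  normalDensity≡density : ∀ {n} (K : Extension F (suc n)) k → normalDensity K k ≡ density k n
  normalDensity≡density {n} K k = trans (normalDensity≡÷ K k) (cong (λ x → ι x ÷ ι (q ^ suc n)) (counts K k))

module _ {c ℓ₁ ℓ₂} {q p e : ℕ} (p-prime : Prime p) (q≡p^e : q ≡ p ^ e) (1<q : 1 < q)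
         (F : FiniteField q c ℓ₁ ℓ₂) (K : ∀ n → .⦃ NonZero n ⦄ → Extension F n) (k : ℕ) where
  open Density {q} {p} {e} p-prime q≡p^e (Strictification.strict F 1<q) k using (density; bounds; limit-periodic)
  open Densities {q = q} {p} {e} p-prime q≡p^e 1<q F using (normalDensity≡density)

  densityAt : ∀ n → .⦃ NonZero n ⦄ → ℚ
  densityAt n = normalDensity (K n) k

  densityAt≡density : ∀ i → densityAt (suc i) ≡ density i
  densityAt≡density i = normalDensity≡density (K (suc i)) k

  densityAt-mean : ∃ λ (L : ℝ) → 0ᴿ ≤ᴿ L × HasMeanValue densityAt L
  densityAt-mean = MeanValues.mean-value density bounds limit-periodic densityAt densityAt≡density

1<primePower : ∀ {p e} → Prime p → 1 ≤ e → 1 < p ^ e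
1<primePower {p} {e} p-prime 1≤e = ^-monoʳ-< p (nonTrivial⇒n>1 p {{prime⇒nonTrivial p-prime}}) {0} {e} 1≤e

theorem1p1 : ∀ {c ℓ₁ ℓ₂} (q : ℕ) → IsPrimePower q →
    (F : FiniteField q c ℓ₁ ℓ₂) (K : ∀ n → .⦃ NonZero n ⦄ → Extension F n) →
    (k : ℕ) →
    ∃ λ (L : ℝ) → 0ᴿ ≤ᴿ L × HasMeanValue (λ n → normalDensity (K n) k) L
theorem1p1 q (p , e , p-prime , 1≤e , q≡p^e) F K k =
  densityAt-mean {e = e} p-prime q≡p^e (subst (1 <_) (sym q≡p^e) (1<primePower p-prime 1≤e)) F K k
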